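{- Let $q \geq 2$ be an integer, and let $\mathbb{F}$ be a finite field. (1) There exists an algorithm for the Storage Capacity$_q$ problem whose running time on a graph on $n$ vertices and an integer $k$ is $n^{O(1)} \cdot \widetilde{O}(1.1996^{q^{3k}})$. (2) There exists an algorithm for the Dual Index Coding$_q$ problem whose running time on a graph on $n$ vertices and an integer $k$ is $n^{O(1)} \cdot \widetilde{O}(2^{q^{3k}})$. (3) There exists an algorithm for the Dual Minrank$_{\mathbb{F}}$ problem whose running time on a graph on $n$ vertices and an integer $k$ is $n^{O(1)} \cdot |\mathbb{F}|^{9k^2}$.
   Context: All graphs are finite, undirected and simple. $N_G(i)$ denotes the set of vertices adjacent to $i$ in $G$ (so $i \notin N_G(i)$), $[n]=\{1,\dots,n\}$, and $x_S$ denotes the restriction of a vector $x$ to the entries with indices in $S$. The $\widetilde{O}$ notation hides poly-logarithmic multiplicative factors (i.e., factors poly-logarithmic in its argument). The integer $q$ and the field $\mathbb{F}$ are fixed (not part of the input). Storage capacity: for a graph $G$ on $[n]$ and $q \geq 2$, $\mathrm{Cap}_q(G)$ is the maximum of $\log_q |C|$ over all codes $C \subseteq [q]^n$ such that for every $x \in C$ and $i \in [n]$, the value of $x_i$ can be determined from $x_{N_G(i)}$ (i.e., for all $x,y \in C$ and $i \in [n]$, $x_{N_G(i)} = y_{N_G(i)}$ implies $x_i=y_i$). Index coding: an index code of length $\ell$ over an alphabet $\Sigma$ for a graph $G$ on $[n]$ is a function $E:\Sigma^n \to \Sigma^\ell$ such that for each $i \in [n]$ there exists a decoding function $g_i:\Sigma^{\ell+|N_G(i)|}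 \to \Sigma$ with $g_i(E(x),x_{N_G(i)})=x_i$ for all $x \in \Sigma^n$. $\mathrm{Ind}_q(G)$ is the smallest integer $\ell\ge 0$ for which there exists an index code of length $\ell$ over $[q]$ for $G$. Minrank: a matrix $A \in \mathbb{F}^{n \times n}$ represents a graph $G$ on $[n]$ over $\mathbb{F}$ if $A_{i,i} \neq 0$ for every $i \in [n]$, and $A_{i,j}=0$ for every pair of distinct non-adjacent vertices $i,j$ of $G$. $\mathrm{minrk}_{\mathbb{F}}(G)$ is the minimum of $\mathrm{rank}_{\mathbb{F}}(A)$ over all matrices $A$ representing $G$ over $\mathbb{F}$. Problems (input: a graph $G$ on $n$ vertices and an integer $k \geq 0$): Storage Capacity$_q$ asks to decide whether $\mathrm{Cap}_q(G) \geq k$; Dual Index Coding$_q$ asks to decide whether $\mathrm{Ind}_q(G) \leq n-k$; Dual Minrank$_{\mathbb{F}}$ asks to decide whether $\mathrm{minrk}_{\mathbb{F}}(G) \leq n-k$. -}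

module Defs where

open import Level using (Level; _⊔_; suc)
open import Algebra.Bundles using (CommutativeRing)
open import Data.Bool.Base using (Bool; true; false; if_then_else_)
open import Data.Fin.Base using (Fin; fromℕ<; remQuot)
open import Data.List.Base using (List; length; filterᵇ; allFin)
open import Data.List.Membership.Propositional using (_∈_)
open import Data.List.Relation.Unary.Unique.Propositional using (Unique)
open import Data.Nat.Base as ℕ
  using (ℕ; zero; NonZero; _+_; _*_; _∸_; _^_; _≤_; _/_; _%_)
open import Data.Nat.Logarithm using (⌊log₂_⌋; ⌈log₂_⌉)
open import Data.Nat.Properties using (_≟_; _<?_; m^n≢0)
open import Data.Product.Base using (∃; ∃-syntax; _×_; _,_; uncurry)
open import Data.Sum.Base using (_⊎_)
open import Data.Vec.Base using (Vec; lookup; map; fromList; _++_)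
open import Function.Bundles using (Inverse)
open import Relation.Binary.PropositionalEquality using (_≡_; _≢_; setoid)
open import Relation.Nullary using (¬_; yes; no; does)

private
  variable
    a : Level
    n : ℕ

IsMaximum : (ℕ → Set a) → ℕ → Set a
IsMaximum P m = P m × (∀ m′ → P m′ → m′ ≤ m)

IsMinimum : (ℕ → Set a) → ℕ → Set a
IsMinimum P m = P m × (∀ m′ → P m′ → m ≤ m′)

record Graph (n : ℕ) : Set where
  field
    adj       : Fin n → Fin n → Bool
    symmetric : ∀ i j → adj i j ≡ adj j i
    loopless  : ∀ i → adj i i ≡ false

open Graph public

N : Graph n → Fin n → List (Fin n)
N {n} G i = filterᵇ (adj G i) (allFin n)

_↾_ : {A : Set a} → Vec A n → (S : List (Fin n)) → Vec A (length S)
x ↾ S = map (lookup x) (fromList S)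

Problem : ∀ a → Set (suc a)
Problem a = ∀ n → Graph n → ℕ → Set a

------------------------------------------------------------------------
-- Storage capacity

IsStorageCode : ∀ q → Graph n → List (Vec (Fin q) n) → Set
IsStorageCode q G C =
  ∀ x y → x ∈ C → y ∈ C → ∀ i → x ↾ N G i ≡ y ↾ N G i → lookup x i ≡ lookup y i

HasStorageCode : ∀ q → Graph n → ℕ → Set
HasStorageCode q G m =
  ∃[ C ] Unique C × IsStorageCode q G C × length C ≡ m

-- If m is the maximum size of a code, then Cap_q(G) = log_q m, so that
-- Cap_q(G) ≥ k means q ^ k ≤ m.
StorageCapacity : ℕ → Problem Level.zero
StorageCapacity q n G k =
  ∃[ m ] IsMaximum (HasStorageCode q G) m × q ^ k ≤ m

------------------------------------------------------------------------
-- Index coding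

record IndexCode (q : ℕ) {n : ℕ} (G : Graph n) (ℓ : ℕ) : Set where
  field
    E       : Vec (Fin q) n → Vec (Fin q) ℓ
    g       : ∀ i → Vec (Fin q) (ℓ + length (N G i)) → Fin q
    decodes : ∀ i x → g i (E x ++ (x ↾ N G i)) ≡ lookup x i

-- Ind_q(G) ≤ n - k, where n - k may be negative.
DualIndexCoding : ℕ → Problem Level.zero
DualIndexCoding q n G k =
  ∃[ ℓ ] IsMinimum (IndexCode q G) ℓ × ℓ + k ≤ n

------------------------------------------------------------------------
-- Minrank

record FiniteField c ℓ : Set (suc (c ⊔ ℓ)) where
  field
    commutativeRing : CommutativeRing c ℓ

  open CommutativeRing commutativeRing public
    renaming (_+_ to _+ᶠ_; _*_ to _*ᶠ_; setoid to setoidᶠ)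

  field
    0≉1     : ¬ (0# ≈ 1#)
    inverse : ∀ x → ¬ (x ≈ 0#) → ∃[ y ] (x *ᶠ y) ≈ 1#
    order   : ℕ
    finite  : Inverse setoidᶠ (setoid (Fin order))

module _ {c ℓ} (F : FiniteField c ℓ) where
  open FiniteField F
  open import Algebra.Properties.CommutativeMonoid.Sum +-commutativeMonoid
    using (sum)

  Matrix : ℕ → Set c
  Matrix n = Fin n → Fin n → Carrier

  -- Linear independence of the columns of A with indices f 0, …, f (r - 1);
  -- it forces f to be injective.
  IndependentColumns : ∀ {n r} → Matrix n → (Fin r → Fin n) → Set (c ⊔ ℓ)
  IndependentColumns A f =
    ∀ (u : _ → Carrier) →
    (∀ i → sum (λ j → u j *ᶠ A i (f j)) ≈ 0#) → ∀ j → u j ≈ 0#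

  IsRank : Matrix n → ℕ → Set (c ⊔ ℓ)
  IsRank {n} A = IsMaximum λ r → ∃[ f ] IndependentColumns {n} {r} A f

  Represents : Matrix n → Graph n → Set ℓ
  Represents A G =
    (∀ i → ¬ (A i i ≈ 0#)) ×
    (∀ i j → i ≢ j → adj G i j ≡ false → A i j ≈ 0#)

  IsMinrank : Graph n → ℕ → Set (c ⊔ ℓ)
  IsMinrank G = IsMinimum λ r → ∃[ A ] Represents A G × IsRank A r

  -- minrk_F(G) ≤ n - k, where n - k may be negative.
  DualMinrank : Problem (c ⊔ ℓ)
  DualMinrank n G k = ∃[ r ] IsMinrank G r × r + k ≤ n

------------------------------------------------------------------------
-- Algorithms: while programs on a random access machine under the
-- logarithmic cost criterion, where an operation costs the total bit
-- length of the numbers (operands, addresses and contents) it handles.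
-- The memory consists of unbounded arrays of natural numbers.  Array
-- names are literals in the program text, so each program uses only
-- finitely many arrays.

Memory : Set
Memory = ℕ → ℕ → ℕ

store : Memory → ℕ → ℕ → ℕ → Memory
store s b i v b′ i′ =
  if does (b′ ≟ b) then (if does (i′ ≟ i) then v else s b′ i′) else s b′ i′

data Op : Set where
  add monus mul quot rem : Op

-- Division by zero yields zero.
⟦_⟧ : Op → ℕ → ℕ → ℕ
⟦ add   ⟧ u v              = u + v
⟦ monus ⟧ u v              = u ∸ v
⟦ mul   ⟧ u v              = u * v
⟦ quot  ⟧ u zero           = zero
⟦ quot  ⟧ u v@(ℕ.suc _)    = u / v
⟦ rem   ⟧ u zero           = zero
⟦ rem   ⟧ u v@(ℕ.suc _)    = u % v

data Expr : Set where
  lit  : ℕ → Expr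
  _[_] : ℕ → Expr → Expr
  op   : Op → Expr → Expr → Expr

infix  6 _[_]≔_
infixr 5 _⨾_

data Program : Set where
  skip           : Program
  _[_]≔_         : ℕ → Expr → Expr → Program
  _⨾_            : Program → Program → Program
  ifⁿ_then_else_ : Expr → Program → Program → Program
  while_repeat_  : Expr → Program → Program

eval : Memory → Expr → ℕ
eval s (lit v)      = v
eval s (b [ e ])    = s b (eval s e)
eval s (op o e₁ e₂) = ⟦ o ⟧ (eval s e₁) (eval s e₂)

bits : ℕ → ℕ
bits v = 1 + ⌊log₂ v ⌋

cost : Memory → Expr → ℕ
cost s (lit v)        = bits v
cost s e@(b [ e₁ ])   = cost s e₁ + bits (eval s e₁) + bits (eval s e)
cost s (op o e₁ e₂)   =
  cost s e₁ + cost s e₂ + bits (eval s e₁) + bits (eval s e₂)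

testCost : Memory → Expr → ℕ
testCost s e = cost s e + bits (eval s e)

-- ⟨ P , s ⟩⇓⟨ s′ , t ⟩ : started in s, P halts in s′ after time t.
-- A test succeeds if its value is nonzero.
data ⟨_,_⟩⇓⟨_,_⟩ : Program → Memory → Memory → ℕ → Set where

  skip : ∀ {s} → ⟨ skip , s ⟩⇓⟨ s , 1 ⟩

  assign : ∀ {s b e₁ e₂} →
    ⟨ b [ e₁ ]≔ e₂ , s ⟩⇓⟨ store s b (eval s e₁) (eval s e₂) ,
      cost s e₁ + cost s e₂ + bits (eval s e₁) + bits (eval s e₂) ⟩

  seq : ∀ {P Q s s′ s″ t t′} →
    ⟨ P , s ⟩⇓⟨ s′ , t ⟩ → ⟨ Q , s′ ⟩⇓⟨ s″ , t′ ⟩ →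
    ⟨ P ⨾ Q , s ⟩⇓⟨ s″ , t + t′ ⟩

  if-true : ∀ {e P Q s s′ t} → eval s e ≢ 0 →
    ⟨ P , s ⟩⇓⟨ s′ , t ⟩ →
    ⟨ ifⁿ e then P else Q , s ⟩⇓⟨ s′ , testCost s e + t ⟩

  if-false : ∀ {e P Q s s′ t} → eval s e ≡ 0 →
    ⟨ Q , s ⟩⇓⟨ s′ , t ⟩ →
    ⟨ ifⁿ e then P else Q , s ⟩⇓⟨ s′ , testCost s e + t ⟩

  while-true : ∀ {e P s s′ s″ t t′} → eval s e ≢ 0 →
    ⟨ P , s ⟩⇓⟨ s′ , t ⟩ → ⟨ while e repeat P , s′ ⟩⇓⟨ s″ , t′ ⟩ →
    ⟨ while e repeat P , s ⟩⇓⟨ s″ , testCost s e + (t + t′) ⟩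

  while-false : ∀ {e P s} → eval s e ≡ 0 →
    ⟨ while e repeat P , s ⟩⇓⟨ s , testCost s e ⟩

-- Row-major adjacency matrix.
adjBit : Graph n → ℕ → ℕ
adjBit {n} G m with m <? n * n
... | yes m<n² = if uncurry (adj G) (remQuot n (fromℕ< m<n²)) then 1 else 0
... | no  _    = 0

-- Array 0 starts with n and k, array 1 holds the adjacency matrix, and
-- all other cells are zero.
input : Graph n → ℕ → Memory
input {n} G k 0 0 = n
input G k 0 1 = k
input G k 1 m = adjBit G m
input G k _ _ = 0

output : Memory → ℕ
output s = s 0 0

Solvable_InTime_ : Problem a → (ℕ → ℕ → ℕ) → Set a
Solvable Π InTime T =
  ∃[ P ] ∀ n (G : Graph n) k → ∃[ s ] ∃[ t ]
    ⟨ P , input G k ⟩⇓⟨ s , t ⟩ ×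
    t ≤ T n k ×
    ((output s ≡ 1 × Π n G k) ⊎ (output s ≡ 0 × ¬ Π n G k))

------------------------------------------------------------------------
-- Growth rates

-- p(n) = n^{O(1)}; the shift by one accounts for n ≤ 1, where powers of n
-- do not leave room for constants.
Polynomial : (ℕ → ℕ) → Set
Polynomial p = ∃[ C ] ∃[ c ] ∀ n → p n ≤ C * (1 + n) ^ c

_∈Õ_ : (ℕ → ℕ) → (ℕ → ℕ) → Set
f ∈Õ g = ∃[ C ] ∃[ d ] ∀ k → f k ≤ C * g k * (1 + ⌈log₂ g k ⌉) ^ d

⌈_÷_⌉ : (u v : ℕ) .{{_ : NonZero v}} → ℕ
⌈ u ÷ v ⌉ = (u + (v ∸ 1)) / v

-- 1.1996 ^ N rounded up, which does not affect Õ since 1.1996 ^ N ≥ 1.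
⌈1·1996^_⌉ : ℕ → ℕ
⌈1·1996^ N ⌉ = ⌈ 11996 ^ N ÷ 10000 ^ N ⌉ {{m^n≢0 10000 N}}

{-# OPTIONS --safe #-}

-- Let Y(G, k) be a yes-instance of one of the three problems.  In each of them
-- two adjacent new vertices raise the attainable k by one, deleting a vertex
-- lowers it by at most one, and deleting an isolated vertex does not change it.
-- Let S be the set of vertices covered by a greedy maximal matching.  If
-- |S| ≥ 2k, the answer is yes; otherwise choose A ⊆ S that maximizes
-- |A| - |J|, where J = N(A) ∖ S.  Hall's theorem matches J into A and the heads
-- H = S ∖ A into the independent rest, so Y(G, |H| + |J|) holds, and
-- Y(G, k) ⇔ Y(G[A ∪ J], k - |H|).  If |H| + |J| < k, this core has at most
-- 3(k - 1) vertices.  The three vertices saved against 3k pay for plain brute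
-- force on the N ≤ q ^ (3(k - 1)) words over the core: all 2 ^ N sets of words
-- for storage codes, a dynamic program over sets of words for index codes.
-- For minrank all matrices on the core, with the independence of each set of
-- columns tested by trying all combinations, stay within |F| ^ (9k²).

module Submission where

import Algebra.Properties.CommutativeMonoid.Sum
import Algebra.Properties.Ring
open import Data.Bool.Base using (Bool; true; false; not; _∧_; _∨_; if_then_else_; T)
open import Data.Bool.Properties using (T?)
open import Data.Empty using (⊥; ⊥-elim)
import Data.Fin.Base as Fin
open import Data.Fin.Base using (Fin; toℕ; fromℕ<; remQuot)
import Data.Fin.Properties as Fin
open import Data.Fin.Properties
  using (toℕ<n; toℕ-injective; toℕ-fromℕ<; ¬Fin0; remQuot-combine; toℕ-combine; fromℕ<-toℕ)
import Data.List.Base as List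
open import Data.List.Base using (List; []; _∷_)
open import Data.List.Membership.Propositional using (_∈_)
open import Data.List.Membership.Propositional.Properties
  using (∈-lookup; ∈-filter⁺; ∈-filter⁻; ∈-allFin; ∈-tabulate⁻)
import Data.List.Properties as List
import Data.List.Relation.Unary.All as All
open import Data.List.Relation.Unary.AllPairs using (_∷_)
open import Data.List.Relation.Unary.Any using (here; there)
open import Data.List.Relation.Unary.Unique.Propositional using (Unique)
import Data.List.Relation.Unary.Unique.Propositional.Properties as Unique
open import Data.Nat.Base
  using (ℕ; zero; suc; NonZero; _+_; _*_; _∸_; _^_; _/_; _%_; _⊔_; ⌊_/2⌋; _≤_; _<_; z≤n; s≤s; z<s; _≡ᵇ_; _≤ᵇ_; >-nonZero)
open import Data.Nat.DivMod
open import Data.Nat.Logarithm using (⌊log₂_⌋; ⌊log₂⌊n/2⌋⌋≡⌊log₂n⌋∸1)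
open import Data.Nat.Properties
open import Data.Nat.Tactic.RingSolver using (solve-∀)
open import Data.Product.Base using (∃-syntax; _×_; _,_; proj₁; proj₂; uncurry)
open import Data.Sum.Base using (_⊎_; inj₁; inj₂)
open import Data.Unit.Base using (tt)
import Data.Vec.Base as Vec
open import Data.Vec.Base using (Vec; []; _∷_)
import Data.Vec.Properties as Vec
open import Data.Vec.Properties using (lookup∘tabulate; tabulate∘lookup; tabulate-cong; ++-injectiveˡ; ++-injectiveʳ)
open import Defs
open import Function.Base using (_∘_; case_of_)
open import Function.Bundles using (Inverse)
import Level
open import Relation.Binary.Definitions using (tri<; tri≈; tri>)
open import Relation.Binary.PropositionalEquality
  using (_≡_; _≢_; refl; sym; trans; cong; cong₂; subst; subst₂; setoid; module ≡-Reasoning)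
open import Relation.Nullary using (¬_; yes; no; does)

-- Counting and digits

-- The time bounds concern concrete programs under logarithmic cost, so value and cost of every term
-- are proved together, the cost as a budget `R ^ δ * X ^ ε * L`: `R` collects what is polynomial,
-- `X` is the one exponential quantity, `L` bounds the length of numbers. Only ε must be tracked
-- exactly; δ is a constant, rounded up freely. Sets, words, matrices and tables are single numbers,
-- so `L` may itself cost a factor `X`. Origin of the exponents, for k ≥ 1: q ^ 3 ≥ 8 gives q ^ (3k)
-- ≥ 8N. As 1.1996 ^ 4 ≥ 2, storage codes may spend 2 ^ (2N): one factor for the sets of words, one
-- that absorbs powers of N. Index codes may spend 2 ^ (8N) and spend 2 ^ (5N). For minrank, with m
-- = k - 1, the search spends |F| ^ (9m² + 11m), below |F| ^ (9k²). The set A is found by trying all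
-- subsets of S instead of computing matchings: there are at most 4 ^ (k - 1) of them, at most N for
-- codes and at most |F| ^ (2m) for minrank. All case distinctions are Boolean searches over encoded
-- finite sets, which keeps the argument constructive; Hall's theorem and the existence of the
-- optima are obtained in the same way.

𝟙 : Bool → ℕ
𝟙 true  = 1
𝟙 false = 0

sum : ℕ → (ℕ → ℕ) → ℕ
sum zero    f = 0
sum (suc n) f = sum n f + f n

count : ℕ → (ℕ → Bool) → ℕ
count n P = sum n (𝟙 ∘ P)

any : ℕ → (ℕ → Bool) → Bool
any zero    P = false
any (suc n) P = any n P ∨ P n

all : ℕ → (ℕ → Bool) → Bool
all n P = not (any n (not ∘ P))

b-dec : ∀ b → b ≡ true ⊎ b ≡ false
b-dec true  = inj₁ refl
b-dec false = inj₂ refl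

absurd : ∀ {a} {A : Set a} {b} → b ≡ true → b ≡ false → A
absurd refl ()

∧-intro : ∀ {a b} → a ≡ true → b ≡ true → a ∧ b ≡ true
∧-intro refl refl = refl

∧-left : ∀ {a b} → a ∧ b ≡ true → a ≡ true
∧-left {true} _ = refl

∧-right : ∀ {a b} → a ∧ b ≡ true → b ≡ true
∧-right {true} p = p

∨-left : ∀ {a b} → a ≡ true → a ∨ b ≡ true
∨-left refl = refl

∨-right : ∀ {a b} → b ≡ true → a ∨ b ≡ true
∨-right {true}  _ = refl
∨-right {false} p = p

∨-elim : ∀ {a b} → a ∨ b ≡ true → a ≡ true ⊎ b ≡ true
∨-elim {true}  _ = inj₁ refl
∨-elim {false} p = inj₂ p

not-intro : ∀ {a} → a ≡ false → not a ≡ true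
not-intro refl = refl

not-elim : ∀ {a} → not a ≡ true → a ≡ false
not-elim {false} _ = refl

not-false : ∀ {a} → not a ≡ false → a ≡ true
not-false {true} _ = refl

≢true : ∀ {a} → ¬ (a ≡ true) → a ≡ false
≢true {true}  f = ⊥-elim (f refl)
≢true {false} _ = refl

bool-ext : ∀ {a b} → (a ≡ true → b ≡ true) → (b ≡ true → a ≡ true) → a ≡ b
bool-ext {true}  {b}     f g = sym (f refl)
bool-ext {false} {true}  f g = g refl
bool-ext {false} {false} f g = refl

≡ᵇ-sound : ∀ {m n} → (m ≡ᵇ n) ≡ true → m ≡ n
≡ᵇ-sound {zero}  {zero}  _ = refl
≡ᵇ-sound {suc m} {suc n} p = cong suc (≡ᵇ-sound p)

≡ᵇ-refl : ∀ n → (n ≡ᵇ n) ≡ true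
≡ᵇ-refl zero    = refl
≡ᵇ-refl (suc n) = ≡ᵇ-refl n

≡ᵇ-complete : ∀ {m n} → m ≡ n → (m ≡ᵇ n) ≡ true
≡ᵇ-complete {m} refl = ≡ᵇ-refl m

≢⇒≡ᵇ : ∀ m n → m ≢ n → (m ≡ᵇ n) ≡ false
≢⇒≡ᵇ m n f = ≢true (f ∘ ≡ᵇ-sound {m} {n})

≡ᵇ-false : ∀ m n → (m ≡ᵇ n) ≡ false → m ≢ n
≡ᵇ-false m n p refl = absurd (≡ᵇ-refl m) p

≤ᵇ-sound : ∀ {m n} → (m ≤ᵇ n) ≡ true → m ≤ n
≤ᵇ-sound {m} {n} p = ≤ᵇ⇒≤ m n (subst T (sym p) _)

≤ᵇ-complete : ∀ {m n} → m ≤ n → (m ≤ᵇ n) ≡ true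
≤ᵇ-complete {m} {n} p with b-dec (m ≤ᵇ n)
... | inj₁ q = q
... | inj₂ q = ⊥-elim (subst T q (≤⇒≤ᵇ p))

≤ᵇ-false : ∀ {m n} → (m ≤ᵇ n) ≡ false → n < m
≤ᵇ-false p = ≰⇒> λ q → absurd (≤ᵇ-complete q) p

<suc-case : ∀ {a} {A : Set a} {i n} → i < suc n → (i < n → A) → (i ≡ n → A) → A
<suc-case p f g with m<1+n⇒m<n∨m≡n p
... | inj₁ q = f q
... | inj₂ q = g q

any-elim : ∀ n {P} → any n P ≡ true → ∃[ i ] i < n × P i ≡ true
any-elim (suc n) {P} p with ∨-elim {any n P} p
... | inj₁ q = let i , i<n , r = any-elim n q in i , m<n⇒m<1+n i<n , r
... | inj₂ q = n , n<1+n n , q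

any-intro : ∀ n {P i} → i < n → P i ≡ true → any n P ≡ true
any-intro (suc n) {P} {i} i<n p = <suc-case i<n
  (λ q → ∨-left (any-intro n q p))
  (λ where refl → ∨-right {any n P} p)

any-false : ∀ n {P i} → any n P ≡ false → i < n → P i ≡ false
any-false n p i<n = ≢true λ q → absurd (any-intro n i<n q) p

all-elim : ∀ n {P i} → all n P ≡ true → i < n → P i ≡ true
all-elim n p i<n = not-false (any-false n (not-elim p) i<n)

all-intro : ∀ n {P} → (∀ i → i < n → P i ≡ true) → all n P ≡ true
all-intro n {P} f = not-intro (≢true λ p →
  let i , i<n , q = any-elim n p in absurd (f i i<n) (not-elim q))

any-cong : ∀ n {P Q} → (∀ i → i < n → P i ≡ Q i) → any n P ≡ any n Q
any-cong zero    f = refl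
any-cong (suc n) f = cong₂ _∨_ (any-cong n λ i p → f i (m<n⇒m<1+n p)) (f n (n<1+n n))

-- Replaces excluded middle wherever a case distinction below asks for a witness in a bounded range.
search : ∀ n (P : ℕ → Bool) → (∃[ i ] i < n × P i ≡ true) ⊎ (∀ i → i < n → P i ≡ false)
search n P with b-dec (any n P)
... | inj₁ p = inj₁ (any-elim n p)
... | inj₂ p = inj₂ λ i → any-false n p

sum-cong : ∀ n {f g} → (∀ i → i < n → f i ≡ g i) → sum n f ≡ sum n g
sum-cong zero    h = refl
sum-cong (suc n) h = cong₂ _+_ (sum-cong n λ i p → h i (m<n⇒m<1+n p)) (h n (n<1+n n))

sum-mono : ∀ n {f g} → (∀ i → i < n → f i ≤ g i) → sum n f ≤ sum n g
sum-mono zero    h = z≤n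
sum-mono (suc n) h = +-mono-≤ (sum-mono n λ i p → h i (m<n⇒m<1+n p)) (h n (n<1+n n))

+-interchange : ∀ a b c d → (a + b) + (c + d) ≡ (a + c) + (b + d)
+-interchange = solve-∀

sum-+ : ∀ n f g → sum n (λ i → f i + g i) ≡ sum n f + sum n g
sum-+ zero    f g = refl
sum-+ (suc n) f g = trans (cong (_+ (f n + g n)) (sum-+ n f g))
  (+-interchange (sum n f) (sum n g) (f n) (g n))

sum-const : ∀ n c → sum n (λ _ → c) ≡ n * c
sum-const zero    c = refl
sum-const (suc n) c = trans (cong (_+ c) (sum-const n c)) (+-comm (n * c) c)

sum-zero : ∀ n {f} → (∀ i → i < n → f i ≡ 0) → sum n f ≡ 0
sum-zero n h = trans (sum-cong n h) (trans (sum-const n 0) (*-zeroʳ n))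

sum-swap : ∀ m n (f : ℕ → ℕ → ℕ) → sum m (λ i → sum n (f i)) ≡ sum n (λ j → sum m (λ i → f i j))
sum-swap zero    n f = sym (sum-zero n λ _ _ → refl)
sum-swap (suc m) n f = trans (cong (_+ sum n (f m)) (sum-swap m n f))
  (sym (sum-+ n (λ j → sum m (λ i → f i j)) (f m)))

𝟙≤1 : ∀ b → 𝟙 b ≤ 1
𝟙≤1 true  = ≤-refl
𝟙≤1 false = z≤n

𝟙-mono : ∀ {a b} → (a ≡ true → b ≡ true) → 𝟙 a ≤ 𝟙 b
𝟙-mono {false} f = z≤n
𝟙-mono {true}  f rewrite f refl = ≤-refl

𝟙-∨ : ∀ a b → 𝟙 (a ∨ b) ≤ 𝟙 a + 𝟙 b
𝟙-∨ true  b = m≤m+n 1 _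
𝟙-∨ false b = ≤-refl

𝟙-disjoint : ∀ {a b} → (a ≡ true → b ≡ false) → 𝟙 (a ∨ b) ≡ 𝟙 a + 𝟙 b
𝟙-disjoint {false} f = refl
𝟙-disjoint {true}  f rewrite f refl = refl

count-cong : ∀ n {P Q} → (∀ i → i < n → P i ≡ Q i) → count n P ≡ count n Q
count-cong n h = sum-cong n λ i p → cong 𝟙 (h i p)

count-mono : ∀ n {P Q} → (∀ i → i < n → P i ≡ true → Q i ≡ true) → count n P ≤ count n Q
count-mono n h = sum-mono n λ i p → 𝟙-mono (h i p)

count≤n : ∀ n P → count n P ≤ n
count≤n n P = ≤-trans (sum-mono n λ i _ → 𝟙≤1 (P i)) (≤-reflexive (trans (sum-const n 1) (*-identityʳ n)))

count-true : ∀ n → count n (λ _ → true) ≡ n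
count-true n = trans (sum-const n 1) (*-identityʳ n)

count-none : ∀ n {P} → (∀ i → i < n → P i ≡ false) → count n P ≡ 0
count-none n h = sum-zero n λ i p → cong 𝟙 (h i p)

count-∪ : ∀ n {P Q} → (∀ i → i < n → P i ≡ true → Q i ≡ false) →
  count n (λ i → P i ∨ Q i) ≡ count n P + count n Q
count-∪ n {P} {Q} h = trans (sum-cong n λ i p → 𝟙-disjoint (h i p)) (sum-+ n (𝟙 ∘ P) (𝟙 ∘ Q))

count-⊆∪ : ∀ n {P Q R} → (∀ i → i < n → R i ≡ true → P i ∨ Q i ≡ true) →
  count n R ≤ count n P + count n Q
count-⊆∪ n {P} {Q} h = ≤-trans (sum-mono n λ i p → ≤-trans (𝟙-mono (h i p)) (𝟙-∨ (P i) (Q i)))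
  (≤-reflexive (sum-+ n (𝟙 ∘ P) (𝟙 ∘ Q)))

count-pos : ∀ n {P i} → i < n → P i ≡ true → 0 < count n P
count-pos (suc n) {P} {i} i<n p = <suc-case i<n
  (λ q → ≤-trans (count-pos n q p) (m≤m+n _ _))
  (λ where refl → ≤-trans (≤-reflexive (cong 𝟙 (sym p))) (m≤n+m _ (count n P)))

count-mono-bound : ∀ {m n} P → m ≤ n → count m P ≤ count n P
count-mono-bound {m} {zero}  P z≤n = z≤n
count-mono-bound {m} {suc n} P m≤n with m≤n⇒m<n∨m≡n m≤n
... | inj₁ (s≤s q) = ≤-trans (count-mono-bound P q) (m≤m+n _ _)
... | inj₂ refl = ≤-refl

rank-< : ∀ {u n} P → P u ≡ true → u < n → count u P < count n P
rank-< {u} P p u<n = ≤-trans (≤-reflexive (trans (+-comm 1 (count u P)) (cong (λ b → count u P + 𝟙 b) (sym p))))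
  (count-mono-bound P u<n)

rank-injective : ∀ {u v} P → P u ≡ true → P v ≡ true → count u P ≡ count v P → u ≡ v
rank-injective {u} {v} P p q e with <-cmp u v
... | tri< l _ _ = ⊥-elim (<-irrefl e (rank-< P p l))
... | tri≈ _ l _ = l
... | tri> _ _ l = ⊥-elim (<-irrefl (sym e) (rank-< P q l))

-- Inverse of the rank `count v P`: the element of P that has exactly i elements of P before it. The
-- value 0 is a default for i out of range.
select : ℕ → (ℕ → Bool) → ℕ → ℕ
select zero    P i = 0
select (suc n) P i = if P n ∧ (count n P ≡ᵇ i) then n else select n P i

select-rank : ∀ n P {v} → v < n → P v ≡ true → select n P (count v P) ≡ v
select-rank (suc n) P {v} v<n p = <suc-case v<n
  (λ q → trans (cong (if_then n else select n P (count v P))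
      (≢true λ r → <-irrefl (sym (≡ᵇ-sound {count n P} (∧-right {P n} r))) (rank-< P p q)))
    (select-rank n P q p))
  (λ where refl → cong (if_then v else select v P (count v P)) (∧-intro p (≡ᵇ-refl (count v P))))

record Selected (n : ℕ) (P : ℕ → Bool) (i v : ℕ) : Set where
  constructor selected
  field
    bound  : v < n
    member : P v ≡ true
    ranked : count v P ≡ i

select-spec : ∀ n P {i} → i < count n P → Selected n P i (select n P i)
select-spec (suc n) P {i} i<c with b-dec (P n) | b-dec (count n P ≡ᵇ i)
... | inj₁ p | inj₁ e rewrite p | e = selected (n<1+n n) p (≡ᵇ-sound {count n P} e)
... | inj₁ p | inj₂ e rewrite p | e = let selected b m r = select-spec n P i<n in selected (m<n⇒m<1+n b) m r
  where i<n = ≤∧≢⇒< (m<1+n⇒m≤n (subst (i <_) (+-comm (count n P) 1) i<c)) (≡ᵇ-false (count n P) i e ∘ sym)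
... | inj₂ p | _ rewrite p = let selected b m r = select-spec n P i<n in selected (m<n⇒m<1+n b) m r
  where i<n = subst (i <_) (+-identityʳ (count n P)) i<c

ins del : (ℕ → Bool) → ℕ → ℕ → Bool
ins P v u = P u ∨ (u ≡ᵇ v)
del P v u = P u ∧ not (u ≡ᵇ v)

count-single : ∀ n v → v < n → count n (_≡ᵇ v) ≡ 1
count-single (suc n) v v<n = <suc-case v<n
  (λ q → trans (cong₂ _+_ (count-single n v q) (cong 𝟙 (≢⇒≡ᵇ n v λ e → <-irrefl (sym e) q))) (+-identityʳ 1))
  (λ where refl → cong₂ _+_ (count-none v λ i p → ≢⇒≡ᵇ i v (<⇒≢ p)) (cong 𝟙 (≡ᵇ-refl v)))

count-ins : ∀ n {P v} → v < n → P v ≡ false → count n (ins P v) ≡ suc (count n P)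
count-ins n {P} {v} v<n p = trans (count-∪ n disj) (trans (cong (count n P +_) (count-single n v v<n)) (+-comm _ 1))
  where
    disj : ∀ i → i < n → P i ≡ true → (i ≡ᵇ v) ≡ false
    disj i _ q = ≢⇒≡ᵇ i v λ where refl → absurd q p

ins-self : ∀ P v → ins P v v ≡ true
ins-self P v = ∨-right {P v} (≡ᵇ-refl v)

ins-old : ∀ P {u} v → P u ≡ true → ins P v u ≡ true
ins-old P v p = ∨-left p

ins-other : ∀ P {u v} → u ≢ v → ins P v u ≡ P u
ins-other P {u} {v} f with P u
... | true  = refl
... | false = ≢⇒≡ᵇ u v f

ins-elim : ∀ P {u v} → ins P v u ≡ true → P u ≡ true ⊎ u ≡ v
ins-elim P {u} p with ∨-elim {P u} p
... | inj₁ q = inj₁ q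
... | inj₂ q = inj₂ (≡ᵇ-sound q)

del-self : ∀ P v → del P v v ≡ false
del-self P v = ≢true λ p → absurd (≡ᵇ-refl v) (not-elim (∧-right {P v} p))

del-other : ∀ P {u v} → u ≢ v → del P v u ≡ P u
del-other P {u} {v} f with P u
... | true  = cong not (≢⇒≡ᵇ u v f)
... | false = refl

del⊆ : ∀ P {u v} → del P v u ≡ true → P u ≡ true
del⊆ P = ∧-left

del-≢ : ∀ P {u v} → del P v u ≡ true → u ≢ v
del-≢ P {u} {v} p = ≡ᵇ-false u v (not-elim (∧-right {P u} p))

count-del : ∀ n {P v} → v < n → P v ≡ true → count n P ≡ suc (count n (del P v))
count-del n {P} {v} v<n p = trans (count-cong n agree) (count-ins n v<n (del-self P v))
  where
    agree : ∀ i → i < n → P i ≡ ins (del P v) v i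
    agree i _ with i ≟ v
    ... | yes refl = trans p (sym (ins-self (del P v) v))
    ... | no  i≢v  = sym (trans (ins-other (del P v) i≢v) (del-other P i≢v))

injection-count : ∀ m n {P} (f : ℕ → ℕ) → (∀ i → i < m → f i < n × P (f i) ≡ true) →
  (∀ i j → i < m → j < m → f i ≡ f j → i ≡ j) → m ≤ count n P
injection-count zero    n f h inj = z≤n
injection-count (suc m) n {P} f h inj =
  subst (suc m ≤_) (sym (count-del n (proj₁ (h m ≤-refl)) (proj₂ (h m ≤-refl))))
    (s≤s (injection-count m n f
      (λ i p → proj₁ (h i (m<n⇒m<1+n p)) ,
        trans (del-other P λ e → <-irrefl (inj i m (m<n⇒m<1+n p) ≤-refl e) p) (proj₂ (h i (m<n⇒m<1+n p))))
      (λ i j p q → inj i j (m<n⇒m<1+n p) (m<n⇒m<1+n q))))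

argmax : ∀ t (f : ℕ → ℕ) → ∃[ i ] i < suc t × (∀ j → j < suc t → f j ≤ f i)
argmax zero f = 0 , z<s , λ where zero _ → ≤-refl ; (suc j) (s≤s ())
argmax (suc t) f with argmax t f
... | i , i<t , h with ≤-total (f i) (f (suc t))
...   | inj₁ le = suc t , ≤-refl , λ j j<t → <suc-case j<t (λ q → ≤-trans (h j q) le) (λ where refl → ≤-refl)
...   | inj₂ ge = i , m<n⇒m<1+n i<t , λ j j<t → <suc-case j<t (h j) (λ where refl → ge)

-- The base is suc b, so that it is positive by construction.
drop : ℕ → ℕ → ℕ → ℕ
drop b zero    x = x
drop b (suc i) x = drop b i x / suc b

digit : ℕ → ℕ → ℕ → ℕ
digit b i x = drop b i x % suc b

encode : ℕ → ℕ → (ℕ → ℕ) → ℕ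
encode b zero    f = 0
encode b (suc m) f = f 0 + suc b * encode b m (f ∘ suc)

drop-/ : ∀ b i x → drop b (suc i) x ≡ drop b i (x / suc b)
drop-/ b zero    x = refl
drop-/ b (suc i) x = cong (_/ suc b) (drop-/ b i x)

digit<base : ∀ b i x → digit b i x < suc b
digit<base b i x = m%n<n (drop b i x) (suc b)

drop≤ : ∀ b i x → drop b i x ≤ x
drop≤ b zero    x = ≤-refl
drop≤ b (suc i) x = ≤-trans (m/n≤m (drop b i x) (suc b)) (drop≤ b i x)

encode-low : ∀ b a y → a < suc b → (a + suc b * y) % suc b ≡ a
encode-low b a y a<b = trans (cong (λ z → (a + z) % suc b) (*-comm (suc b) y))
  (trans ([m+kn]%n≡m%n a y (suc b)) (m<n⇒m%n≡m a<b))

encode-high : ∀ b a y → a < suc b → (a + suc b * y) / suc b ≡ y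
encode-high b a y a<b = *-cancelˡ-≡ _ y (suc b) (+-cancelˡ-≡ a _ _ (sym (begin
  a + suc b * y ≡⟨ m≡m%n+[m/n]*n (a + suc b * y) (suc b) ⟩
  (a + suc b * y) % suc b + (a + suc b * y) / suc b * suc b
    ≡⟨ cong₂ _+_ (encode-low b a y a<b) (*-comm _ (suc b)) ⟩
  a + suc b * ((a + suc b * y) / suc b) ∎)))
  where open ≡-Reasoning

digit-encode : ∀ b m f → (∀ i → i < m → f i < suc b) → ∀ i → i < m → digit b i (encode b m f) ≡ f i
digit-encode b (suc m) f h zero    _ = encode-low b (f 0) _ (h 0 z<s)
digit-encode b (suc m) f h (suc i) (s≤s p) = trans
  (cong (_% suc b) (trans (drop-/ b i _) (cong (drop b i) (encode-high b (f 0) _ (h 0 z<s)))))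
  (digit-encode b m (f ∘ suc) (λ j q → h (suc j) (s≤s q)) i p)

encode< : ∀ b m f → (∀ i → i < m → f i < suc b) → encode b m f < suc b ^ m
encode< b zero    f h = z<s
encode< b (suc m) f h = ≤-trans (+-monoˡ-≤ (suc b * encode b m (f ∘ suc)) (h 0 z<s))
  (≤-trans (≤-reflexive (sym (*-suc (suc b) _)))
    (*-monoʳ-≤ (suc b) (encode< b m (f ∘ suc) λ i p → h (suc i) (s≤s p))))

encode-cong : ∀ b m {f g} → (∀ i → i < m → f i ≡ g i) → encode b m f ≡ encode b m g
encode-cong b zero    h = refl
encode-cong b (suc m) h = cong₂ (λ a y → a + suc b * y) (h 0 z<s) (encode-cong b m λ i p → h (suc i) (s≤s p))

encode-digit : ∀ b m x → x < suc b ^ m → encode b m (λ i → digit b i x) ≡ x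
encode-digit b zero    zero    _ = refl
encode-digit b zero    (suc x) (s≤s ())
encode-digit b (suc m) x p = begin
  x % suc b + suc b * encode b m (λ i → digit b (suc i) x)
    ≡⟨ cong (λ y → x % suc b + suc b * y) (trans (encode-cong b m λ i _ → cong (_% suc b) (drop-/ b i x))
         (encode-digit b m (x / suc b) (m<n*o⇒m/o<n (subst (x <_) (*-comm (suc b) _) p)))) ⟩
  x % suc b + suc b * (x / suc b) ≡⟨ cong (x % suc b +_) (*-comm (suc b) _) ⟩
  x % suc b + x / suc b * suc b   ≡⟨ m≡m%n+[m/n]*n x (suc b) ⟨
  x ∎
  where open ≡-Reasoning

digit-ext : ∀ b m {x y} → x < suc b ^ m → y < suc b ^ m → (∀ i → i < m → digit b i x ≡ digit b i y) → x ≡ y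
digit-ext b m {x} {y} p q h = trans (sym (encode-digit b m x p)) (trans (encode-cong b m h) (encode-digit b m y q))

bit : ℕ → ℕ → Bool
bit i X = digit 1 i X ≡ᵇ 1

digit₁ : ∀ i X → digit 1 i X ≡ 𝟙 (bit i X)
digit₁ i X with digit 1 i X | digit<base 1 i X
... | zero        | _ = refl
... | suc zero    | _ = refl
... | suc (suc _) | s≤s (s≤s ())

mask : ℕ → (ℕ → Bool) → ℕ
mask n U = encode 1 n (𝟙 ∘ U)

𝟙-≡ᵇ1 : ∀ b → (𝟙 b ≡ᵇ 1) ≡ b
𝟙-≡ᵇ1 true  = refl
𝟙-≡ᵇ1 false = refl

bit-mask : ∀ n U {i} → i < n → bit i (mask n U) ≡ U i
bit-mask n U {i} p = trans (cong (_≡ᵇ 1) (digit-encode 1 n (𝟙 ∘ U) (λ j _ → s≤s (𝟙≤1 (U j))) i p)) (𝟙-≡ᵇ1 (U i))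

mask< : ∀ n U → mask n U < 2 ^ n
mask< n U = encode< 1 n (𝟙 ∘ U) λ j _ → s≤s (𝟙≤1 (U j))

-- The digits of the code of f restricted to U sit at the ranks of the elements of U.
code : ℕ → ℕ → (ℕ → Bool) → (ℕ → ℕ) → ℕ
code b n U f = encode b (count n U) (λ i → f (select n U i))

code< : ∀ b n U {f} → (∀ v → f v < suc b) → code b n U f < suc b ^ count n U
code< b n U h = encode< b (count n U) _ λ i _ → h _

digit-code : ∀ b n U {f v} → (∀ v → f v < suc b) → v < n → U v ≡ true → digit b (count v U) (code b n U f) ≡ f v
digit-code b n U {f} {v} h v<n p = trans
  (digit-encode b (count n U) _ (λ i _ → h _) (count v U) (rank-< U p v<n))
  (cong f (select-rank n U v<n p))

full-code< : ∀ b n {f} → (∀ v → f v < suc b) → encode b n f < suc b ^ n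
full-code< b n h = encode< b n _ λ i _ → h i

-- Terms compiled to programs, with their running times

halve< : ∀ {m o} → m < 2 * o → ⌊ m /2⌋ < o
halve< {zero}        {suc o} p = z<s
halve< {suc zero}    {suc o} p = z<s
halve< {suc (suc m)} {suc o} (s≤s p) =
  s≤s (halve< {m} {o} (≤-pred (subst (suc (suc m) ≤_) (+-suc o (o + 0)) p)))

-- Halving v lowers both its logarithm and the exponent L by one. The case v = 0 is why L must be
-- positive: zero still has one bit.
bits≤ : ∀ {L v} → 1 ≤ L → v < 2 ^ L → bits v ≤ L
bits≤ {suc L} (s≤s z≤n) p = s≤s (log≤ L p)
  where
    unpred : ∀ {a b} → a ∸ 1 ≤ b → a ≤ suc b
    unpred {zero}  _ = z≤n
    unpred {suc a} p = s≤s p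

    log≤ : ∀ L {v} → v < 2 ^ suc L → ⌊log₂ v ⌋ ≤ L
    log≤ zero    {zero}        _ = z≤n
    log≤ zero    {suc zero}    _ = z≤n
    log≤ zero    {suc (suc v)} (s≤s (s≤s ()))
    log≤ (suc L) {v} p = unpred (subst (_≤ L) (⌊log₂⌊n/2⌋⌋≡⌊log₂n⌋∸1 v)
      (log≤ L (halve< {v} {2 ^ suc L} p)))

-- A term writes its value into the destination cell d and may overwrite the cells from d on.
Term : Set
Term = ℕ → Program

-- Every variable is an array of its own, used at index 0 only, so an access costs two plus the
-- length of the content, whatever the number of the variable. Arrays 0 and 1 stay reserved for the
-- input.
cell : ℕ → Expr
cell c = (2 + c) [ lit 0 ]

set : ℕ → Expr → Program
set c e = (2 + c) [ lit 0 ]≔ e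

var const : ℕ → Term
var x d   = set d (cell x)
const v d = set d (lit v)

orderT paramT : Term
orderT d = set d (0 [ lit 0 ])
paramT d = set d (0 [ lit 1 ])

entryT : Term → Term
entryT e d = e d ⨾ set d (1 [ cell d ])

opT : Op → Term → Term → Term
opT o e₁ e₂ d = e₁ d ⨾ e₂ (1 + d) ⨾ set d (op o (cell d) (cell (1 + d)))

letT : Term → (Term → Term) → Term
letT e f d = e d ⨾ f (var d) (1 + d) ⨾ set d (cell (1 + d))

-- Truncated subtraction serves as the comparison of index and limit, since a test succeeds on every
-- nonzero value.
loopTest : ℕ → Expr
loopTest d = op monus (cell (1 + d)) (cell (2 + d))

loopBody : (Term → Term → Term) → ℕ → Program
loopBody f d = f (var (2 + d)) (var d) (3 + d) ⨾ set d (cell (3 + d)) ⨾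
  set (2 + d) (op add (cell (2 + d)) (lit 1))

-- Cells d, 1 + d and 2 + d hold the accumulator, the number of rounds and the round index.
loopT : Term → Term → (Term → Term → Term) → Term
loopT t a f d = a d ⨾ t (1 + d) ⨾ set (2 + d) (lit 0) ⨾ while loopTest d repeat loopBody f d

-- (d , σ) stands for the memories whose cells below d hold σ.
World : Set
World = ℕ × (ℕ → ℕ)

_⊑_ : World → World → Set
(d , σ) ⊑ (d′ , σ′) = d ≤ d′ × (∀ x → x < d → σ′ x ≡ σ x)

⊑-refl : ∀ {w} → w ⊑ w
⊑-refl = ≤-refl , λ _ _ → refl

⊑-trans : ∀ {u v w} → u ⊑ v → v ⊑ w → u ⊑ w
⊑-trans (a , f) (b , g) = ≤-trans a b , λ x p → trans (g x (≤-trans p a)) (f x p)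

cells : Memory → ℕ → ℕ
cells s x = s (2 + x) 0

store-same : ∀ s c v → cells (store s (2 + c) 0 v) c ≡ v
store-same s c v rewrite ≡ᵇ-refl c = refl

store-other : ∀ s c v {x} → x ≢ c → cells (store s (2 + c) 0 v) x ≡ cells s x
store-other s c v {x} x≢c rewrite ≢⇒≡ᵇ x c x≢c = refl

module Machine (n k : ℕ) (G : Graph n) (R X L : ℕ) (64≤R : 64 ≤ R) (1≤X : 1 ≤ X) (1≤L : 1 ≤ L) where

  record Intact (s : Memory) : Set where
    constructor intact
    field
      order₀ : s 0 0 ≡ n
      param₀ : s 0 1 ≡ k
      entry₀ : ∀ m → s 1 m ≡ adjBit G m

  -- L bounds the bit length of all values; loops of at most R * X ^ e rounds cost one factor each.
  Budget : ℕ → ℕ → ℕ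
  Budget δ ε = R ^ δ * X ^ ε * L

  Exec : Program → Memory → ℕ → (Memory → Set) → Set
  Exec P s τ Φ = ∃[ s′ ] ∃[ t ] ⟨ P , s ⟩⇓⟨ s′ , t ⟩ × t ≤ τ × Φ s′

  _⟫_ : ∀ {P Q s τ τ′ Φ Ψ} → Exec P s τ Φ → (∀ s′ → Φ s′ → Exec Q s′ τ′ Ψ) → Exec (P ⨾ Q) s (τ + τ′) Ψ
  (s₁ , t₁ , r₁ , le₁ , φ) ⟫ f with f s₁ φ
  ... | s₂ , t₂ , r₂ , le₂ , ψ = s₂ , t₁ + t₂ , seq r₁ r₂ , +-mono-≤ le₁ le₂ , ψ

  infixr 5 _⟫_

  again : ∀ {e P s τ₀ τ τ′ Φ Ψ} → eval s e ≢ 0 → testCost s e ≤ τ₀ → Exec P s τ Φ →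
    (∀ s′ → Φ s′ → Exec (while e repeat P) s′ τ′ Ψ) → Exec (while e repeat P) s (τ₀ + (τ + τ′)) Ψ
  again z c (s₁ , t₁ , r₁ , le₁ , φ) f with f s₁ φ
  ... | s₂ , t₂ , r₂ , le₂ , ψ = s₂ , _ , while-true z r₁ r₂ , +-mono-≤ c (+-mono-≤ le₁ le₂) , ψ

  slower : ∀ {P s τ τ′ Φ} → τ ≤ τ′ → Exec P s τ Φ → Exec P s τ′ Φ
  slower p (s , t , r , le , φ) = s , t , r , ≤-trans le p , φ

  entails : ∀ {P s τ Φ Ψ} → (∀ s′ → Φ s′ → Ψ s′) → Exec P s τ Φ → Exec P s τ Ψ
  entails f (s , t , r , le , φ) = s , t , r , le , f s φ

  record After (s : Memory) (d v : ℕ) (s′ : Memory) : Set where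
    constructor after
    field
      sound : Intact s′
      keep  : ∀ x → x < d → cells s′ x ≡ cells s x
      val   : cells s′ d ≡ v
  open After

  Runs : Program → ℕ → Memory → ℕ → ℕ → Set
  Runs P d s v τ = Exec P s τ (After s d v)

  -- Quantifying over the extensions of w lets a term be used under further bindings.
  record J (w : World) (e : Term) (v δ ε : ℕ) : Set where
    constructor mkJ
    field
      small : v < 2 ^ L
      run   : ∀ d σ → w ⊑ (d , σ) → ∀ s → Intact s → (∀ x → x < d → cells s x ≡ σ x) →
              Runs (e d) d s v (Budget δ ε)
  open J public

  up : ∀ {w w′ e v δ ε} → w ⊑ w′ → J w e v δ ε → J w′ e v δ ε
  up p (mkJ a f) = mkJ a λ d σ q → f d σ (⊑-trans p q)

  private
    0<R : 0 < R
    0<R = ≤-trans z<s 64≤R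

    instance
      R-nonZero : NonZero R
      R-nonZero = >-nonZero 0<R
      X-nonZero : NonZero X
      X-nonZero = >-nonZero 1≤X

  Budget-mono : ∀ {δ δ′ ε ε′} → δ ≤ δ′ → ε ≤ ε′ → Budget δ ε ≤ Budget δ′ ε′
  Budget-mono p q = *-monoˡ-≤ L (*-mono-≤ (^-monoʳ-≤ R p) (^-monoʳ-≤ X q))

  L≤Budget : ∀ δ ε → L ≤ Budget δ ε
  L≤Budget δ ε = ≤-trans (≤-reflexive (sym (*-identityˡ L)))
    (*-monoˡ-≤ L (*-mono-≤ {1} {_} {1} (m^n>0 R δ) (m^n>0 X ε)))

  -- The purpose of `64≤R`: the constant number of steps that a construct adds to its subterms is
  -- paid by one more power of `R`.
  Budget-suc : ∀ δ ε → 64 * Budget δ ε ≤ Budget (suc δ) ε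
  Budget-suc δ ε = ≤-trans (*-monoˡ-≤ (Budget δ ε) 64≤R)
    (≤-reflexive (lemma R (R ^ δ) (X ^ ε) L))
    where lemma : ∀ r a b l → r * (a * b * l) ≡ r * a * b * l
          lemma = solve-∀

  Budget-loop : ∀ {t} δ e ε → t ≤ R * X ^ e → t * Budget δ ε ≤ Budget (suc δ) (e + ε)
  Budget-loop {t} δ e ε p = ≤-trans (*-monoˡ-≤ (Budget δ ε) p)
    (≤-reflexive (trans (lemma R (X ^ e) (R ^ δ) (X ^ ε) L)
      (cong (λ z → R * R ^ δ * z * L) (sym (^-distribˡ-+-* X e ε)))))
    where lemma : ∀ r c a b l → r * c * (a * b * l) ≡ r * a * (c * b) * l
          lemma = solve-∀

  weaken : ∀ {w e v δ ε δ′ ε′} → δ ≤ δ′ → ε ≤ ε′ → J w e v δ ε → J w e v δ′ ε′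
  weaken p q (mkJ a f) = mkJ a λ d σ r s i g → slower (Budget-mono p q) (f d σ r s i g)

  -- For closed depths the implicit argument computes to the unit type and is filled in by eta, so a
  -- depth is rounded up to a literal without a written proof. This stops the maxima from piling up
  -- in types.
  weakenᵇ : ∀ {w e v δ ε δ′} {_ : T (δ ≤ᵇ δ′)} → J w e v δ ε → J w e v δ′ ε
  weakenᵇ {δ = δ} {δ′ = δ′} {p} = weaken (≤ᵇ⇒≤ δ δ′ p) ≤-refl

  reval : ∀ {w e v v′ δ ε} → v ≡ v′ → J w e v δ ε → J w e v′ δ ε
  reval refl j = j

  -- Preserves the cells above d as well. The body of a loop needs this: it writes the accumulator
  -- while limit and index lie above it.
  run-set′ : ∀ d e {v κ} s → Intact s → eval s e ≡ v → v < 2 ^ L → cost s e ≤ κ * L →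
    Exec (set d e) s ((3 + κ) * L) (λ s′ → After s d v s′ × (∀ x → x ≢ d → cells s′ x ≡ cells s x))
  run-set′ d e {v} {κ} s i refl v< c =
    store s (2 + d) 0 v , _ , assign ,
    ≤-trans (+-mono-≤ (+-mono-≤ (s≤s c) (≤-refl {1})) (bits≤ 1≤L v<))
      (≤-trans (≤-reflexive (lemma₁ (κ * L) L)) (≤-trans (+-monoʳ-≤ (κ * L + L) (+-mono-≤ 1≤L 1≤L)) (≤-reflexive (lemma₂ κ L)))) ,
    (after (intact (Intact.order₀ i) (Intact.param₀ i) (Intact.entry₀ i))
      (λ x p → store-other s d v (<⇒≢ p)) (store-same s d v) , λ x p → store-other s d v p)
    where lemma₁ : ∀ a l → 1 + a + 1 + l ≡ a + l + 2
          lemma₁ = solve-∀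
          lemma₂ : ∀ a l → a * l + l + (l + l) ≡ (3 + a) * l
          lemma₂ = solve-∀

  run-set : ∀ d e {v κ} s → Intact s → eval s e ≡ v → v < 2 ^ L → cost s e ≤ κ * L →
    Runs (set d e) d s v ((3 + κ) * L)
  run-set d e {κ = κ} s i p q c = entails (λ _ → proj₁) (run-set′ d e {κ = κ} s i p q c)

  cost-lit : ∀ s v → v < 2 ^ L → cost s (lit v) ≤ 1 * L
  cost-lit s v p = ≤-trans (bits≤ 1≤L p) (≤-reflexive (sym (*-identityˡ L)))

  private
    2+L≤3L : 2 + L ≤ 3 * L
    2+L≤3L = ≤-trans (+-monoˡ-≤ L (+-mono-≤ 1≤L 1≤L)) (≤-reflexive (lemma L))
      where lemma : ∀ l → l + l + l ≡ 3 * l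
            lemma = solve-∀

  cost-cell : ∀ s c → cells s c < 2 ^ L → cost s (cell c) ≤ 3 * L
  cost-cell s c p = ≤-trans (+-monoʳ-≤ 2 (bits≤ 1≤L p)) 2+L≤3L

  private
    +-≤-* : ∀ {a b} p q → a ≤ p * L → b ≤ q * L → a + b ≤ (p + q) * L
    +-≤-* p q x y = ≤-trans (+-mono-≤ x y) (≤-reflexive (sym (*-distribʳ-+ L p q)))

    bits≤* : ∀ {v} → v < 2 ^ L → bits v ≤ 1 * L
    bits≤* p = ≤-trans (bits≤ 1≤L p) (≤-reflexive (sym (*-identityˡ L)))

    const≤Budget : ∀ κ {_ : T (κ ≤ᵇ 64)} → κ * L ≤ Budget 1 0
    const≤Budget κ {p} = ≤-trans (*-monoˡ-≤ L (≤-trans (≤ᵇ⇒≤ κ 64 p) 64≤R))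
      (≤-reflexive (lemma R L))
      where lemma : ∀ r l → r * l ≡ r * 1 * 1 * l
            lemma = solve-∀

    const≤Budget′ : ∀ κ δ ε → κ * L ≤ κ * Budget δ ε
    const≤Budget′ κ δ ε = *-monoʳ-≤ κ (L≤Budget δ ε)

  cost-op : ∀ s o e₁ e₂ κ₁ κ₂ → cost s e₁ ≤ κ₁ * L → cost s e₂ ≤ κ₂ * L →
    eval s e₁ < 2 ^ L → eval s e₂ < 2 ^ L → cost s (op o e₁ e₂) ≤ (κ₁ + κ₂ + 1 + 1) * L
  cost-op s o e₁ e₂ κ₁ κ₂ a b p q =
    +-≤-* (κ₁ + κ₂ + 1) 1 (+-≤-* (κ₁ + κ₂) 1 (+-≤-* κ₁ κ₂ a b) (bits≤* p)) (bits≤* q)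

  var-J : ∀ {d σ x v} → x < d → σ x ≡ v → v < 2 ^ L → J (d , σ) (var x) v 1 0
  var-J {x = x} {v} x<d e v< = mkJ v< λ d′ σ′ (d≤ , agree) s i g →
    let value = trans (g x (≤-trans x<d d≤)) (trans (agree x x<d) e)
    in slower (const≤Budget 6) (run-set d′ (cell x) {κ = 3} s i value v<
         (cost-cell s x (subst (_< 2 ^ L) (sym value) v<)))

  const-J : ∀ {w} v → v < 2 ^ L → J w (const v) v 1 0
  const-J v v< = mkJ v< λ d σ _ s i g →
    slower (const≤Budget 4) (run-set d (lit v) {κ = 1} s i refl v< (cost-lit s v v<))

  order-J : ∀ {w} → n < 2 ^ L → J w orderT n 1 0
  order-J n< = mkJ n< λ d σ _ s i g →
    slower (const≤Budget 6) (run-set d (0 [ lit 0 ]) {κ = 3} s i (Intact.order₀ i) n<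
      (≤-trans (+-monoʳ-≤ 2 (bits≤ 1≤L (subst (_< 2 ^ L) (sym (Intact.order₀ i)) n<))) 2+L≤3L))

  param-J : ∀ {w} → k < 2 ^ L → J w paramT k 1 0
  param-J k< = mkJ k< λ d σ _ s i g →
    slower (const≤Budget 6) (run-set d (0 [ lit 1 ]) {κ = 3} s i (Intact.param₀ i) k<
      (≤-trans (+-monoʳ-≤ 2 (bits≤ 1≤L (subst (_< 2 ^ L) (sym (Intact.param₀ i)) k<))) 2+L≤3L))

  entry-J : ∀ {w e v δ ε} → J w e v δ ε → adjBit G v < 2 ^ L → J w (entryT e) (adjBit G v) (suc δ) ε
  entry-J {v = v} {δ} {ε} je a< = mkJ a< λ d σ p s i g →
    slower (≤-trans (+-monoʳ-≤ (Budget δ ε) (const≤Budget′ 8 δ ε))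
        (≤-trans (*-monoˡ-≤ (Budget δ ε) {9} (≤ᵇ⇒≤ 9 64 _)) (Budget-suc δ ε)))
      (run je d σ p s i g ⟫ λ s₁ a₁ →
        let value = trans (cong (s₁ 1) (val a₁)) (Intact.entry₀ (sound a₁) v)
            cd< = subst (_< 2 ^ L) (sym (val a₁)) (small je)
        in entails (λ s₂ a₂ → after (sound a₂) (λ x q → trans (keep a₂ x q) (keep a₁ x q)) (val a₂))
             (run-set d (1 [ cell d ]) {κ = 5} s₁ (sound a₁) value a<
               (+-≤-* 4 1 (+-≤-* 3 1 (cost-cell s₁ d cd<) (bits≤* cd<)) (bits≤* (subst (_< 2 ^ L) (sym value) a<)))))

  -- Once cell d is filled, the next subterm works from `1 + d` on, with the present memory as its
  -- world.
  extend : ∀ {w d σ s s₁ v} → w ⊑ (d , σ) → (∀ x → x < d → cells s x ≡ σ x) → After s d v s₁ → w ⊑ (1 + d , cells s₁)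
  extend {d = d} p g a = ⊑-trans p (n≤1+n d , λ x q → trans (keep a x q) (g x q))

  op-J : ∀ {w} o {e₁ e₂ u v δ₁ ε₁ δ₂ ε₂} → J w e₁ u δ₁ ε₁ → J w e₂ v δ₂ ε₂ → ⟦ o ⟧ u v < 2 ^ L →
    J w (opT o e₁ e₂) (⟦ o ⟧ u v) (suc (δ₁ ⊔ δ₂)) (ε₁ ⊔ ε₂)
  op-J o {u = u} {v} {δ₁} {ε₁} {δ₂} {ε₂} j₁ j₂ r< = mkJ r< λ d σ p s i g →
    slower time
      (run j₁ d σ p s i g ⟫ λ s₁ a₁ →
       run j₂ (1 + d) (cells s₁) (extend p g a₁) s₁ (sound a₁) (λ _ _ → refl) ⟫ λ s₂ a₂ →
       let u′ = trans (keep a₂ d ≤-refl) (val a₁)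
           u< = subst (_< 2 ^ L) (sym u′) (small j₁)
           v< = subst (_< 2 ^ L) (sym (val a₂)) (small j₂)
       in entails (λ s₃ a₃ → after (sound a₃)
              (λ x q → trans (keep a₃ x q) (trans (keep a₂ x (m<n⇒m<1+n q)) (keep a₁ x q))) (val a₃))
            (run-set d (op o (cell d) (cell (1 + d))) {κ = 8} s₂ (sound a₂) (cong₂ ⟦ o ⟧ u′ (val a₂)) r<
              (cost-op s₂ o (cell d) (cell (1 + d)) 3 3 (cost-cell s₂ d u<) (cost-cell s₂ (1 + d) v<) u< v<)))
    where
      δ = δ₁ ⊔ δ₂
      ε = ε₁ ⊔ ε₂
      time : Budget δ₁ ε₁ + (Budget δ₂ ε₂ + 11 * L) ≤ Budget (suc δ) ε
      time = ≤-trans (+-mono-≤ (Budget-mono (m≤m⊔n δ₁ δ₂) (m≤m⊔n ε₁ ε₂))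
           (+-mono-≤ (Budget-mono (m≤n⊔m δ₁ δ₂) (m≤n⊔m ε₁ ε₂)) (const≤Budget′ 11 δ ε)))
         (≤-trans (*-monoˡ-≤ (Budget δ ε) {13} (≤ᵇ⇒≤ 13 64 _)) (Budget-suc δ ε))

  let-J : ∀ {w e f u v δ₁ ε₁ δ₂ ε₂} → J w e u δ₁ ε₁ →
    (∀ {w′ y} → w ⊑ w′ → J w′ y u 1 0 → J w′ (f y) v δ₂ ε₂) →
    J w (letT e f) v (suc (δ₁ ⊔ δ₂)) (ε₁ ⊔ ε₂)
  let-J {w} {e} {f} {u} {v} {δ₁} {ε₁} {δ₂} {ε₂} j₁ body =
    -- The bound on the value is independent of how the variable is supplied, so it is read off from
    -- the body at a constant.
    mkJ (small (body (⊑-refl {w}) (const-J u (small j₁)))) λ d σ p s i g →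
    slower time
      (run j₁ d σ p s i g ⟫ λ s₁ a₁ →
       let j₂ = body {1 + d , cells s₁} {var d} (extend p g a₁) (var-J ≤-refl (val a₁) (small j₁))
       in run j₂ (1 + d) (cells s₁) ⊑-refl s₁ (sound a₁) (λ _ _ → refl) ⟫ λ s₂ a₂ →
       entails (λ s₃ a₃ → after (sound a₃)
              (λ x q → trans (keep a₃ x q) (trans (keep a₂ x (m<n⇒m<1+n q)) (keep a₁ x q))) (val a₃))
         (run-set d (cell (1 + d)) {κ = 3} s₂ (sound a₂) (val a₂) (small j₂)
           (cost-cell s₂ (1 + d) (subst (_< 2 ^ L) (sym (val a₂)) (small j₂)))))
    where
      δ = δ₁ ⊔ δ₂
      ε = ε₁ ⊔ ε₂
      time : Budget δ₁ ε₁ + (Budget δ₂ ε₂ + 6 * L) ≤ Budget (suc δ) ε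
      time = ≤-trans (+-mono-≤ (Budget-mono (m≤m⊔n δ₁ δ₂) (m≤m⊔n ε₁ ε₂))
           (+-mono-≤ (Budget-mono (m≤n⊔m δ₁ δ₂) (m≤n⊔m ε₁ ε₂)) (const≤Budget′ 6 δ ε)))
         (≤-trans (*-monoˡ-≤ (Budget δ ε) {8} (≤ᵇ⇒≤ 8 64 _)) (Budget-suc δ ε))

  -- The function `acc` is the loop invariant: the accumulator after i rounds. Of the two additional
  -- powers of `R`, one together with `X ^ e` pays for the rounds, the other for the constants.
  loop-J : ∀ {w tT aT f t e δ₁ ε₁ δ₂ ε₂ δ₃ ε₃} (acc : ℕ → ℕ) →
    J w tT t δ₁ ε₁ → J w aT (acc 0) δ₂ ε₂ → t ≤ R * X ^ e →
    (∀ {w′ x y} i → i < t → w ⊑ w′ → J w′ x i 1 0 → J w′ y (acc i) 1 0 → J w′ (f x y) (acc (suc i)) δ₃ ε₃) →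
    J w (loopT tT aT f) (acc t) (2 + (δ₁ ⊔ (δ₂ ⊔ δ₃))) (ε₁ ⊔ (ε₂ ⊔ (e + ε₃)))
  loop-J {w} {tT} {aT} {f} {t} {e} {δ₁} {ε₁} {δ₂} {ε₂} {δ₃} {ε₃} acc jt ja t≤ body = mkJ (acc< t ≤-refl) whole
    where
      acc< : ∀ i → i ≤ t → acc i < 2 ^ L
      acc< zero    _ = small ja
      acc< (suc i) p = small (body i p (⊑-refl {w}) (const-J i (<-trans p (small jt))) (const-J (acc i) (acc< i (<⇒≤ p))))

      δ = δ₁ ⊔ (δ₂ ⊔ δ₃)
      ε = ε₁ ⊔ (ε₂ ⊔ (e + ε₃))
      b = Budget δ₃ ε₃

      record Ready (d : ℕ) (σ : ℕ → ℕ) (i : ℕ) (s : Memory) : Set where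
        field
          sound : Intact s
          below : ∀ x → x < d → cells s x ≡ σ x
          value : cells s d ≡ acc i
          limit : cells s (1 + d) ≡ t
          index : cells s (2 + d) ≡ i

      1<2^L : 1 < 2 ^ L
      1<2^L = ^-monoʳ-≤ 2 1≤L

      round : ∀ d σ → w ⊑ (d , σ) → ∀ i s → i < t → Ready d σ i s →
        Exec (loopBody f d) s (16 * b) (Ready d σ (suc i))
      round d σ p i s i<t ready = slower time
          (run jb (3 + d) (cells s) ⊑-refl s (Ready.sound ready) (λ _ _ → refl) ⟫ λ s₁ a₁ →
           run-set′ d (cell (3 + d)) {κ = 3} s₁ (sound a₁) (val a₁) (small jb)
             (cost-cell s₁ (3 + d) (subst (_< 2 ^ L) (sym (val a₁)) (small jb))) ⟫ λ s₂ (a₂ , keep₂) →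
           let i₂ = trans (keep₂ (2 + d) (λ ())) (trans (keep a₁ (2 + d) ≤-refl) (Ready.index ready))
               i₂< = subst (_< 2 ^ L) (sym i₂) (<-trans i<t (small jt))
           in entails (λ s₃ a₃ → record
                { sound = sound a₃
                ; below = λ x q → trans (keep a₃ x (≤-trans q (m≤n+m d 2))) (trans (keep a₂ x q)
                    (trans (keep a₁ x (≤-trans q (m≤n+m d 3))) (Ready.below ready x q)))
                ; value = trans (keep a₃ d (m≤n+m (suc d) 1)) (val a₂)
                ; limit = trans (keep a₃ (1 + d) ≤-refl) (trans (keep₂ (1 + d) (λ ()))
                    (trans (keep a₁ (1 + d) (n≤1+n (2 + d))) (Ready.limit ready)))
                ; index = val a₃ })
              (run-set (2 + d) (op add (cell (2 + d)) (lit 1)) {suc i} {κ = 6} s₂ (sound a₂)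
                (trans (cong (_+ 1) i₂) (+-comm i 1)) (≤-trans (s≤s i<t) (small jt))
                (cost-op s₂ add (cell (2 + d)) (lit 1) 3 1 (cost-cell s₂ (2 + d) i₂<) (cost-lit s₂ 1 1<2^L) i₂< 1<2^L)))
        where
          jb : J (3 + d , cells s) (f (var (2 + d)) (var d)) (acc (suc i)) δ₃ ε₃
          jb = body i i<t (⊑-trans p (m≤n+m d 3 , Ready.below ready))
            (var-J ≤-refl (Ready.index ready) (<-trans i<t (small jt)))
            (var-J (m≤n+m (suc d) 2) (Ready.value ready) (acc< i (<⇒≤ i<t)))

          time : b + (6 * L + 9 * L) ≤ 16 * b
          time = +-monoʳ-≤ b (≤-trans (≤-reflexive (sym (*-distribʳ-+ L 6 9))) (const≤Budget′ 15 δ₃ ε₃))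

      test : ∀ {d σ i s} r → i + r ≡ t → Ready d σ i s → eval s (loopTest d) ≡ r
      test {i = i} r e ready = trans (cong₂ _∸_ (trans (Ready.limit ready) (sym e)) (Ready.index ready)) (m+n∸m≡n i r)

      testCost≤ : ∀ {d σ i s} r → i + r ≡ t → Ready d σ i s → testCost s (loopTest d) ≤ 9 * b
      testCost≤ {d} {σ} {i} {s} r e ready = ≤-trans
        (+-≤-* 8 1 (cost-op s monus (cell (1 + d)) (cell (2 + d)) 3 3 (cost-cell s (1 + d) t<) (cost-cell s (2 + d) i<) t< i<)
          (bits≤* (subst (_< 2 ^ L) (sym (test r e ready)) (≤-trans (s≤s (subst (r ≤_) e (m≤n+m r i))) (small jt)))))
        (const≤Budget′ 9 δ₃ ε₃)
        where
          t< = subst (_< 2 ^ L) (sym (Ready.limit ready)) (small jt)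
          i< = subst (_< 2 ^ L) (sym (Ready.index ready)) (≤-trans (s≤s (subst (i ≤_) e (m≤m+n i r))) (small jt))

      -- By induction on the remaining rounds r. A test takes at most 9 and a body at most 16 units
      -- of `b`, rounded up to 32; the final failing test accounts for the successor in `suc r`.
      iterate : ∀ d σ → w ⊑ (d , σ) → ∀ r i s → i + r ≡ t → Ready d σ i s →
        Exec (while loopTest d repeat loopBody f d) s (suc r * (32 * b)) (Ready d σ t)
      iterate d σ p zero i s e ready = s , _ , while-false (test 0 e ready) ,
        ≤-trans (testCost≤ 0 e ready) (≤-trans (*-monoˡ-≤ b {9} {32} (≤ᵇ⇒≤ 9 32 _)) (≤-reflexive (sym (*-identityˡ (32 * b))))) ,
        subst (λ i → Ready d σ i s) (trans (sym (+-identityʳ i)) e) ready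
      iterate d σ p (suc r) i s e ready = slower
        (≤-trans (≤-reflexive (lemma b (suc r * (32 * b)))) (+-monoˡ-≤ (suc r * (32 * b)) (*-monoˡ-≤ b {25} {32} (≤ᵇ⇒≤ 25 32 _))))
        (again (λ z → case trans (sym (test (suc r) e ready)) z of λ ()) (testCost≤ (suc r) e ready)
          (round d σ p i s (subst (i <_) e (m<m+n i z<s)) ready)
          (λ s₁ ready₁ → iterate d σ p r (suc i) s₁ (trans (sym (+-suc i r)) e) ready₁))
        where
          lemma : ∀ b y → 9 * b + (16 * b + y) ≡ 25 * b + y
          lemma = solve-∀

      whole : ∀ d σ → w ⊑ (d , σ) → ∀ s → Intact s → (∀ x → x < d → cells s x ≡ σ x) →
        Runs (loopT tT aT f d) d s (acc t) (Budget (2 + δ) ε)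
      whole d σ p s i g = slower time
          (run ja d σ p s i g ⟫ λ s₁ a₁ →
           run jt (1 + d) (cells s₁) (extend p g a₁) s₁ (sound a₁) (λ _ _ → refl) ⟫ λ s₂ a₂ →
           run-set (2 + d) (lit 0) {κ = 1} s₂ (sound a₂) refl 0< (cost-lit s₂ 0 0<) ⟫ λ s₃ a₃ →
           entails (λ s₄ ready → after (Ready.sound ready) (λ x q → trans (Ready.below ready x q) (sym (g x q))) (Ready.value ready))
             (iterate d σ p t 0 s₃ refl record
               { sound = sound a₃
               ; below = λ x q → trans (keep a₃ x (≤-trans q (m≤n+m d 2)))
                   (trans (keep a₂ x (m<n⇒m<1+n q)) (trans (keep a₁ x q) (g x q)))
               ; value = trans (keep a₃ d (m≤n+m (suc d) 1)) (trans (keep a₂ d ≤-refl) (val a₁))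
               ; limit = trans (keep a₃ (1 + d) ≤-refl) (val a₂)
               ; index = val a₃ }))
        where
          0< : 0 < 2 ^ L
          0< = m^n>0 2 L
          δ₂≤ : δ₂ ≤ suc δ
          δ₂≤ = ≤-trans (m≤m⊔n δ₂ δ₃) (≤-trans (m≤n⊔m δ₁ (δ₂ ⊔ δ₃)) (n≤1+n δ))
          δ₃≤ : δ₃ ≤ δ
          δ₃≤ = ≤-trans (m≤n⊔m δ₂ δ₃) (m≤n⊔m δ₁ (δ₂ ⊔ δ₃))
          ε₃≤ : e + ε₃ ≤ ε
          ε₃≤ = ≤-trans (m≤n⊔m ε₂ (e + ε₃)) (m≤n⊔m ε₁ (ε₂ ⊔ (e + ε₃)))
          B₁ : Budget δ₁ ε₁ ≤ Budget (suc δ) ε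
          B₁ = Budget-mono (≤-trans (m≤m⊔n δ₁ (δ₂ ⊔ δ₃)) (n≤1+n δ)) (m≤m⊔n ε₁ (ε₂ ⊔ (e + ε₃)))
          B₂ : Budget δ₂ ε₂ ≤ Budget (suc δ) ε
          B₂ = Budget-mono δ₂≤ (≤-trans (m≤m⊔n ε₂ (e + ε₃)) (m≤n⊔m ε₁ (ε₂ ⊔ (e + ε₃))))
          tb : t * b ≤ Budget (suc δ) ε
          tb = ≤-trans (Budget-loop {t} δ₃ e ε₃ t≤) (Budget-mono (s≤s δ₃≤) ε₃≤)
          b≤ : 32 * b ≤ Budget (suc δ) ε
          b≤ = ≤-trans (*-monoˡ-≤ b {32} {64} (≤ᵇ⇒≤ 32 64 _)) (≤-trans (Budget-suc δ₃ ε₃)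
            (Budget-mono (s≤s δ₃≤) (≤-trans (m≤n+m ε₃ e) ε₃≤)))
          loop≤ : suc t * (32 * b) ≤ 33 * Budget (suc δ) ε
          loop≤ = ≤-trans (+-mono-≤ b≤ (≤-trans (≤-reflexive (lemma₁ t b)) (*-monoʳ-≤ 32 tb))) ≤-refl
            where lemma₁ : ∀ t b → t * (32 * b) ≡ 32 * (t * b)
                  lemma₁ = solve-∀
          lemma₂ : ∀ b → b + (b + (4 * b + 33 * b)) ≡ 39 * b
          lemma₂ = solve-∀

          time : Budget δ₂ ε₂ + (Budget δ₁ ε₁ + (4 * L + suc t * (32 * b))) ≤ Budget (2 + δ) ε
          time = ≤-trans (+-mono-≤ B₂ (+-mono-≤ B₁ (+-mono-≤ (const≤Budget′ 4 (suc δ) ε) loop≤)))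
            (≤-trans (≤-reflexive (lemma₂ (Budget (suc δ) ε)))
              (≤-trans (*-monoˡ-≤ (Budget (suc δ) ε) {39} {64} (≤ᵇ⇒≤ 39 64 _)) (Budget-suc (suc δ) ε)))

-- Logical and arithmetical terms and their cost rules

andT orT eqT leT : Term → Term → Term
notT : Term → Term
notT a  = opT monus (const 1) a
andT    = opT mul
orT a b = notT (andT (notT a) (notT b))
leT a b = notT (opT monus a b)
eqT a b = andT (leT a b) (leT b a)

anyT allT sumT maskT : Term → (Term → Term) → Term
anyT t f  = loopT t (const 0) (λ i acc → orT acc (f i))
allT t f  = notT (anyT t (notT ∘ f))
sumT t f  = loopT t (const 0) (λ i acc → opT add acc (f i))
maskT t f = loopT t (const 0) (λ i acc →
  letT (opT monus t (opT add i (const 1))) λ j → opT add (opT mul (const 2) acc) (f j))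

powT : Term → Term → Term
powT b e = loopT e (const 1) (λ _ acc → opT mul acc b)

digitT : ℕ → Term → Term → Term
digitT b i x = opT rem (loopT i x (λ _ acc → opT quot acc (const (suc b)))) (const (suc b))

bitT : Term → Term → Term
bitT = digitT 1

edgeT : Term → Term → Term
edgeT u v = entryT (opT add (opT mul u orderT) v)

rankT : Term → Term → Term
rankT W v = sumT v (λ u → bitT u W)

sizeT : Term → Term
sizeT W = rankT W orderT

𝟙-not : ∀ b → 1 ∸ 𝟙 b ≡ 𝟙 (not b)
𝟙-not true  = refl
𝟙-not false = refl

𝟙-∧ : ∀ a b → 𝟙 a * 𝟙 b ≡ 𝟙 (a ∧ b)
𝟙-∧ true  b = +-identityʳ (𝟙 b)
𝟙-∧ false b = refl

𝟙-deMorgan : ∀ a b → 𝟙 (not (not a ∧ not b)) ≡ 𝟙 (a ∨ b)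
𝟙-deMorgan true  b     = refl
𝟙-deMorgan false true  = refl
𝟙-deMorgan false false = refl

𝟙-≤ᵇ : ∀ a b → 1 ∸ (a ∸ b) ≡ 𝟙 (a ≤ᵇ b)
𝟙-≤ᵇ a b with b-dec (a ≤ᵇ b)
... | inj₁ p rewrite m≤n⇒m∸n≡0 (≤ᵇ-sound {a} {b} p) | p = refl
... | inj₂ p rewrite p = m≤n⇒m∸n≡0 (m<n⇒0<n∸m (≤ᵇ-false {a} {b} p))

≡ᵇ-antisym : ∀ a b → (a ≤ᵇ b) ∧ (b ≤ᵇ a) ≡ (a ≡ᵇ b)
≡ᵇ-antisym a b = bool-ext
  (λ p → ≡ᵇ-complete (≤-antisym (≤ᵇ-sound {a} {b} (∧-left p)) (≤ᵇ-sound {b} {a} (∧-right {a ≤ᵇ b} p))))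
  (λ p → ∧-intro (≤ᵇ-complete (≤-reflexive (≡ᵇ-sound {a} {b} p))) (≤ᵇ-complete (≤-reflexive (sym (≡ᵇ-sound {a} {b} p)))))

sum-mono-bound : ∀ {m n} f → m ≤ n → sum m f ≤ sum n f
sum-mono-bound {m} {zero}  f z≤n = z≤n
sum-mono-bound {m} {suc n} f m≤n with m≤n⇒m<n∨m≡n m≤n
... | inj₁ (s≤s q) = ≤-trans (sum-mono-bound f q) (m≤m+n _ _)
... | inj₂ refl    = ≤-refl

adjBit≤1 : ∀ {n} (G : Graph n) m → adjBit G m ≤ 1
adjBit≤1 {n} G m with m <? n * n
... | no _ = z≤n
... | yes p with uncurry (adj G) (remQuot n (fromℕ< p))
...   | true  = ≤-refl
...   | false = z≤n

entry : ∀ {n} → Graph n → ℕ → Bool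
entry G m = adjBit G m ≡ᵇ 1

edge : ∀ {n} → Graph n → ℕ → ℕ → Bool
edge {n} G u v = entry G (u * n + v)

𝟙-entry : ∀ {n} (G : Graph n) m → adjBit G m ≡ 𝟙 (entry G m)
𝟙-entry G m with adjBit G m | adjBit≤1 G m
... | zero        | _ = refl
... | suc zero    | _ = refl
... | suc (suc _) | s≤s ()

n≤n² : ∀ n → n ≤ n * n
n≤n² zero    = z≤n
n≤n² (suc m) = m≤m+n (suc m) (m * suc m)

module Rules (n k : ℕ) (G : Graph n) (R X L : ℕ) (64≤R : 64 ≤ R) (1≤X : 1 ≤ X) (1≤L : 1 ≤ L)
  (n²≤R : n * n ≤ R) (R<2^L : R < 2 ^ L) where

  open Machine n k G R X L 64≤R 1≤X 1≤L public

  ≤R⇒< : ∀ {v} → v ≤ R → v < 2 ^ L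
  ≤R⇒< p = ≤-trans (s≤s p) R<2^L

  n≤R : n ≤ R
  n≤R = ≤-trans (n≤n² n) n²≤R

  const≤64 : ∀ {w} v {_ : T (v ≤ᵇ 64)} → J w (const v) v 1 0
  const≤64 v {p} = const-J v (≤R⇒< (≤-trans (≤ᵇ⇒≤ v 64 p) 64≤R))

  orderJ : ∀ {w} → J w orderT n 1 0
  orderJ = order-J (≤R⇒< n≤R)

  𝟙< : ∀ b → 𝟙 b < 2 ^ L
  𝟙< b = ≤R⇒< (≤-trans (𝟙≤1 b) (≤-trans (s≤s z≤n) 64≤R))

  ≤R : ∀ {t} → t ≤ R → t ≤ R * X ^ 0
  ≤R p = ≤-trans p (≤-reflexive (sym (*-identityʳ R)))

  monus-J : ∀ {w e₁ e₂ u v δ₁ ε₁ δ₂ ε₂} → J w e₁ u δ₁ ε₁ → J w e₂ v δ₂ ε₂ →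
    J w (opT monus e₁ e₂) (u ∸ v) (suc (δ₁ ⊔ δ₂)) (ε₁ ⊔ ε₂)
  monus-J {u = u} {v} a b = op-J monus a b (≤-trans (s≤s (m∸n≤m u v)) (small a))

  quot-J : ∀ {w e₁ e₂ u v δ₁ ε₁ δ₂ ε₂} → J w e₁ u δ₁ ε₁ → J w e₂ v δ₂ ε₂ →
    J w (opT quot e₁ e₂) (⟦ quot ⟧ u v) (suc (δ₁ ⊔ δ₂)) (ε₁ ⊔ ε₂)
  quot-J {u = u} {v} a b = op-J quot a b (≤-trans (s≤s (bound v)) (small a))
    where bound : ∀ v → ⟦ quot ⟧ u v ≤ u
          bound zero    = z≤n
          bound (suc v) = m/n≤m u (suc v)

  rem-J : ∀ {w e₁ e₂ u v δ₁ ε₁ δ₂ ε₂} → J w e₁ u δ₁ ε₁ → J w e₂ v δ₂ ε₂ →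
    J w (opT rem e₁ e₂) (⟦ rem ⟧ u v) (suc (δ₁ ⊔ δ₂)) (ε₁ ⊔ ε₂)
  rem-J {u = u} {v} a b = op-J rem a b (≤-trans (s≤s (bound v)) (small a))
    where bound : ∀ v → ⟦ rem ⟧ u v ≤ u
          bound zero    = z≤n
          bound (suc v) = m%n≤m u (suc v)

  -- The depth has the form `suc δ` here and in the following rules so that its maximum with the
  -- depth 1 of a constant reduces by computation.
  not-J : ∀ {w a p δ ε} → J w a (𝟙 p) (suc δ) ε → J w (notT a) (𝟙 (not p)) (2 + δ) ε
  not-J {p = p} j = reval (𝟙-not p) (monus-J (const≤64 1) j)

  and-J : ∀ {w a b p q δ₁ ε₁ δ₂ ε₂} → J w a (𝟙 p) (suc δ₁) ε₁ → J w b (𝟙 q) (suc δ₂) ε₂ →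
    J w (andT a b) (𝟙 (p ∧ q)) (2 + (δ₁ ⊔ δ₂)) (ε₁ ⊔ ε₂)
  and-J {p = p} {q} a b = reval (𝟙-∧ p q) (op-J mul a b (subst (_< 2 ^ L) (sym (𝟙-∧ p q)) (𝟙< (p ∧ q))))

  or-J : ∀ {w a b p q δ₁ ε₁ δ₂ ε₂} → J w a (𝟙 p) (suc δ₁) ε₁ → J w b (𝟙 q) (suc δ₂) ε₂ →
    J w (orT a b) (𝟙 (p ∨ q)) (4 + (δ₁ ⊔ δ₂)) (ε₁ ⊔ ε₂)
  or-J {p = p} {q} a b = reval (𝟙-deMorgan p q) (not-J (and-J (not-J a) (not-J b)))

  le-J : ∀ {w a b u v δ₁ ε₁ δ₂ ε₂} → J w a u δ₁ ε₁ → J w b v δ₂ ε₂ →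
    J w (leT a b) (𝟙 (u ≤ᵇ v)) (2 + (δ₁ ⊔ δ₂)) (ε₁ ⊔ ε₂)
  le-J {u = u} {v} a b = reval (𝟙-≤ᵇ u v) (monus-J (const≤64 1) (monus-J a b))

  eq-J : ∀ {w a b u v δ} → J w a u δ 0 → J w b v δ 0 → J w (eqT a b) (𝟙 (u ≡ᵇ v)) (3 + δ) 0
  eq-J {u = u} {v} {δ} a b = reval (cong 𝟙 (≡ᵇ-antisym u v))
    (weaken (≤-reflexive (trans (cong₂ (λ x y → suc (suc (suc (x ⊔ y)))) (⊔-idem δ) (⊔-idem δ)) (cong (3 +_) (⊔-idem δ)))) ≤-refl
      (and-J (le-J a b) (le-J b a)))

  any-J : ∀ {w tT f t δ ε} e {P : ℕ → Bool} → J w tT t 1 0 → t ≤ R * X ^ e →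
    (∀ {w′ x} i → i < t → w ⊑ w′ → J w′ x i 1 0 → J w′ (f x) (𝟙 (P i)) (suc δ) ε) →
    J w (anyT tT f) (𝟙 (any t P)) (6 + δ) (e + ε)
  any-J {t = t} e {P} jt t≤ body = loop-J {e = e} (λ i → 𝟙 (any i P)) jt (const≤64 0) t≤
    λ i i<t p jx jacc → or-J {p = any i P} {P i} jacc (body i i<t p jx)

  all-J : ∀ {w tT f t δ ε} e {P : ℕ → Bool} → J w tT t 1 0 → t ≤ R * X ^ e →
    (∀ {w′ x} i → i < t → w ⊑ w′ → J w′ x i 1 0 → J w′ (f x) (𝟙 (P i)) (suc δ) ε) →
    J w (allT tT f) (𝟙 (all t P)) (8 + δ) (e + ε)
  all-J {t = t} e {P} jt t≤ body = not-J {p = any t (not ∘ P)} (any-J e {not ∘ P} jt t≤ λ i i<t p jx → not-J {p = P i} (body i i<t p jx))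

  sum-J : ∀ {w tT f t δ ε} e {g : ℕ → ℕ} → J w tT t 1 0 → t ≤ R * X ^ e → sum t g < 2 ^ L →
    (∀ {w′ x} i → i < t → w ⊑ w′ → J w′ x i 1 0 → J w′ (f x) (g i) (suc δ) ε) →
    J w (sumT tT f) (sum t g) (4 + δ) (e + ε)
  sum-J {t = t} e {g} jt t≤ s< body = loop-J {e = e} (λ i → sum i g) jt (const≤64 0) t≤
    λ i i<t p jx jacc → op-J add jacc (body i i<t p jx) (≤-trans (s≤s (sum-mono-bound g i<t)) s<)

  count-J : ∀ {w tT f t δ ε} e {P : ℕ → Bool} → J w tT t 1 0 → t ≤ R * X ^ e →
    (∀ {w′ x} i → i < t → w ⊑ w′ → J w′ x i 1 0 → J w′ (f x) (𝟙 (P i)) (suc δ) ε) →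
    J w (sumT tT f) (count t P) (4 + δ) (e + ε)
  count-J {t = t} e {P} jt t≤ body = sum-J e {𝟙 ∘ P} jt t≤ (≤-trans (s≤s (count≤n t P)) (small jt)) body

  -- Horner's scheme, from the top bit down: after i rounds the accumulator is `top i`, the code of
  -- the last i bits, and the next round prepends the bit at `t ∸ (i + 1)`.
  mask-J : ∀ {w tT f t δ ε} e {P : ℕ → Bool} → J w tT t 1 0 → t ≤ R * X ^ e → t ≤ L →
    (∀ {w′ x} i → i < t → w ⊑ w′ → J w′ x i 1 0 → J w′ (f x) (𝟙 (P i)) (2 + δ) ε) →
    J w (maskT tT f) (mask t P) (6 + δ) (e + ε)
  mask-J {t = t} e {P} jt t≤ t≤L body =
    reval (encode-cong 1 t λ j _ → cong (𝟙 ∘ P ∘ (_+ j)) (n∸n≡0 t))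
      (loop-J {e = e} top jt (const≤64 0) t≤ λ i i<t p jx jacc →
        let p<t = m<n⇒0<n∸m i<t
        in let-J (monus-J (up p jt) (op-J add jx (const≤64 1) (≤-trans (s≤s (≤-trans (≤-reflexive (+-comm i 1)) i<t)) (small jt))))
          λ p′ jj → reval (step i i<t)
            (op-J add (op-J mul (const≤64 2) (up p′ jacc) (≤-trans (s≤s (m≤n+m _ (𝟙 (P (t ∸ (i + 1)))))) (step< i i<t)))
              (body (t ∸ (i + 1)) (∸-monoʳ-< (≤-trans (s≤s z≤n) (≤-reflexive (+-comm 1 i))) (≤-trans (≤-reflexive (+-comm i 1)) i<t)) (⊑-trans p p′) jj)
              (subst (_< 2 ^ L) (+-comm (𝟙 (P (t ∸ (i + 1)))) _) (step< i i<t))))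
    where
      top : ℕ → ℕ
      top i = encode 1 i (λ j → 𝟙 (P (t ∸ i + j)))

      top-suc : ∀ i → i < t → top (suc i) ≡ 𝟙 (P (t ∸ (i + 1))) + 2 * top i
      top-suc i i<t = cong₂ (λ a b → 𝟙 (P a) + 2 * b)
        (trans (+-identityʳ (t ∸ suc i)) (cong (t ∸_) (+-comm 1 i)))
        (encode-cong 1 i λ j _ → cong (𝟙 ∘ P) (trans (+-suc (t ∸ suc i) j) (cong (_+ j) (sym (+-∸-assoc 1 i<t)))))

      step : ∀ i → i < t → 2 * top i + 𝟙 (P (t ∸ (i + 1))) ≡ top (suc i)
      step i i<t = trans (+-comm (2 * top i) _) (sym (top-suc i i<t))

      step< : ∀ i → i < t → 𝟙 (P (t ∸ (i + 1))) + 2 * top i < 2 ^ L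
      step< i i<t = subst (_< 2 ^ L) (top-suc i i<t)
        (≤-trans (encode< 1 (suc i) _ (λ j _ → s≤s (𝟙≤1 (P (t ∸ suc i + j))))) (^-monoʳ-≤ 2 (≤-trans i<t t≤L)))

  pow-J : ∀ {w bT eT b e′} e → J w bT (suc b) 1 0 → J w eT e′ 1 0 → e′ ≤ R * X ^ e → suc b ^ e′ < 2 ^ L →
    J w (powT bT eT) (suc b ^ e′) 4 e
  pow-J {b = b} {e′} e jb je le p< = weaken ≤-refl (≤-reflexive (+-identityʳ e))
    (loop-J {e = e} (λ i → suc b ^ i) je (const≤64 1) le λ i i<e p jx jacc →
      reval (*-comm (suc b ^ i) (suc b)) (op-J mul jacc (up p jb)
        (subst (_< 2 ^ L) (*-comm (suc b) (suc b ^ i)) (≤-trans (s≤s (^-monoʳ-≤ (suc b) i<e)) p<))))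

  -- Digit i is reached by i divisions, so reading from a number with more than polynomially many
  -- digits costs powers of `X`.
  digit-J : ∀ {w iT xT i x} b e → suc b ≤ R → J w iT i 1 0 → J w xT x 1 0 → i ≤ R * X ^ e →
    J w (digitT b iT xT) (digit b i x) 5 e
  digit-J {i = i} {x} b e b≤ ji jx le = weaken ≤-refl (≤-reflexive (trans (⊔-identityʳ (e + 0)) (+-identityʳ e)))
    (rem-J (loop-J {e = e} (λ i → drop b i x) ji jx le λ i _ p _ jacc → quot-J jacc (const-J (suc b) (≤R⇒< b≤)))
      (const-J (suc b) (≤R⇒< b≤)))

  bit-J : ∀ {w iT xT i x} e → J w iT i 1 0 → J w xT x 1 0 → i ≤ R * X ^ e →
    J w (bitT iT xT) (𝟙 (bit i x)) 5 e
  bit-J {i = i} {x} e ji jx le = reval (digit₁ i x) (digit-J 1 e (≤-trans (≤ᵇ⇒≤ 2 64 _) 64≤R) ji jx le)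

  member-J : ∀ {w iT xT i U} → J w iT i 1 0 → J w xT (mask n U) 1 0 → i < n →
    J w (bitT iT xT) (𝟙 (U i)) 5 0
  member-J {U = U} ji jx i<n = reval (cong 𝟙 (bit-mask n U i<n)) (bit-J 0 ji jx (≤R (≤-trans (<⇒≤ i<n) n≤R)))

  rank-J : ∀ {w WT vT v U} → J w WT (mask n U) 1 0 → J w vT v 1 0 → v ≤ n →
    J w (rankT WT vT) (count v U) 8 0
  rank-J {U = U} jW jv v≤n = count-J 0 {U} jv (≤R (≤-trans v≤n n≤R)) λ i i<v p jx →
    member-J {U = U} jx (up p jW) (≤-trans i<v v≤n)

  size-J : ∀ {w WT U} → J w WT (mask n U) 1 0 → J w (sizeT WT) (count n U) 8 0
  size-J {U = U} jW = rank-J {U = U} jW orderJ ≤-refl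

  entryJ : ∀ {w e v δ ε} → J w e v δ ε → J w (entryT e) (𝟙 (entry G v)) (suc δ) ε
  entryJ {v = v} j = reval (𝟙-entry G v) (entry-J j (≤R⇒< (≤-trans (adjBit≤1 G v) (≤-trans (s≤s z≤n) 64≤R))))

  edge-J : ∀ {w uT vT u v} → J w uT u 1 0 → J w vT v 1 0 → u < n → v < n → J w (edgeT uT vT) (𝟙 (edge G u v)) 4 0
  edge-J {u = u} {v} ju jv u<n v<n = entryJ
    (op-J add (op-J mul ju orderJ (≤-trans (s≤s (m≤m+n (u * n) v)) i<)) jv i<)
    where
      i< : u * n + v < 2 ^ L
      i< = ≤R⇒< (≤-trans (≤-trans (+-monoʳ-≤ (u * n) (<⇒≤ v<n)) (≤-trans (≤-reflexive (+-comm (u * n) n)) (*-monoˡ-≤ n u<n))) n²≤R)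

-- Hall's theorem

Sub : ℕ → (ℕ → Bool) → (ℕ → Bool) → Set
Sub n P Q = ∀ i → i < n → P i ≡ true → Q i ≡ true

module Matchings (n : ℕ) (E : ℕ → ℕ → Bool) where

  nb : (ℕ → Bool) → (ℕ → Bool) → ℕ → Bool
  nb B Q v = Q v ∧ any n (λ u → B u ∧ E u v)

  nb-intro : ∀ {B Q u v} → Q v ≡ true → u < n → B u ≡ true → E u v ≡ true → nb B Q v ≡ true
  nb-intro q u<n b e = ∧-intro q (any-intro n u<n (∧-intro b e))

  nb-elim : ∀ {B Q v} → nb B Q v ≡ true → ∃[ u ] u < n × B u ≡ true × E u v ≡ true
  nb-elim {B} {Q} {v} p = let u , u<n , r = any-elim n (∧-right {Q v} p) in u , u<n , ∧-left r , ∧-right {B u} r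

  record Matching (P Q : ℕ → Bool) : Set where
    field
      partner   : ℕ → ℕ
      bound     : ∀ u → u < n → P u ≡ true → partner u < n
      inside    : ∀ u → u < n → P u ≡ true → Q (partner u) ≡ true
      joined    : ∀ u → u < n → P u ≡ true → E u (partner u) ≡ true
      injective : ∀ u v → u < n → v < n → P u ≡ true → P v ≡ true → partner u ≡ partner v → u ≡ v

  Hall : (ℕ → Bool) → (ℕ → Bool) → Set
  Hall P Q = ∀ B → Sub n B P → count n B ≤ count n (nb B Q)

  -- Both cases of the induction for Hall's theorem assemble the matching from two matchings with
  -- disjoint targets.
  paste : ∀ {P Q A B Q₁ Q₂} → Matching A Q₁ → Matching B Q₂ →
    (∀ u → u < n → P u ≡ true → A u ≡ false → B u ≡ true) →
    Sub n Q₁ Q → Sub n Q₂ Q → (∀ v → v < n → Q₁ v ≡ true → Q₂ v ≡ false) → Matching P Q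
  paste {P} {Q} {A} {B} {Q₁} {Q₂} M₁ M₂ split s₁ s₂ disjoint = record
    { partner = m ; bound = bound ; inside = inside ; joined = joined ; injective = injective }
    where
      module M₁ = Matching M₁
      module M₂ = Matching M₂

      m : ℕ → ℕ
      m u = if A u then M₁.partner u else M₂.partner u

      bound : ∀ u → u < n → P u ≡ true → m u < n
      bound u u<n p with A u in a
      ... | true  = M₁.bound u u<n a
      ... | false = M₂.bound u u<n (split u u<n p a)

      inside : ∀ u → u < n → P u ≡ true → Q (m u) ≡ true
      inside u u<n p with A u in a
      ... | true  = s₁ _ (M₁.bound u u<n a) (M₁.inside u u<n a)
      ... | false = s₂ _ (M₂.bound u u<n b) (M₂.inside u u<n b)
        where b = split u u<n p a

      joined : ∀ u → u < n → P u ≡ true → E u (m u) ≡ true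
      joined u u<n p with A u in a
      ... | true  = M₁.joined u u<n a
      ... | false = M₂.joined u u<n (split u u<n p a)

      clash : ∀ {u v} {X : Set} → u < n → v < n → A u ≡ true → B v ≡ true → M₁.partner u ≡ M₂.partner v → X
      clash {u} {v} u<n v<n a b e = absurd (subst (λ x → Q₂ x ≡ true) (sym e) (M₂.inside v v<n b))
        (disjoint _ (M₁.bound u u<n a) (M₁.inside u u<n a))

      injective : ∀ u v → u < n → v < n → P u ≡ true → P v ≡ true → m u ≡ m v → u ≡ v
      injective u v u<n v<n p q e with A u in a | A v in b
      ... | true  | true  = M₁.injective u v u<n v<n a b e
      ... | true  | false = clash u<n v<n a (split v v<n q b) e
      ... | false | true  = clash v<n u<n b (split u u<n p a) (sym e)
      ... | false | false = M₂.injective u v u<n v<n (split u u<n p a) (split v v<n q b) e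

  shrink : ∀ {B Q} → Matching B Q → Matching B (nb B Q)
  shrink {B} {Q} M = record { partner = M.partner ; bound = M.bound ; joined = M.joined ; injective = M.injective
    ; inside = λ u u<n b → nb-intro {B} {Q} (M.inside u u<n b) u<n b (M.joined u u<n b) }
    where module M = Matching M

  -- The induction of Halmos and Vaughan, with c bounding |P|. If some nonempty proper subset B of P
  -- has at most |B| neighbours, B is matched into its neighbourhood and the rest of P outside of
  -- it. Otherwise every such subset has a neighbour to spare, so an arbitrary edge from x to y can
  -- be fixed. The search over masks decides between the two cases.
  hall : ∀ c P Q → count n P ≤ c → Hall P Q → Matching P Q
  hall zero P Q c≤ h = record
    { partner = λ u → u ; bound = λ _ u<n _ → u<n ; inside = λ u u<n p → none u<n p
    ; joined = λ u u<n p → none u<n p ; injective = λ _ _ u<n _ p _ _ → none u<n p }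
    where none : ∀ {u} {X : Set} → u < n → P u ≡ true → X
          none u<n p = ⊥-elim (<-irrefl refl (≤-trans (count-pos n u<n p) c≤))
  hall (suc c) P Q c≤ h with search n P
  ... | inj₂ none = hall c P Q (≤-trans (≤-reflexive (count-none n none)) z≤n) h
  ... | inj₁ (x , x<n , px) with search (2 ^ n) (λ X → all n (λ i → not (bit i X) ∨ P i) ∧
          ((1 ≤ᵇ count n (λ i → bit i X)) ∧ ((suc (count n (λ i → bit i X)) ≤ᵇ count n P) ∧
          (count n (nb (λ i → bit i X) Q) ≤ᵇ count n (λ i → bit i X)))))
  ...   | inj₁ (X , _ , t) = paste {P} {Q} {B} {P′} {nb B Q} {Q′}
          (shrink (hall c B Q (≤-pred (≤-trans B< c≤)) (λ C s → h C λ i p q → B⊆P i p (s i p q))))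
          (hall c P′ Q′ (≤-pred (≤-trans P′< c≤)) hall′)
          (λ u _ p a → ∧-intro p (not-intro a)) (λ v _ → ∧-left) (λ v _ → ∧-left)
          (λ v _ q → ≢true λ r → absurd q (not-elim (∧-right {Q v} r)))
    where
      B P′ Q′ : ℕ → Bool
      B i  = bit i X
      P′ i = P i ∧ not (B i)
      Q′ v = Q v ∧ not (nb B Q v)

      t₂ = ∧-right {all n (λ i → not (bit i X) ∨ P i)} t
      t₃ = ∧-right {1 ≤ᵇ count n B} t₂

      B⊆P : Sub n B P
      B⊆P i i<n b with ∨-elim {not (B i)} (all-elim n (∧-left t) i<n)
      ... | inj₁ f = absurd b (not-elim f)
      ... | inj₂ p = p

      B< : count n B < count n P
      B< = ≤ᵇ-sound {suc (count n B)} (∧-left t₃)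

      tight : count n (nb B Q) ≤ count n B
      tight = ≤ᵇ-sound (∧-right {suc (count n B) ≤ᵇ count n P} t₃)

      P′< : count n P′ < count n P
      P′< = ≤-trans (≤-reflexive (+-comm 1 _)) (≤-trans (+-monoʳ-≤ (count n P′) (≤ᵇ-sound {1} (∧-left t₂)))
        (≤-trans (≤-reflexive (sym (count-∪ n {P′} {B} λ i _ p → not-elim (∧-right {P i} p))))
          (count-mono n {λ i → P′ i ∨ B i} {P} λ i i<n p → case ∨-elim {P′ i} p of λ where
            (inj₁ a) → ∧-left a
            (inj₂ b) → B⊆P i i<n b)))

      hall′ : Hall P′ Q′
      -- Hall's condition for the union of C and B gives |C| + |B| ≤ |N(C) outside N(B)| + |N(B)|,
      -- and tightness of B cancels the last summand against |B|.
      hall′ C s = +-cancelʳ-≤ (count n B) _ _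
        (≤-trans (≤-reflexive (sym (count-∪ n {C} {B} λ i i<n p → not-elim (∧-right {P i} (s i i<n p)))))
        (≤-trans (h (λ i → C i ∨ B i) λ i i<n p → case ∨-elim {C i} p of λ where
            (inj₁ a) → ∧-left (s i i<n a)
            (inj₂ b) → B⊆P i i<n b)
        (≤-trans (count-⊆∪ n {nb C Q′} {nb B Q} cover) (+-monoʳ-≤ _ tight))))
        where
          cover : ∀ v → v < n → nb (λ i → C i ∨ B i) Q v ≡ true → nb C Q′ v ∨ nb B Q v ≡ true
          cover v v<n p with nb-elim {λ i → C i ∨ B i} {Q} p | b-dec (nb B Q v)
          ... | _ | inj₁ q = ∨-right {nb C Q′ v} q
          ... | u , u<n , r , e | inj₂ q with ∨-elim {C u} r
          ...   | inj₁ cu = ∨-left (nb-intro {C} {Q′} (∧-intro (∧-left p) (not-intro q)) u<n cu e)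
          ...   | inj₂ bu = absurd (nb-intro {B} {Q} (∧-left p) u<n bu e) q
  ...   | inj₂ loose = paste {P} {Q} {_≡ᵇ x} {del P x} {_≡ᵇ y} {del Q y} single
          (hall c (del P x) (del Q y) (≤-pred (≤-trans (≤-reflexive (sym (count-del n x<n px))) c≤)) hall′)
          (λ u _ p a → trans (del-other P (≡ᵇ-false u x a)) p)
          (λ v _ e → subst (λ z → Q z ≡ true) (sym (≡ᵇ-sound {v} {y} e)) qy) (λ v _ → ∧-left)
          (λ v _ e → subst (λ z → del Q y z ≡ false) (sym (≡ᵇ-sound {v} {y} e)) (del-self Q y))
    where
      only-x : count n (_≡ᵇ x) ≤ count n (nb (_≡ᵇ x) Q)
      only-x = h (_≡ᵇ x) λ i _ e → subst (λ z → P z ≡ true) (sym (≡ᵇ-sound {i} {x} e)) px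

      found : ∃[ y ] y < n × Q y ≡ true × E x y ≡ true
      found with search n (nb (_≡ᵇ x) Q)
      ... | inj₂ none = ⊥-elim (<-irrefl refl (≤-trans (≤-reflexive (sym (count-single n x x<n)))
                          (≤-trans only-x (≤-reflexive (count-none n none)))))
      ... | inj₁ (y , y<n , r) = let u , _ , e , j = nb-elim {_≡ᵇ x} {Q} r in
              y , y<n , ∧-left r , subst (λ z → E z y ≡ true) (≡ᵇ-sound {u} {x} e) j
      y = proj₁ found
      y<n = proj₁ (proj₂ found)
      qy = proj₁ (proj₂ (proj₂ found))

      single : Matching (_≡ᵇ x) (_≡ᵇ y)
      single = record
        { partner = λ _ → y ; bound = λ _ _ _ → y<n ; inside = λ _ _ _ → ≡ᵇ-refl y
        ; joined = λ u _ e → subst (λ z → E z y ≡ true) (sym (≡ᵇ-sound {u} {x} e)) (proj₂ (proj₂ (proj₂ found)))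
        ; injective = λ u v _ _ p q _ → trans (≡ᵇ-sound {u} {x} p) (sym (≡ᵇ-sound {v} {x} q)) }

      hall′ : Hall (del P x) (del Q y)
      hall′ C s with count n C in eq
      ... | zero  = z≤n
      ... | suc d = ≤-pred (≤-trans strict (≤-trans (count-⊆∪ n {nb C (del Q y)} {_≡ᵇ y} cover)
                      (≤-reflexive (trans (cong (count n (nb C (del Q y)) +_) (count-single n y y<n)) (+-comm _ 1)))))
        where
          cover : ∀ v → v < n → nb C Q v ≡ true → nb C (del Q y) v ∨ (v ≡ᵇ y) ≡ true
          cover v v<n p with b-dec (v ≡ᵇ y) | nb-elim {C} {Q} p
          ... | inj₁ e | _ = ∨-right {nb C (del Q y) v} e
          ... | inj₂ e | u , u<n , cu , j =
            ∨-left (nb-intro {C} {del Q y} (trans (del-other Q (≡ᵇ-false v y e)) (∧-left p)) u<n cu j)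

          same : ∀ i → i < n → bit i (mask n C) ≡ C i
          same i = bit-mask n C

          C< : suc (suc d) ≤ count n P
          C< = ≤-trans (s≤s (≤-trans (≤-reflexive (sym eq)) (count-mono n s))) (≤-reflexive (sym (count-del n x<n px)))

          -- C is nonempty and omits x, hence is a proper subset of P, and the failed search says
          -- that it is not tight. The spare neighbour compensates for the removal of y.
          strict : suc (suc d) ≤ count n (nb C Q)
          strict with b-dec (count n (nb C Q) ≤ᵇ suc d)
          ... | inj₂ f = ≤ᵇ-false {count n (nb C Q)} {suc d} f
          ... | inj₁ f = absurd (∧-intro
                  (all-intro n λ i i<n → trans (cong (λ b → not b ∨ P i) (same i i<n)) (sub i i<n))
                  (subst (λ z → (1 ≤ᵇ z) ∧ ((suc z ≤ᵇ count n P) ∧ (count n (nb (λ i → bit i (mask n C)) Q) ≤ᵇ z)) ≡ true)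
                    (sym size) (∧-intro refl (∧-intro (≤ᵇ-complete {suc (suc d)} C<)
                      (subst (λ z → (z ≤ᵇ suc d) ≡ true) (sym (count-cong n λ v _ →
                        cong (Q v ∧_) (any-cong n λ u u<n → cong (_∧ E u v) (same u u<n)))) f)))))
                  (loose (mask n C) (mask< n C))
            where
              size : count n (λ i → bit i (mask n C)) ≡ suc d
              size = trans (count-cong n same) eq
              sub : ∀ i → i < n → not (C i) ∨ P i ≡ true
              sub i i<n with C i in e
              ... | true  = ∧-left (s i i<n e)
              ... | false = refl

-- Kernelization

-- Y U k reads: the subgraph induced by U is a yes-instance for the target k.
record Saving {ℓ} (n : ℕ) (E : ℕ → ℕ → Bool) (Y : (ℕ → Bool) → ℕ → Set ℓ) : Set ℓ where
  field
    ext   : ∀ {U Z k} → (∀ i → i < n → U i ≡ Z i) → Y U k → Y Z k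
    empty : Y (λ _ → false) 0
    lower : ∀ {U k} → Y U (suc k) → Y U k
    grow  : ∀ {U v k} → v < n → U v ≡ false → Y U k → Y (ins U v) k
    pair  : ∀ {U u v k} → u < n → v < n → U u ≡ false → ins U u v ≡ false → E u v ≡ true →
            Y U k → Y (ins (ins U u) v) (suc k)
    cut   : ∀ {U v k} → v < n → U v ≡ true → Y U (suc k) → Y (del U v) k
    lone  : ∀ {U v k} → v < n → U v ≡ true → (∀ u → u < n → U u ≡ true → E v u ≡ false) →
            Y U k → Y (del U v) k

module SavingProperties {ℓ} {n : ℕ} {E : ℕ → ℕ → Bool} {Y : (ℕ → Bool) → ℕ → Set ℓ} (S : Saving n E Y) where
  open Saving S
  open Matchings n E

  lower* : ∀ {U k} d → Y U (d + k) → Y U k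
  lower* zero    y = y
  lower* (suc d) y = lower* d (lower y)

  lower≤ : ∀ {U k k′} → k ≤ k′ → Y U k′ → Y U k
  lower≤ {U} {k} {k′} p y = lower* (k′ ∸ k) (subst (Y U) (sym (m∸n+n≡m p)) y)

  grow* : ∀ c {U Z k} → count n Z ≤ c + count n U → Sub n U Z → Y U k → Y Z k
  grow* c {U} {Z} le s y with search n (λ v → Z v ∧ not (U v))
  ... | inj₂ none = ext (λ i i<n → bool-ext (s i i<n) (back i i<n)) y
    where
      back : ∀ i → i < n → Z i ≡ true → U i ≡ true
      back i i<n z with b-dec (U i)
      ... | inj₁ u = u
      ... | inj₂ u = absurd (∧-intro z (not-intro u)) (none i i<n)
  grow* zero {U} {Z} le s y | inj₁ (v , v<n , p) =
    ⊥-elim (<-irrefl refl (≤-trans (≤-reflexive (sym (count-ins n v<n (not-elim (∧-right {Z v} p)))))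
      (≤-trans (count-mono n sub) le)))
    where
      sub : Sub n (ins U v) Z
      sub i i<n q with ins-elim U q
      ... | inj₁ u = s i i<n u
      ... | inj₂ refl = ∧-left p
  grow* (suc c) {U} {Z} le s y | inj₁ (v , v<n , p) =
    grow* c (≤-trans le (≤-reflexive (trans (sym (+-suc c (count n U))) (cong (c +_) (sym (count-ins n v<n v∉U))))))
      sub (grow v<n v∉U y)
    where
      v∉U = not-elim (∧-right {Z v} p)
      sub : Sub n (ins U v) Z
      sub i i<n q with ins-elim U q
      ... | inj₁ u = s i i<n u
      ... | inj₂ refl = ∧-left p

  mono : ∀ {U Z k} → Sub n U Z → Y U k → Y Z k
  mono {U} {Z} = grow* (count n Z) (m≤m+n _ _)

  -- The edges of the matching enter one at a time by `pair`. The disjointness assumptions keep both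
  -- ends of the remaining edges outside the growing set.
  match* : ∀ c {P Q U Z k} (M : Matching P Q) → count n P ≡ c → Sub n U Z → Sub n P Z → Sub n Q Z →
    (∀ i → i < n → P i ≡ true → U i ≡ false) → (∀ i → i < n → Q i ≡ true → U i ≡ false) →
    (∀ i → i < n → P i ≡ true → Q i ≡ false) → Y U k → Y Z (c + k)
  match* zero    M e s₁ s₂ s₃ d₁ d₂ d₃ y = mono s₁ y
  match* (suc c) {P} {Q} {U} {Z} {k} M e s₁ s₂ s₃ d₁ d₂ d₃ y with search n P
  ... | inj₂ none = case trans (sym e) (count-none n none) of λ ()
  ... | inj₁ (x , x<n , px) = subst (Y Z) (+-suc c k)
    (match* c {del P x} {del Q m} {ins (ins U x) m} M′ (suc-injective (trans (sym (count-del n x<n px)) e))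
      s₁′ (λ i i<n p → s₂ i i<n (del⊆ P p)) (λ i i<n q → s₃ i i<n (del⊆ Q q))
      (λ i i<n p → trans (ins-other (ins U x) (apart i<n (del⊆ P p) qm))
        (trans (ins-other U (del-≢ P p)) (d₁ i i<n (del⊆ P p))))
      (λ i i<n q → trans (ins-other (ins U x) (del-≢ Q q))
        (trans (ins-other U (λ e → apart x<n px (del⊆ Q q) (sym e))) (d₂ i i<n (del⊆ Q q))))
      (λ i i<n p → ≢true λ q → absurd (del⊆ Q q) (d₃ i i<n (del⊆ P p)))
      (pair x<n m<n (d₁ x x<n px) (trans (ins-other U (λ e → apart x<n px qm (sym e))) (d₂ m m<n qm))
        (M.joined x x<n px) y))
    where
      module M = Matching M
      m = M.partner x
      m<n = M.bound x x<n px
      qm = M.inside x x<n px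

      apart : ∀ {i j} → i < n → P i ≡ true → Q j ≡ true → i ≢ j
      apart i<n p q refl = absurd q (d₃ _ i<n p)

      s₁′ : Sub n (ins (ins U x) m) Z
      s₁′ i i<n p with ins-elim (ins U x) p
      ... | inj₂ refl = s₃ m m<n qm
      ... | inj₁ q with ins-elim U q
      ...   | inj₁ u = s₁ i i<n u
      ...   | inj₂ refl = s₂ x x<n px

      M′ : Matching (del P x) (del Q m)
      M′ = record
        { partner = M.partner
        ; bound = λ u u<n p → M.bound u u<n (del⊆ P p)
        ; inside = λ u u<n p → trans (del-other Q λ e → del-≢ P p (M.injective u x u<n x<n (del⊆ P p) px e))
            (M.inside u u<n (del⊆ P p))
        ; joined = λ u u<n p → M.joined u u<n (del⊆ P p)
        ; injective = λ u v u<n v<n p q → M.injective u v u<n v<n (del⊆ P p) (del⊆ P q) }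

  match : ∀ {P Q U Z k} → Matching P Q → Sub n U Z → Sub n P Z → Sub n Q Z →
    (∀ i → i < n → P i ≡ true → U i ≡ false) → (∀ i → i < n → Q i ≡ true → U i ≡ false) →
    (∀ i → i < n → P i ≡ true → Q i ≡ false) → Y U k → Y Z (count n P + k)
  match M = match* _ M refl

  cut* : ∀ c {H U Z k} → count n H ≡ c → Sub n H U →
    (∀ i → i < n → U i ≡ true → H i ≡ false → Z i ≡ true) → Y U (c + k) → Y Z k
  cut* c {H} e s r y with search n H
  cut* zero    e s r y | inj₂ none = mono (λ i i<n u → r i i<n u (none i i<n)) y
  cut* (suc c) e s r y | inj₂ none = case trans (sym e) (count-none n none) of λ ()
  cut* zero    e s r y | inj₁ (x , x<n , h) = ⊥-elim (<-irrefl (sym e) (count-pos n x<n h))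
  cut* (suc c) {H} {U} {Z} e s r y | inj₁ (x , x<n , h) =
    cut* c {del H x} {del U x} (suc-injective (trans (sym (count-del n x<n h)) e))
      (λ i i<n p → trans (del-other U (del-≢ H p)) (s i i<n (del⊆ H p)))
      (λ i i<n p q → r i i<n (del⊆ U p) (trans (sym (del-other H (del-≢ U p))) q))
      (cut x<n (s x x<n h) y)

  lone* : ∀ c {O U Z k} → count n O ≡ c → Sub n O U →
    (∀ i j → i < n → j < n → O i ≡ true → U j ≡ true → E i j ≡ false) →
    (∀ i → i < n → U i ≡ true → O i ≡ false → Z i ≡ true) → Y U k → Y Z k
  lone* c {O} e s f r y with search n O
  lone* c       e s f r y | inj₂ none = mono (λ i i<n u → r i i<n u (none i i<n)) y
  lone* zero    e s f r y | inj₁ (x , x<n , o) = ⊥-elim (<-irrefl (sym e) (count-pos n x<n o))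
  lone* (suc c) {O} {U} {Z} e s f r y | inj₁ (x , x<n , o) =
    lone* c {del O x} {del U x} (suc-injective (trans (sym (count-del n x<n o)) e))
      (λ i i<n p → trans (del-other U (del-≢ O p)) (s i i<n (del⊆ O p)))
      (λ i j i<n j<n p q → f i j i<n j<n (del⊆ O p) (del⊆ U q))
      (λ i i<n p q → r i i<n (del⊆ U p) (trans (sym (del-other O (del-≢ U p))) q))
      (lone x<n (s x x<n o) (λ u u<n → f x u x<n u<n o) y)

row col : ℕ → ℕ → ℕ
row n p = ⟦ quot ⟧ p n
col n p = ⟦ rem ⟧ p n

row< : ∀ n p → p < n * n → row n p < n
row< zero    p lt = ⊥-elim (n≮0 lt)
row< (suc m) p lt = m<n*o⇒m/o<n lt

col< : ∀ n p → p < n * n → col n p < n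
col< zero    p lt = ⊥-elim (n≮0 lt)
col< (suc m) p lt = m%n<n p (suc m)

row-col : ∀ n p → p < n * n → row n p * n + col n p ≡ p
row-col zero    p lt = ⊥-elim (n≮0 lt)
row-col (suc m) p lt = trans (+-comm _ (p % suc m)) (sym (m≡m%n+[m/n]*n p (suc m)))

position : ∀ n u v → u < n → v < n → u * n + v < n * n × row n (u * n + v) ≡ u × col n (u * n + v) ≡ v
position (suc m) u v u<n v<n = lt , *-cancelʳ-≡ _ _ (suc m) (+-cancelʳ-≡ v _ _
    (trans (cong ((u * suc m + v) / suc m * suc m +_) (sym c≡)) (row-col (suc m) (u * suc m + v) lt))) , c≡
  where
    lt : u * suc m + v < suc m * suc m
    lt = ≤-trans (s≤s (+-monoʳ-≤ (u * suc m) (≤-pred v<n)))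
      (≤-trans (≤-reflexive (trans (sym (+-suc (u * suc m) m)) (+-comm (u * suc m) (suc m)))) (*-monoˡ-≤ (suc m) u<n))
    c≡ : (u * suc m + v) % suc m ≡ v
    c≡ = trans (cong (_% suc m) (+-comm (u * suc m) v)) (trans ([m+kn]%n≡m%n v u (suc m)) (m<n⇒m%n≡m v<n))

module Kernel {n : ℕ} (G : Graph n) (k : ℕ) where

  fresh : ℕ → (ℕ → Bool) → Bool
  fresh p C = entry G p ∧ (not (C (row n p)) ∧ not (C (col n p)))

  -- The vertices covered by the greedy matching after inspecting p entries of the adjacency matrix.
  covered : ℕ → ℕ → Bool
  covered zero    x = false
  covered (suc p) x = covered p x ∨ (fresh p (covered p) ∧ ((x ≡ᵇ row n p) ∨ (x ≡ᵇ col n p)))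

  matched : ℕ → Bool
  matched = covered (n * n)

  large : Bool
  large = k + k ≤ᵇ count n matched

  -- Emptied if `large` holds. Terms have no short-circuit evaluation, so the search over subsets
  -- runs even when the answer is already known, and it must stay within the budget then.
  cover : ℕ → Bool
  cover x = matched x ∧ not large

  pick : ℕ → ℕ → Bool
  pick α x = cover x ∧ bit (count x cover) α

  hood : (ℕ → Bool) → ℕ → Bool
  hood A v = not (cover v) ∧ any n (λ u → A u ∧ edge G u v)

  subsets : ℕ
  subsets = 2 ^ count n cover

  -- pick α maximizes the deficiency |A| - |hood A| over all subsets A of the cover.
  optimal : ℕ → Bool
  optimal α = all subsets (λ β → count n (pick β) + count n (hood (pick α)) ≤ᵇ count n (pick α) + count n (hood (pick β)))

  heads : ℕ → ℕ
  heads α = count n cover ∸ count n (pick α)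

  paired : ℕ → Bool
  paired α = k ≤ᵇ heads α + count n (hood (pick α))

  -- Emptied if `paired` holds, for the same reason as the cover: the brute-force search is
  -- evaluated in any case, and only the failure of `paired` bounds the size of the neighbourhood.
  core : ℕ → ℕ → Bool
  core α v = (pick α v ∨ hood (pick α) v) ∧ not (paired α)

  accepts : ((ℕ → Bool) → ℕ → Bool) → Bool
  accepts brute = large ∨ any subsets (λ α → optimal α ∧ (paired α ∨ brute (core α) (k ∸ heads α)))

  a+a≤b+b : ∀ {a b} → a + a ≤ b + b → a ≤ b
  a+a≤b+b {a} {b} p with a ≤? b
  ... | yes q = q
  ... | no  q = ⊥-elim (<-irrefl refl (≤-trans (+-mono-< (≰⇒> q) (≰⇒> q)) p))

  -- The parity matters: an even size 2m below 2k is at most 2(k - 1). For k = 0 the set is always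
  -- large and the cover empty, so the truncated subtraction is harmless.
  cover-size : (∃[ m ] count n matched ≡ m + m) → count n cover ≤ 2 * (k ∸ 1)
  cover-size (m , e) with large in l
  ... | true  = ≤-trans (≤-reflexive (count-none n λ i _ → ≢true λ p → case ∧-right {matched i} p of λ ())) z≤n
  ... | false = ≤-trans (count-mono n {λ x → matched x ∧ true} {matched} λ _ _ → ∧-left)
    (≤-trans (≤-reflexive e) (≤-trans (+-mono-≤ m≤ m≤) (≤-reflexive (cong (k ∸ 1 +_) (sym (+-identityʳ (k ∸ 1)))))))
    where
      m<k : m < k
      m<k = ≰⇒> λ q → absurd (≤ᵇ-complete (+-mono-≤ q q)) (trans (cong (k + k ≤ᵇ_) (sym e)) l)
      m≤ : m ≤ k ∸ 1
      m≤ = ∸-monoˡ-≤ 1 m<k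

  pick⊆cover : ∀ α i → pick α i ≡ true → cover i ≡ true
  pick⊆cover α i = ∧-left

  -- The pick lies in the cover, which gives 2(k - 1), and failure of `paired` means that heads and
  -- neighbourhood together number at most k - 1.
  core-size : count n cover ≤ 2 * (k ∸ 1) → ∀ α → count n (core α) ≤ 3 * (k ∸ 1)
  core-size c≤ α with paired α in p
  ... | true  = ≤-trans (≤-reflexive (count-none n λ i _ → ≢true λ q →
                  case ∧-right {pick α i ∨ hood (pick α) i} q of λ ())) z≤n
  ... | false = ≤-trans (count-⊆∪ n {pick α} {hood (pick α)} λ i _ → ∧-left)
    (≤-trans (+-mono-≤ {count n (pick α)} {2 * (k ∸ 1)} (≤-trans (count-mono n λ i _ → pick⊆cover α i) c≤)
      (≤-trans (m≤n+m _ (heads α)) (∸-monoˡ-≤ 1 (≤ᵇ-false {k} p))))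
      (≤-reflexive (lemma (k ∸ 1))))
    where lemma : ∀ m → 2 * m + m ≡ 3 * m
          lemma = solve-∀

module KernelCorrect {ℓ} {n : ℕ} (G : Graph n) (k : ℕ)
  (E-sym : ∀ u v → u < n → v < n → edge G u v ≡ edge G v u)
  (E-irr : ∀ u → u < n → edge G u u ≡ false)
  {Y : (ℕ → Bool) → ℕ → Set ℓ} (S : Saving n (edge G) Y) where

  open Kernel G k
  open Saving S
  open SavingProperties S
  open Matchings n (edge G)

  private
    E = edge G

    V : ℕ → Bool
    V _ = true

  entry-edge : ∀ p → p < n * n → entry G p ≡ E (row n p) (col n p)
  entry-edge p lt = cong (entry G) (sym (row-col n p lt))

  covered-yes : ∀ p → p ≤ n * n → ∃[ m ] count n (covered p) ≡ m + m × Y (covered p) m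
  covered-yes zero    _  = 0 , count-none n (λ _ _ → refl) , empty
  covered-yes (suc p) p< with covered-yes p (<⇒≤ p<) | b-dec (fresh p (covered p))
  ... | m , e , y | inj₂ f = m , trans (count-cong n (λ i i<n → sym (same i i<n))) e , ext same y
    where
      same : ∀ i → i < n → covered p i ≡ covered (suc p) i
      same i _ rewrite f with covered p i
      ... | true  = refl
      ... | false = refl
  ... | m , e , y | inj₁ f = suc m ,
      trans (count-cong n λ i i<n → sym (same i i<n))
        (trans (count-ins n c<n c∉) (trans (cong suc (count-ins n r<n r∉))
          (trans (cong (suc ∘ suc) e) (cong suc (sym (+-suc m m)))))) ,
      ext same (pair r<n c<n r∉ c∉ joined y)
    where
      r = row n p
      c = col n p
      r<n = row< n p p<
      c<n = col< n p p<
      f₂ = ∧-right {entry G p} f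
      joined : E r c ≡ true
      joined = trans (sym (entry-edge p p<)) (∧-left f)
      r∉ : covered p r ≡ false
      r∉ = not-elim (∧-left f₂)
      c∉ : ins (covered p) r c ≡ false
      c∉ = trans (ins-other (covered p) λ e → absurd (subst (λ z → E r z ≡ true) e joined) (E-irr r r<n))
        (not-elim (∧-right {not (covered p r)} f₂))
      same : ∀ i → i < n → ins (ins (covered p) r) c i ≡ covered (suc p) i
      same i _ rewrite f with covered p i
      ... | true  = refl
      ... | false = refl

  covered-mono : ∀ {p p′} x → p ≤ p′ → covered p x ≡ true → covered p′ x ≡ true
  covered-mono {p} {zero}   x z≤n c = c
  covered-mono {p} {suc p′} x le  c with m≤n⇒m<n∨m≡n le
  ... | inj₁ (s≤s q) = ∨-left (covered-mono x q c)
  ... | inj₂ refl    = c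

  -- Maximality of the greedy matching: an edge between two unmatched vertices would have been fresh
  -- when its matrix entry was inspected.
  unmatched-independent : ∀ u v → u < n → v < n → matched u ≡ false → matched v ≡ false → E u v ≡ false
  unmatched-independent u v u<n v<n mu mv = ≢true λ e →
    let lt , r≡ , c≡ = position n u v u<n v<n
        p = u * n + v
        before : ∀ x → matched x ≡ false → covered p x ≡ false
        before x m = ≢true λ c → absurd (covered-mono x (<⇒≤ lt) c) m
        f : fresh p (covered p) ≡ true
        f = ∧-intro e (∧-intro (not-intro (trans (cong (covered p) r≡) (before u mu)))
              (not-intro (trans (cong (covered p) c≡) (before v mv))))
    in absurd (covered-mono u lt (∨-right {covered p u} (∧-intro f (∨-left (≡ᵇ-complete (sym r≡)))))) mu

  matched-even : ∃[ m ] count n matched ≡ m + m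
  matched-even = let m , e , _ = covered-yes (n * n) ≤-refl in m , e

  cover≤ : count n cover ≤ 2 * (k ∸ 1)
  cover≤ = cover-size matched-even

  core≤ : ∀ α → count n (core α) ≤ 3 * (k ∸ 1)
  core≤ = core-size cover≤

  large-yes : large ≡ true → Y V k
  large-yes l = let m , e , y = covered-yes (n * n) ≤-refl in
    lower≤ (a+a≤b+b (subst (k + k ≤_) e (≤ᵇ-sound l))) (mono (λ _ _ _ → refl) y)

  hood-cong : ∀ {A B} → (∀ i → i < n → A i ≡ B i) → ∀ v → hood A v ≡ hood B v
  hood-cong f v = cong (not (cover v) ∧_) (any-cong n λ u u<n → cong (_∧ E u v) (f u u<n))

  picked : ∀ B → Sub n B cover → ∃[ β ] β < subsets × (∀ i → i < n → pick β i ≡ B i)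
  picked B s = code 1 n cover (𝟙 ∘ B) , code< 1 n cover (λ v → s≤s (𝟙≤1 (B v))) , agree
    where
      agree : ∀ i → i < n → pick (code 1 n cover (𝟙 ∘ B)) i ≡ B i
      agree i i<n with b-dec (cover i)
      ... | inj₂ c = trans (cong (_∧ bit (count i cover) (code 1 n cover (𝟙 ∘ B))) c) (sym (≢true λ b → absurd (s i i<n b) c))
      ... | inj₁ c = trans (cong (_∧ bit (count i cover) (code 1 n cover (𝟙 ∘ B))) c)
        (trans (cong (_≡ᵇ 1) (digit-code 1 n cover (λ v → s≤s (𝟙≤1 (B v))) i<n c)) (𝟙-≡ᵇ1 (B i)))

  module Optimal (small : large ≡ false) (α : ℕ) (opt : optimal α ≡ true) where

    private
      A J H I : ℕ → Bool
      A = pick α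
      J = hood A
      H v = cover v ∧ not (A v)
      I v = not (cover v) ∧ not (J v)

      A⊆ : Sub n A cover
      A⊆ i _ = pick⊆cover α i

      best : ∀ B → Sub n B cover → count n B + count n J ≤ count n A + count n (hood B)
      best B s = let β , β< , agree = picked B s in
        subst₂ (λ x y → x + count n J ≤ count n A + y) (count-cong n agree)
          (count-cong n λ v _ → hood-cong agree v) (≤ᵇ-sound (all-elim subsets opt β<))

      cover≡matched : ∀ v → cover v ≡ matched v
      cover≡matched v rewrite small with matched v
      ... | true  = refl
      ... | false = refl

      independent : ∀ u v → u < n → v < n → cover u ≡ false → cover v ≡ false → E u v ≡ false
      independent u v u<n v<n p q = unmatched-independent u v u<n v<n
        (trans (sym (cover≡matched u)) p) (trans (sym (cover≡matched v)) q)

      A∩J : ∀ i → i < n → A i ≡ true → J i ≡ false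
      A∩J i _ a = ≢true λ j → absurd (pick⊆cover α i a) (not-elim (∧-left j))

      H∩A : ∀ i → i < n → H i ≡ true → A i ≡ false
      H∩A i _ h = not-elim (∧-right {cover i} h)

      heads≡ : heads α ≡ count n H
      heads≡ = trans (cong (_∸ count n A) (trans (count-cong n split) (count-∪ n {H} {A} H∩A))) (m+n∸n≡m (count n H) (count n A))
        where
          split : ∀ i → i < n → cover i ≡ H i ∨ A i
          split i i<n with b-dec (A i)
          ... | inj₁ a = trans (A⊆ i i<n a) (sym (∨-right {H i} a))
          ... | inj₂ a rewrite a with cover i
          ...   | true  = refl
          ...   | false = refl

      -- Compare A with the enlarged set A ∪ B. The neighbourhood grows only by the neighbours of B
      -- in I, and by optimality it must grow by at least |B|.
      hall-heads : Hall H I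
      hall-heads B s = +-cancelʳ-≤ (count n A + count n J) _ _ (begin
        count n B + (count n A + count n J) ≡⟨ shuffle₁ (count n B) (count n A) (count n J) ⟩
        (count n A + count n B) + count n J ≡⟨ cong (_+ count n J) (count-∪ n {A} {B} (λ i i<n a → ≢true λ b → absurd a (H∩A i i<n (s i i<n b)))) ⟨
        count n A∪B + count n J             ≤⟨ best A∪B sub ⟩
        count n A + count n (hood A∪B)      ≤⟨ +-monoʳ-≤ (count n A) (count-⊆∪ n {nb B I} {J} cov) ⟩
        count n A + (count n (nb B I) + count n J) ≡⟨ shuffle₂ (count n A) (count n (nb B I)) (count n J) ⟩
        count n (nb B I) + (count n A + count n J) ∎)
        where
          open ≤-Reasoning
          shuffle₁ : ∀ b a j → b + (a + j) ≡ (a + b) + j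
          shuffle₁ = solve-∀
          shuffle₂ : ∀ a b j → a + (b + j) ≡ b + (a + j)
          shuffle₂ = solve-∀
          A∪B : ℕ → Bool
          A∪B i = A i ∨ B i
          sub : Sub n A∪B cover
          sub i i<n p with ∨-elim {A i} p
          ... | inj₁ a = A⊆ i i<n a
          ... | inj₂ b = ∧-left (s i i<n b)
          cov : ∀ v → v < n → hood A∪B v ≡ true → nb B I v ∨ J v ≡ true
          cov v v<n p with b-dec (J v) | any-elim n (∧-right {not (cover v)} p)
          ... | inj₁ j | _ = ∨-right {nb B I v} j
          ... | inj₂ j | u , u<n , q with ∨-elim {A u} (∧-left q)
          ...   | inj₁ a = absurd (∧-intro (∧-left p) (any-intro n u<n (∧-intro a (∧-right {A∪B u} q)))) j
          ...   | inj₂ b = ∨-left (nb-intro {B} {I} (∧-intro (∧-left p) (not-intro j)) u<n b (∧-right {A∪B u} q))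

      -- Compare A with the set `A′` that omits the neighbours of B. Its neighbourhood lies in J and
      -- avoids B, so |B| vertices of J are saved; by optimality at least as many vertices of A had
      -- to be given up.
      hall-hood : Hall J A
      hall-hood B s = +-cancelˡ-≤ (count n A′ + count n J) _ _ (begin
        (count n A′ + count n J) + count n B ≤⟨ +-monoˡ-≤ (count n B) (best A′ λ i i<n p → A⊆ i i<n (∧-left p)) ⟩
        (count n A + count n (hood A′)) + count n B ≡⟨ +-assoc (count n A) _ _ ⟩
        count n A + (count n (hood A′) + count n B) ≤⟨ +-mono-≤ (count-⊆∪ n {A′} {nb B A} splitA) hood+B ⟩
        (count n A′ + count n (nb B A)) + count n J ≡⟨ shuffle (count n A′) (count n (nb B A)) (count n J) ⟩
        (count n A′ + count n J) + count n (nb B A) ∎)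
        where
          open ≤-Reasoning
          shuffle : ∀ a b j → (a + b) + j ≡ (a + j) + b
          shuffle = solve-∀
          A′ : ℕ → Bool
          A′ i = A i ∧ not (nb B A i)
          splitA : ∀ i → i < n → A i ≡ true → A′ i ∨ nb B A i ≡ true
          splitA i _ a with nb B A i
          ... | true  = ∨-right {A i ∧ false} refl
          ... | false = ∨-left (∧-intro a refl)
          avoid : ∀ v → v < n → hood A′ v ≡ true → B v ≡ false
          avoid v v<n p = ≢true λ b → let u , u<n , q = any-elim n (∧-right {not (cover v)} p) in
            absurd (nb-intro {B} {A} (∧-left (∧-left q)) v<n b (trans (E-sym v u v<n u<n) (∧-right {A′ u} q)))
              (not-elim (∧-right {A u} (∧-left q)))
          hood+B : count n (hood A′) + count n B ≤ count n J
          hood+B = ≤-trans (≤-reflexive (sym (count-∪ n {hood A′} {B} avoid))) (count-mono n sub)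
            where
              sub : Sub n (λ i → hood A′ i ∨ B i) J
              sub v v<n p with ∨-elim {hood A′ v} p
              ... | inj₂ b = s v v<n b
              ... | inj₁ h = let u , u<n , q = any-elim n (∧-right {not (cover v)} h) in
                ∧-intro (∧-left h) (any-intro n u<n (∧-intro (∧-left (∧-left q)) (∧-right {A′ u} q)))

      matching-heads : Matching H I
      matching-heads = hall _ H I ≤-refl hall-heads

      H∩I : ∀ i → i < n → H i ≡ true → I i ≡ false
      H∩I i _ h = ≢true λ p → absurd {b = cover i} (∧-left h) (not-elim (∧-left p))

    -- The heads are matched into I starting from the empty set, then J is matched into A on top of
    -- that: |H| + |J| disjoint edges, which is at least k.
    paired-yes : paired α ≡ true → Y V k
    paired-yes p = lower≤ (subst (k ≤_) (trans (cong (_+ count n J) heads≡) (+-comm (count n H) (count n J))) (≤ᵇ-sound p))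
      (match (hall _ J A ≤-refl hall-hood) (λ _ _ _ → refl) (λ _ _ _ → refl) (λ _ _ _ → refl)
        (λ i i<n j → ≢true λ q → case ∨-elim {H i} q of λ where
          (inj₁ h) → absurd {b = cover i} (∧-left h) (not-elim (∧-left j))
          (inj₂ p) → absurd j (not-elim (∧-right {not (cover i)} p)))
        (λ i i<n a → ≢true λ q → case ∨-elim {H i} q of λ where
          (inj₁ h) → absurd a (H∩A i i<n h)
          (inj₂ p) → absurd (A⊆ i i<n a) (not-elim (∧-left p)))
        (λ i i<n j → ≢true λ a → absurd j (A∩J i i<n a))
        (subst (Y (λ i → H i ∨ I i)) (+-identityʳ (count n H))
          (match {U = λ _ → false} matching-heads (λ _ _ ()) (λ _ _ → ∨-left) (λ i _ → ∨-right {H i})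
            (λ _ _ _ → refl) (λ _ _ _ → refl) H∩I empty)))

    module _ (unpaired : paired α ≡ false) where

      private
        core-elim : ∀ i → core α i ≡ true → A i ≡ true ⊎ J i ≡ true
        core-elim i p = ∨-elim {A i} (∧-left p)

        core-intro : ∀ i → A i ∨ J i ≡ true → core α i ≡ true
        core-intro i p = ∧-intro p (not-intro unpaired)

      heads≤ : heads α ≤ k
      heads≤ = <⇒≤ (≤-trans (s≤s (m≤m+n (heads α) _)) (≤ᵇ-false {k} unpaired))

      -- The matching of H into I avoids the core, so it adds |H| to what the core attains.
      core-yes : Y (core α) (k ∸ heads α) → Y V k
      core-yes y = subst (Y V) (trans (cong (_+ (k ∸ heads α)) (sym heads≡)) (m+[n∸m]≡n heads≤))
        (match matching-heads (λ _ _ _ → refl) (λ _ _ _ → refl) (λ _ _ _ → refl)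
          (λ i i<n h → ≢true λ q → case core-elim i q of λ where
            (inj₁ a) → absurd a (H∩A i i<n h)
            (inj₂ j) → absurd {b = cover i} (∧-left h) (not-elim (∧-left j)))
          (λ i i<n p → ≢true λ q → case core-elim i q of λ where
            (inj₁ a) → absurd (A⊆ i i<n a) (not-elim (∧-left p))
            (inj₂ j) → absurd j (not-elim (∧-right {not (cover i)} p)))
          H∩I y)

      -- Deleting H costs at most |H|. A vertex of I then has no neighbour left: one in A would put
      -- it into J, and two vertices outside the cover are never adjacent.
      yes-core : Y V k → Y (core α) (k ∸ heads α)
      yes-core y = lone* (count n I) {I} {λ i → not (H i)} refl
        (λ i i<n p → not-intro (≢true λ h → absurd p (H∩I i i<n h)))
        isolated
        remaining
        (cut* (count n H) {H} {V} refl (λ _ _ _ → refl) (λ _ _ _ → not-intro)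
          (subst (Y V) (sym (trans (cong (_+ (k ∸ heads α)) (sym heads≡)) (m+[n∸m]≡n heads≤))) y))
        where
          isolated : ∀ i j → i < n → j < n → I i ≡ true → not (H j) ≡ true → E i j ≡ false
          isolated i j i<n j<n p q with b-dec (cover j)
          ... | inj₂ c = independent i j i<n j<n (not-elim (∧-left p)) c
          ... | inj₁ c = ≢true λ e → absurd
              (∧-intro (∧-left p) (any-intro n j<n (∧-intro in-A (trans (E-sym j i j<n i<n) e))))
              (not-elim (∧-right {not (cover i)} p))
            where
              in-A : A j ≡ true
              in-A with b-dec (A j)
              ... | inj₁ a = a
              ... | inj₂ a = absurd (∧-intro c (not-intro a)) (not-elim q)
          remaining : ∀ i → i < n → not (H i) ≡ true → I i ≡ false → core α i ≡ true
          remaining i i<n h p with b-dec (A i) | b-dec (J i)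
          ... | inj₁ a | _      = core-intro i (∨-left a)
          ... | _      | inj₁ j = core-intro i (∨-right {A i} j)
          ... | inj₂ a | inj₂ j with b-dec (cover i)
          ...   | inj₁ c = absurd (∧-intro c (not-intro a)) (not-elim h)
          ...   | inj₂ c = absurd (∧-intro (not-intro c) (not-intro j)) p

  optimum : ∃[ α ] α < subsets × optimal α ≡ true
  optimum with 2 ^ count n cover in e
  ... | zero  = ⊥-elim (<-irrefl (sym e) (m^n>0 2 (count n cover)))
  -- The deficiency may be negative; adding n to it keeps the objective in the natural numbers.
  ... | suc t with argmax t (λ β → count n (pick β) + (n ∸ count n (hood (pick β))))
  ...   | α , α< , best = α , α< , all-intro (suc t) λ β β< → ≤ᵇ-complete
    (exchange (count≤n n (hood (pick α))) (count≤n n (hood (pick β))) (best β β<))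
    where
      exchange : ∀ {a b x y} → x ≤ n → y ≤ n → b + (n ∸ y) ≤ a + (n ∸ x) → b + x ≤ a + y
      exchange {a} {b} {x} {y} x≤ y≤ p = +-cancelʳ-≤ (n ∸ y + (n ∸ x)) _ _ (begin
        (b + x) + ((n ∸ y) + (n ∸ x)) ≡⟨ shuffle₁ b x (n ∸ y) (n ∸ x) ⟩
        (b + (n ∸ y)) + (x + (n ∸ x)) ≤⟨ +-mono-≤ p (≤-reflexive (trans (m+[n∸m]≡n x≤) (sym (m+[n∸m]≡n y≤)))) ⟩
        (a + (n ∸ x)) + (y + (n ∸ y)) ≡⟨ shuffle₂ a (n ∸ x) y (n ∸ y) ⟩
        (a + y) + ((n ∸ y) + (n ∸ x)) ∎)
        where
          open ≤-Reasoning
          shuffle₁ : ∀ b x c d → (b + x) + (c + d) ≡ (b + c) + (x + d)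
          shuffle₁ = solve-∀
          shuffle₂ : ∀ a d y c → (a + d) + (y + c) ≡ (a + y) + (c + d)
          shuffle₂ = solve-∀

  module _ (brute : (ℕ → Bool) → ℕ → Bool)
    (sound    : ∀ U k′ → count n U ≤ 3 * (k ∸ 1) → brute U k′ ≡ true → Y U k′)
    (complete : ∀ U k′ → count n U ≤ 3 * (k ∸ 1) → Y U k′ → brute U k′ ≡ true) where

    accepts-sound : accepts brute ≡ true → Y V k
    accepts-sound a with b-dec large
    ... | inj₁ l = large-yes l
    ... | inj₂ l with ∨-elim {large} a
    ...   | inj₁ l′ = large-yes l′
    ...   | inj₂ b with any-elim subsets b
    ...     | α , _ , q with b-dec (paired α)
    ...       | inj₁ p = Optimal.paired-yes l α (∧-left q) p
    ...       | inj₂ p with ∨-elim {paired α} (∧-right {optimal α} q)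
    ...         | inj₁ p′ = absurd p′ p
    ...         | inj₂ r = Optimal.core-yes l α (∧-left q) p (sound (core α) (k ∸ heads α) (core≤ α) r)

    accepts-complete : Y V k → accepts brute ≡ true
    accepts-complete y with b-dec large
    ... | inj₁ l = ∨-left l
    ... | inj₂ l with optimum
    ...   | α , α< , opt = ∨-right {large} (any-intro subsets α< (∧-intro opt final))
      where
        final : paired α ∨ brute (core α) (k ∸ heads α) ≡ true
        final with b-dec (paired α)
        ... | inj₁ p = ∨-left p
        ... | inj₂ p = ∨-right {paired α} (complete (core α) (k ∸ heads α) (core≤ α) (Optimal.yes-core l α opt p y))

-- The kernelization as a program

matchT : Term
matchT = letT (opT mul orderT orderT) λ nn → loopT nn (const 0) λ p C →
  letT (opT quot p orderT) λ u → letT (opT rem p orderT) λ v →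
  letT (andT (entryT p) (andT (notT (bitT u C)) (notT (bitT v C)))) λ c →
  maskT orderT λ x → orT (bitT x C) (andT c (orT (eqT x u) (eqT x v)))

largeT : Term → Term
largeT M = leT (opT add paramT paramT) (sizeT M)

coverT pickT hoodT : Term → Term → Term
coverT M l = maskT orderT λ x → andT (bitT x M) (notT l)
pickT S a  = maskT orderT λ x → andT (bitT x S) (letT (rankT S x) λ r → bitT r a)
hoodT S A  = maskT orderT λ v → andT (notT (bitT v S)) (anyT orderT λ u → andT (bitT u A) (edgeT u v))

coreT : Term → Term → Term → Term
coreT A J p = maskT orderT λ x → andT (orT (bitT x A) (bitT x J)) (notT p)

optimalT : Term → Term → Term → Term → Term
optimalT S A J t = allT t λ b → letT (pickT S b) λ B → letT (hoodT S B) λ K →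
  leT (opT add (sizeT B) (sizeT J)) (opT add (sizeT A) (sizeT K))

trialT : (Term → Term → Term) → Term → Term → Term → Term → Term
trialT bruteT S c t a =
  letT (pickT S a) λ A → letT (hoodT S A) λ J →
  letT (opT monus c (sizeT A)) λ h →
  letT (leT paramT (opT add h (sizeT J))) λ p →
  letT (coreT A J p) λ W → letT (opT monus paramT h) λ k′ →
  andT (optimalT S A J t) (orT p (bruteT W k′))

acceptsT : (Term → Term → Term) → Term
acceptsT bruteT =
  letT matchT λ M → letT (largeT M) λ l → letT (coverT M l) λ S →
  letT (sizeT S) λ c → letT (powT (const 2) c) λ t →
  orT l (anyT t (trialT bruteT S c t))

n<2^n : ∀ n → n < 2 ^ n
n<2^n zero    = z<s
n<2^n (suc n) = ≤-trans (+-mono-≤ (m^n>0 2 n) (n<2^n n)) (≤-reflexive (cong (2 ^ n +_) (sym (+-identityʳ (2 ^ n)))))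

encode-zero : ∀ b m → encode b m (λ _ → 0) ≡ 0
encode-zero b zero    = refl
encode-zero b (suc m) = trans (cong (suc b *_) (encode-zero b m)) (*-zeroʳ (suc b))

module KernelProgram (n k : ℕ) (G : Graph n) (R X L : ℕ) (64≤R : 64 ≤ R) (1≤X : 1 ≤ X) (1≤L : 1 ≤ L)
  (n²≤R : n * n ≤ R) (R<2^L : R < 2 ^ L) (n<L : n < L) (2k<2^L : k + k < 2 ^ L) where

  open Rules n k G R X L 64≤R 1≤X 1≤L n²≤R R<2^L public
  open Kernel G k public

  infixr 5 _∙_
  _∙_ : ∀ {u v w} → u ⊑ v → v ⊑ w → u ⊑ w
  _∙_ = ⊑-trans

  Bits : World → Term → (ℕ → Bool) → Set
  Bits w W U = J w W (mask n U) 1 0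

  paramJ : ∀ {w} → J w paramT k 1 0
  paramJ = param-J (≤-trans (s≤s (m≤m+n k k)) 2k<2^L)

  private
    n≤L : n ≤ L
    n≤L = <⇒≤ n<L

    n≤ : n ≤ R * X ^ 0
    n≤ = ≤R n≤R

    2n<2^L : n + n < 2 ^ L
    2n<2^L = ≤-trans (+-mono-≤ (n<2^n n) (<⇒≤ (n<2^n n)))
      (≤-trans (≤-reflexive (cong (2 ^ n +_) (sym (+-identityʳ (2 ^ n))))) (^-monoʳ-≤ 2 n<L))

  +≤2n : ∀ {a b} → a ≤ n → b ≤ n → a + b < 2 ^ L
  +≤2n p q = ≤-trans (s≤s (+-mono-≤ p q)) 2n<2^L

  match-J : ∀ {w} → J w matchT (mask n matched) 45 0
  match-J = weakenᵇ (let-J (op-J mul orderJ orderJ (≤R⇒< n²≤R)) λ p₁ jn →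
    loop-J {e = 0} (λ p → mask n (covered p)) jn (reval (sym (encode-zero 1 n)) (const≤64 0)) (≤R n²≤R) λ p p<n² p₂ jp jC →
    let-J (quot-J jp orderJ) λ p₃ ju → let-J (rem-J (up p₃ jp) orderJ) λ p₄ jv →
    let-J (and-J (entryJ (up (p₃ ∙ p₄) jp)) (and-J
            (not-J (member-J {U = covered p} (up p₄ ju) (up (p₃ ∙ p₄) jC) (row< n p p<n²)))
            (not-J (member-J {U = covered p} jv (up (p₃ ∙ p₄) jC) (col< n p p<n²))))) λ p₅ jc →
    mask-J 0 {covered (suc p)} orderJ n≤ n≤L λ x x<n p₆ jx →
      or-J {p = covered p x} (member-J {U = covered p} jx (up (p₃ ∙ p₄ ∙ p₅ ∙ p₆) jC) x<n)
        (and-J {p = fresh p (covered p)} (up p₆ jc) (or-J (eq-J jx (up (p₄ ∙ p₅ ∙ p₆) ju)) (eq-J jx (up (p₅ ∙ p₆) jv)))))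

  large-J : ∀ {w M} → Bits w M matched → J w (largeT M) (𝟙 large) 10 0
  large-J jM = le-J (op-J add paramJ paramJ 2k<2^L) (size-J {U = matched} jM)

  cover-J : ∀ {w M l} → Bits w M matched → J w l (𝟙 large) 1 0 → J w (coverT M l) (mask n cover) 15 0
  cover-J jM jl = weakenᵇ (mask-J 0 {cover} orderJ n≤ n≤L λ x x<n p jx →
    and-J (member-J {U = matched} jx (up p jM) x<n) (not-J {p = large} (up p jl)))

  pick-J : ∀ {w S a α} → Bits w S cover → J w a α 1 0 → J w (pickT S a) (mask n (pick α)) 20 0
  pick-J {α = α} jS ja = weakenᵇ (mask-J 0 {pick α} orderJ n≤ n≤L λ x x<n p jx →
    and-J (member-J {U = cover} jx (up p jS) x<n)
      (let-J (rank-J {U = cover} (up p jS) jx (<⇒≤ x<n)) λ p′ jr →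
        bit-J 0 jr (up (p ∙ p′) ja) (≤R (≤-trans (count≤n x cover) (≤-trans (<⇒≤ x<n) n≤R)))))

  hood-J : ∀ {w S A B} → Bits w S cover → Bits w A B → J w (hoodT S A) (mask n (hood B)) 25 0
  hood-J {B = B} jS jA = weakenᵇ (mask-J 0 {hood B} orderJ n≤ n≤L λ v v<n p jv →
    and-J (not-J {p = cover v} (member-J {U = cover} jv (up p jS) v<n))
      (any-J 0 orderJ n≤ λ u u<n p′ ju →
        and-J {p = B u} (member-J {U = B} ju (up (p ∙ p′) jA) u<n) (edge-J ju (up p′ jv) u<n v<n)))

  core-J : ∀ {w A J′ p α} → Bits w A (pick α) → Bits w J′ (hood (pick α)) → J w p (𝟙 (paired α)) 1 0 →
    J w (coreT A J′ p) (mask n (core α)) 20 0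
  core-J {α = α} jA jJ jp = weakenᵇ (mask-J 0 {core α} orderJ n≤ n≤L λ x x<n p jx →
    and-J (or-J {p = pick α x} (member-J {U = pick α} jx (up p jA) x<n) (member-J {U = hood (pick α)} jx (up p jJ) x<n))
      (not-J {p = paired α} (up p jp)))

  optimal-J : ∀ {w S A J′ t α} e → subsets ≤ R * X ^ e → Bits w S cover → Bits w A (pick α) → Bits w J′ (hood (pick α)) →
    J w t subsets 1 0 → J w (optimalT S A J′ t) (𝟙 (optimal α)) 40 e
  optimal-J {α = α} e s≤ jS jA jJ jt = weaken (≤ᵇ⇒≤ 34 40 _) (≤-reflexive (+-identityʳ e))
    (all-J e jt s≤ λ β β< p jb →
      let-J (pick-J (up p jS) jb) λ p₁ jB → let-J (hood-J {B = pick β} (up (p ∙ p₁) jS) jB) λ p₂ jK →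
      le-J (op-J add (size-J {U = pick β} (up p₂ jB)) (size-J {U = hood (pick α)} (up (p ∙ p₁ ∙ p₂) jJ))
             (+≤2n (count≤n n (pick β)) (count≤n n (hood (pick α)))))
           (op-J add (size-J {U = pick α} (up (p ∙ p₁ ∙ p₂) jA)) (size-J {U = hood (pick β)} jK)
             (+≤2n (count≤n n (pick α)) (count≤n n (hood (pick β))))))

  module Search (cover≤ : count n cover ≤ 2 * (k ∸ 1)) (e : ℕ) (subsets≤ : subsets ≤ R * X ^ e)
    (brute : (ℕ → Bool) → ℕ → Bool) (bruteT : Term → Term → Term) (ε : ℕ)
    (brute-J : ∀ {w W k′ U m} → count n U ≤ 3 * (k ∸ 1) → m ≤ k → Bits w W U → J w k′ m 1 0 →
      J w (bruteT W k′) (𝟙 (brute U m)) 110 ε) where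

    trial-J : ∀ {w S c t a α} → Bits w S cover → J w c (count n cover) 1 0 → J w t subsets 1 0 → J w a α 1 0 →
      J w (trialT bruteT S c t a) (𝟙 (optimal α ∧ (paired α ∨ brute (core α) (k ∸ heads α)))) 125 (e + ε)
    trial-J {α = α} jS jc jt ja = weakenᵇ
      (let-J (pick-J jS ja) λ p₁ jA → let-J (hood-J {B = pick α} (up p₁ jS) jA) λ p₂ jJ →
       let-J (monus-J (up (p₁ ∙ p₂) jc) (size-J {U = pick α} (up p₂ jA))) λ p₃ jh →
       let-J (le-J paramJ (op-J add jh (size-J {U = hood (pick α)} (up p₃ jJ))
         (+≤2n (≤-trans (m∸n≤m (count n cover) (count n (pick α))) (count≤n n cover)) (count≤n n (hood (pick α)))))) λ p₄ jp →
       let-J (core-J {α = α} (up (p₂ ∙ p₃ ∙ p₄) jA) (up (p₃ ∙ p₄) jJ) jp) λ p₅ jW →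
       let-J (monus-J paramJ (up (p₄ ∙ p₅) jh)) λ p₆ jk →
       weaken ≤-refl (⊔-lub (m≤m+n e ε) (m≤n+m ε e))
         (and-J (optimal-J {α = α} e subsets≤ (up (p₁ ∙ p₂ ∙ p₃ ∙ p₄ ∙ p₅ ∙ p₆) jS) (up (p₂ ∙ p₃ ∙ p₄ ∙ p₅ ∙ p₆) jA)
                  (up (p₃ ∙ p₄ ∙ p₅ ∙ p₆) jJ) (up (p₁ ∙ p₂ ∙ p₃ ∙ p₄ ∙ p₅ ∙ p₆) jt))
           (or-J {p = paired α} (up (p₅ ∙ p₆) jp) (brute-J (core-size cover≤ α) (m∸n≤m k (heads α)) (up p₆ jW) jk))))

    -- The subsets of the cover are enumerated twice, nested: once to propose A and once to test its
    -- optimality. Hence e occurs twice. The same program skeleton serves all three problems.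
    accepts-J : ∀ {w} → J w (acceptsT bruteT) (𝟙 (accepts brute)) 140 (e + (e + ε))
    accepts-J = weakenᵇ
      (let-J match-J λ p₁ jM → let-J (large-J jM) λ p₂ jl → let-J (cover-J (up p₂ jM) jl) λ p₃ jS →
       let-J (size-J {U = cover} jS) λ p₄ jc →
       let-J (pow-J 0 (const≤64 2) jc (≤R (≤-trans (count≤n n cover) n≤R))
         (≤-trans (s≤s (^-monoʳ-≤ 2 (count≤n n cover))) (^-monoʳ-< 2 ≤-refl n<L))) λ p₅ jt →
       or-J {p = large} (up (p₃ ∙ p₄ ∙ p₅) jl) (any-J e jt subsets≤ λ α α< p₆ ja →
         trial-J {α = α} (up (p₄ ∙ p₅ ∙ p₆) jS) (up (p₅ ∙ p₆) jc) (up p₆ jt) ja))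

-- Storage codes

pigeonhole : ∀ q {m f} → q * m ≤ sum q f → 0 < q → ∃[ a ] a < q × m ≤ f a
pigeonhole q {m} {f} le 0<q with search q (λ a → m ≤ᵇ f a)
... | inj₁ (a , a<q , p) = a , a<q , ≤ᵇ-sound p
... | inj₂ none = ⊥-elim (<-irrefl refl (≤-trans (strict q 0<q λ a a<q → ≤ᵇ-false {m} {f a} (none a a<q)) le))
  where
    strict : ∀ q → 0 < q → (∀ a → a < q → f a < m) → sum q f < q * m
    strict (suc zero)    _ h = ≤-trans (h 0 z<s) (≤-reflexive (sym (+-identityʳ m)))
    strict (suc (suc q)) _ h = ≤-trans (+-mono-< (strict (suc q) z<s λ a p → h a (m<n⇒m<1+n p)) (h (suc q) ≤-refl))
      (≤-reflexive (+-comm (suc q * m) m))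

pigeonhole-low : ∀ q {m f} → sum q f ≤ q * m → 0 < q → ∃[ a ] a < q × f a ≤ m
pigeonhole-low q {m} {f} le 0<q with search q (λ a → f a ≤ᵇ m)
... | inj₁ (a , a<q , p) = a , a<q , ≤ᵇ-sound p
... | inj₂ none = ⊥-elim (<-irrefl refl (≤-trans (strict q 0<q λ a a<q → ≤ᵇ-false {f a} {m} (none a a<q)) le))
  where
    strict : ∀ q → 0 < q → (∀ a → a < q → m < f a) → q * m < sum q f
    strict (suc zero)    _ h = ≤-trans (s≤s (≤-reflexive (+-identityʳ m))) (h 0 z<s)
    strict (suc (suc q)) _ h = ≤-trans (s≤s (≤-reflexive (+-comm m (suc q * m))))
      (+-mono-< (strict (suc q) z<s λ a p → h a (m<n⇒m<1+n p)) (h (suc q) ≤-refl))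

divMod-ext : ∀ {i j} o .{{_ : NonZero o}} → i / o ≡ j / o → i % o ≡ j % o → i ≡ j
divMod-ext {i} {j} o p q = trans (m≡m%n+[m/n]*n i o) (trans (cong₂ (λ a b → a + b * o) q p) (sym (m≡m%n+[m/n]*n j o)))

module Words (b n : ℕ) (E : ℕ → ℕ → Bool) where

  Word : Set
  Word = ℕ → ℕ

  Differ : (ℕ → Bool) → Word → Word → Set
  Differ U x y = ∃[ v ] v < n × U v ≡ true × x v ≢ y v

  -- Knowing its neighbours in U, the vertex v cannot tell x from y.
  record Clash (U : ℕ → Bool) (x y : Word) : Set where
    constructor clashes
    field
      {vertex} : ℕ
      bound    : vertex < n
      member   : U vertex ≡ true
      differ   : x vertex ≢ y vertex
      agree    : ∀ u → u < n → U u ≡ true → E vertex u ≡ true → x u ≡ y u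

  clash : (ℕ → Bool) → Word → Word → Bool
  clash U x y = any n λ v → U v ∧ (not (x v ≡ᵇ y v) ∧ all n (λ u → not (U u ∧ E v u) ∨ (x u ≡ᵇ y u)))

  clash-sound : ∀ {U x y} → clash U x y ≡ true → Clash U x y
  clash-sound {U} {x} {y} p with any-elim n p
  ... | v , v<n , q = clashes v<n (∧-left q) (≡ᵇ-false (x v) (y v) (not-elim (∧-left q′))) agree
    where
      q′ = ∧-right {U v} q
      agree : ∀ u → u < n → U u ≡ true → E v u ≡ true → x u ≡ y u
      agree u u<n a e with ∨-elim {not (U u ∧ E v u)} (all-elim n (∧-right {not (x v ≡ᵇ y v)} q′) u<n)
      ... | inj₁ f = absurd (∧-intro a e) (not-elim f)
      ... | inj₂ r = ≡ᵇ-sound r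

  clash-complete : ∀ {U x y} → Clash U x y → clash U x y ≡ true
  clash-complete {U} {x} {y} (clashes {v} v<n m d f) = any-intro n v<n (∧-intro m (∧-intro (not-intro (≢⇒≡ᵇ (x v) (y v) d))
    (all-intro n λ u u<n → agree u u<n)))
    where
      agree : ∀ u → u < n → not (U u ∧ E v u) ∨ (x u ≡ᵇ y u) ≡ true
      agree u u<n with U u ∧ E v u in e
      ... | true  = ≡ᵇ-complete (f u u<n (∧-left e) (∧-right {U u} e))
      ... | false = refl

  Clash-cong : ∀ {U x y x′ y′} → (∀ v → v < n → U v ≡ true → x v ≡ x′ v) → (∀ v → v < n → U v ≡ true → y v ≡ y′ v) →
    Clash U x y → Clash U x′ y′
  Clash-cong f g (clashes v<n m d h) = clashes v<n m
    (λ e → d (trans (f _ v<n m) (trans e (sym (g _ v<n m)))))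
    (λ u u<n a e → trans (sym (f u u<n a)) (trans (h u u<n a e) (g u u<n a)))

  Clash-ext : ∀ {U Z x y} → (∀ i → i < n → U i ≡ Z i) → Clash U x y → Clash Z x y
  Clash-ext f (clashes v<n m d h) = clashes v<n (trans (sym (f _ v<n)) m) d
    λ u u<n a → h u u<n (trans (f u u<n) a)

  put : ℕ → ℕ → Word → Word
  put v a x u = if u ≡ᵇ v then a else x u

  put-same : ∀ v a x → put v a x v ≡ a
  put-same v a x rewrite ≡ᵇ-refl v = refl

  put-other : ∀ v a x {u} → u ≢ v → put v a x u ≡ x u
  put-other v a x {u} f rewrite ≢⇒≡ᵇ u v f = refl

  put-idle : ∀ v {a} x → x v ≡ a → ∀ w → put v a x w ≡ x w
  put-idle v {a} x e w with w ≟ v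
  ... | yes refl = trans (put-same v a x) (sym e)
  ... | no w≢v   = put-other v a x w≢v

  put-bound : ∀ v {a x q} → a < q → (∀ u → x u < q) → ∀ u → put v a x u < q
  put-bound v p h u with u ≡ᵇ v
  ... | true  = p
  ... | false = h u

  -- Both words receive the same letter at v, so seeing v does not help any other vertex to tell
  -- them apart.
  Clash-put : ∀ {U v x y} a → Clash (del U v) x y → U v ≡ true → Clash U (put v a x) (put v a y)
  Clash-put {U} {v} {x} {y} a (clashes {w} w<n m d f) p = clashes w<n (del⊆ U m)
    (λ e → d (trans (sym (put-other v a x w≢v)) (trans e (put-other v a y w≢v)))) agree
    where
      w≢v = del-≢ U m
      agree : ∀ u → u < n → U u ≡ true → E w u ≡ true → put v a x u ≡ put v a y u
      agree u u<n q e with u ≟ v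
      ... | yes refl = trans (put-same v a x) (sym (put-same v a y))
      ... | no  u≢v  = trans (put-other v a x u≢v) (trans (f u u<n (trans (del-other U u≢v) q) e) (sym (put-other v a y u≢v)))

  -- Words are total functions of which only the values on U matter, so distinctness is required on
  -- U. Indexing by numbers below m replaces duplicate-free lists.
  record Storage (U : ℕ → Bool) (m : ℕ) : Set where
    constructor storage
    field
      family   : ℕ → Word
      digits   : ∀ i v → family i v < suc b
      distinct : ∀ i j → i < m → j < m → i ≢ j → Differ U (family i) (family j)
      safe     : ∀ i j → i < m → j < m → i ≢ j → ¬ Clash U (family i) (family j)

  storage-restrict : ∀ {U m m′} → m′ ≤ m → Storage U m → Storage U m′
  storage-restrict le (storage c dig dist safe) = storage c dig
    (λ i j p q → dist i j (≤-trans p le) (≤-trans q le)) (λ i j p q → safe i j (≤-trans p le) (≤-trans q le))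

  letter : (ℕ → Bool) → ℕ → Word
  letter U x v = digit b (count v U) x

  module Brute (U : ℕ → Bool) where

    universe : ℕ
    universe = suc b ^ count n U

    -- A storage code is an independent set of the confusion graph, whose vertices are the words
    -- over U and whose edges are the clashes. X is the bit mask of a set of words.
    independent : ℕ → Bool
    independent X = all universe λ x → all universe λ y → not (bit x X ∧ (bit y X ∧ clash U (letter U x) (letter U y)))

    stores : ℕ → Bool
    stores m = any (2 ^ universe) λ X → independent X ∧ (m ≤ᵇ count universe (λ x → bit x X))

    independent-elim : ∀ {X x y} → independent X ≡ true → x < universe → y < universe → bit x X ≡ true → bit y X ≡ true →
      ¬ Clash U (letter U x) (letter U y)
    independent-elim {X} {x} {y} p x< y< bx by c = absurd (∧-intro bx (∧-intro by (clash-complete c)))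
      (not-elim (all-elim universe (all-elim universe p x<) y<))

    independent-intro : ∀ {X} → (∀ x y → x < universe → y < universe → bit x X ≡ true → bit y X ≡ true →
      ¬ Clash U (letter U x) (letter U y)) → independent X ≡ true
    independent-intro {X} h = all-intro universe λ x x< → all-intro universe λ y y< → not-intro (≢true λ p →
      let p₂ = ∧-right {bit x X} p in h x y x< y< (∧-left p) (∧-left p₂) (clash-sound (∧-right {bit y X} p₂)))

    letter-differ : ∀ {x y} → x < universe → y < universe → x ≢ y → Differ U (letter U x) (letter U y)
    letter-differ {x} {y} x< y< x≢y with search (count n U) (λ i → not (digit b i x ≡ᵇ digit b i y))
    ... | inj₂ same = ⊥-elim (x≢y (digit-ext b (count n U) x< y< λ i p → ≡ᵇ-sound (not-false (same i p))))
    ... | inj₁ (i , p , d) = let selected v<n m r = select-spec n U p in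
      select n U i , v<n , m , λ e → ≡ᵇ-false (digit b i x) (digit b i y) (not-elim d)
        (subst (λ r → digit b r x ≡ digit b r y) r e)

    letter-code : ∀ {f v} → (∀ v → f v < suc b) → v < n → U v ≡ true → letter U (code b n U f) v ≡ f v
    letter-code h = digit-code b n U h

    stores-sound : ∀ {m} → stores m ≡ true → Storage U m
    stores-sound {m} p with any-elim (2 ^ universe) p
    ... | X , _ , q = storage (letter U ∘ pickᵢ) (λ i v → digit<base b (count v U) (pickᵢ i))
        (λ i j i<m j<m i≢j → letter-differ (Selected.bound (spec i<m)) (Selected.bound (spec j<m)) (λ e → i≢j (unique i<m j<m e)))
        (λ i j i<m j<m _ → independent-elim (∧-left q) (Selected.bound (spec i<m)) (Selected.bound (spec j<m))
          (Selected.member (spec i<m)) (Selected.member (spec j<m)))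
      where
        pickᵢ = select universe (λ x → bit x X)
        spec : ∀ {i} → i < m → Selected universe (λ x → bit x X) i (pickᵢ i)
        spec i<m = select-spec universe (λ x → bit x X) (≤-trans i<m (≤ᵇ-sound {m} (∧-right {independent X} q)))
        unique : ∀ {i j} → i < m → j < m → pickᵢ i ≡ pickᵢ j → i ≡ j
        unique i<m j<m e = trans (sym (Selected.ranked (spec i<m)))
          (trans (cong (λ z → count z (λ x → bit x X)) e) (Selected.ranked (spec j<m)))

    stores-complete : ∀ {m} → Storage U m → stores m ≡ true
    stores-complete {m} (storage c dig distinct safe) = any-intro (2 ^ universe) (mask< universe C)
      (∧-intro (independent-intro ind) (≤ᵇ-complete (injection-count m universe κ
        (λ i i<m → code< b n U (dig i) , trans (bit-mask universe C (code< b n U (dig i))) (any-intro m i<m (≡ᵇ-refl (κ i))))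
        inj)))
      where
        κ : ℕ → ℕ
        κ i = code b n U (c i)
        C : ℕ → Bool
        C x = any m (λ i → x ≡ᵇ κ i)
        back : ∀ i v → v < n → U v ≡ true → letter U (κ i) v ≡ c i v
        back i v = letter-code (dig i)
        inj : ∀ i j → i < m → j < m → κ i ≡ κ j → i ≡ j
        inj i j i<m j<m e with i ≟ j
        ... | yes p = p
        ... | no i≢j = let v , v<n , m , d = distinct i j i<m j<m i≢j in
          ⊥-elim (d (trans (sym (back i v v<n m)) (trans (cong (λ z → letter U z v) e) (back j v v<n m))))
        ind : ∀ x y → x < universe → y < universe → bit x (mask universe C) ≡ true → bit y (mask universe C) ≡ true →
          ¬ Clash U (letter U x) (letter U y)
        ind x y x< y< bx by cl with any-elim m (trans (sym (bit-mask universe C x<)) bx) | any-elim m (trans (sym (bit-mask universe C y<)) by)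
        ... | i , i<m , p | j , j<m , r with ≡ᵇ-sound {x} p | ≡ᵇ-sound {y} r | i ≟ j
        ...   | refl | refl | yes refl = Clash.differ cl refl
        ...   | refl | refl | no i≢j = safe i j i<m j<m i≢j (Clash-cong (back i) (back j) cl)

  module _ (E-sym : ∀ u v → u < n → v < n → E u v ≡ E v u) where

    storage-saving : Saving n E (λ U k → Storage U (suc b ^ k))
    storage-saving = record
      { ext = λ {U} {Z} {k} → ext {U} {Z} {k} ; empty = empty
      ; lower = λ {U} {k} → lower {U} {k} ; grow = λ {U} {v} {k} → grow {U} {v} {k}
      ; pair = λ {U} {u} {v} {k} → pair {U} {u} {v} {k} ; cut = λ {U} {v} {k} → cut {U} {v} {k}
      ; lone = λ {U} {v} {k} → lone {U} {v} {k} }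
      where
        ext : ∀ {U Z k} → (∀ i → i < n → U i ≡ Z i) → Storage U (suc b ^ k) → Storage Z (suc b ^ k)
        ext f (storage c dig dist safe) = storage c dig
          (λ i j p q r → let v , v<n , m , d = dist i j p q r in v , v<n , trans (sym (f v v<n)) m , d)
          (λ i j p q r → safe i j p q r ∘ Clash-ext λ i i<n → sym (f i i<n))

        empty : Storage (λ _ → false) 1
        empty = storage (λ _ _ → 0) (λ _ _ → z<s)
          (λ where zero zero _ _ r → ⊥-elim (r refl) ; (suc _) _ (s≤s ()) ; _ (suc _) _ (s≤s ()))
          (λ _ _ _ _ _ c → case Clash.member c of λ ())

        lower : ∀ {U k} → Storage U (suc b ^ suc k) → Storage U (suc b ^ k)
        lower {k = k} = storage-restrict (m≤n*m (suc b ^ k) (suc b))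

        grow : ∀ {U v k} → v < n → U v ≡ false → Storage U (suc b ^ k) → Storage (ins U v) (suc b ^ k)
        grow {U} {v} v<n v∉U (storage c dig dist safe) = storage (λ i → put v 0 (c i)) (λ i → put-bound v z<s (dig i))
          (λ i j p q r → let w , w<n , m , d = dist i j p q r in
            w , w<n , ins-old U v m , λ e → d (trans (sym (keep i m)) (trans e (keep j m))))
          (λ i j p q r → safe i j p q r ∘ shrinks i j)
          where
            U≢v : ∀ {w} → U w ≡ true → w ≢ v
            U≢v m refl = absurd m v∉U
            keep : ∀ i {w} → U w ≡ true → put v 0 (c i) w ≡ c i w
            keep i m = put-other v 0 (c i) (U≢v m)
            shrinks : ∀ i j → Clash (ins U v) (put v 0 (c i)) (put v 0 (c j)) → Clash U (c i) (c j)
            shrinks i j (clashes w<n m d f) with ins-elim U m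
            ... | inj₂ refl = ⊥-elim (d (trans (put-same v 0 (c i)) (sym (put-same v 0 (c j)))))
            ... | inj₁ w∈U = clashes w<n w∈U (λ e → d (trans (keep i w∈U) (trans e (sym (keep j w∈U)))))
              λ u u<n a e → trans (sym (keep i a)) (trans (f u u<n (ins-old U v a) e) (keep j a))

        -- Each old word is repeated for every letter, written at both u and v: each of the two
        -- recovers its letter from the other. Index i stands for the old word `i / q` and the
        -- letter `i % q`.
        pair : ∀ {U u v k} → u < n → v < n → U u ≡ false → ins U u v ≡ false → E u v ≡ true →
          Storage U (suc b ^ k) → Storage (ins (ins U u) v) (suc b ^ suc k)
        pair {U} {u} {v} {k} u<n v<n u∉ v∉ e (storage c dig dist safe) = storage c′
          (λ i → put-bound v (m%n<n i (suc b)) (put-bound u (m%n<n i (suc b)) (dig (i / suc b)))) dist′ safe′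
          where
            c′ : ℕ → Word
            c′ i = put v (i % suc b) (put u (i % suc b) (c (i / suc b)))
            Z = ins (ins U u) v
            u≢v : u ≢ v
            u≢v refl = absurd (ins-self U u) v∉
            at-u : ∀ i → c′ i u ≡ i % suc b
            at-u i = trans (put-other v r (put u r x) u≢v) (put-same u r x)
              where r = i % suc b
                    x = c (i / suc b)
            at-v : ∀ i → c′ i v ≡ i % suc b
            at-v i = put-same v (i % suc b) (put u (i % suc b) (c (i / suc b)))
            at-U : ∀ i {w} → U w ≡ true → c′ i w ≡ c (i / suc b) w
            at-U i m = trans (put-other v r (put u r x) λ where refl → absurd (ins-old U u m) v∉)
              (put-other u r x λ where refl → absurd m u∉)
              where r = i % suc b
                    x = c (i / suc b)
            high : ∀ {i} → i < suc b ^ suc k → i / suc b < suc b ^ k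
            high {i} p = m<n*o⇒m/o<n (subst (i <_) (*-comm (suc b) (suc b ^ k)) p)
            dist′ : ∀ i j → i < suc b ^ suc k → j < suc b ^ suc k → i ≢ j → Differ Z (c′ i) (c′ j)
            dist′ i j p q r with i / suc b ≟ j / suc b
            ... | yes same = v , v<n , ins-self (ins U u) v , λ z →
              r (divMod-ext (suc b) same (trans (sym (at-v i)) (trans z (at-v j))))
            ... | no other = let w , w<n , m , d = dist _ _ (high p) (high q) other in
              w , w<n , ins-old (ins U u) v (ins-old U u m) , λ z → d (trans (sym (at-U i m)) (trans z (at-U j m)))
            safe′ : ∀ i j → i < suc b ^ suc k → j < suc b ^ suc k → i ≢ j → ¬ Clash Z (c′ i) (c′ j)
            safe′ i j p q r (clashes {w} w<n m d f) with ins-elim (ins U u) m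
            ... | inj₂ refl = d (trans (at-v i) (trans (trans (sym (at-u i))
                  (trans (f u u<n (ins-old (ins U u) v (ins-self U u)) (trans (E-sym v u v<n u<n) e)) (at-u j))) (sym (at-v j))))
            ... | inj₁ m′ with ins-elim U m′
            ...   | inj₂ refl = d (trans (at-u i) (trans (trans (sym (at-v i))
                    (trans (f v v<n (ins-self (ins U u) v) e) (at-v j))) (sym (at-u j))))
            ...   | inj₁ w∈U = safe _ _ (high p) (high q)
                    (λ same → d (trans (at-U i w∈U) (trans (cong (λ z → c z w) same) (sym (at-U j w∈U)))))
                    (clashes w<n w∈U (λ z → d (trans (at-U i w∈U) (trans z (sym (at-U j w∈U)))))
                      λ x x<n a e′ → trans (sym (at-U i a)) (trans (f x x<n (ins-old (ins U u) v (ins-old U u a)) e′) (at-U j a)))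

        -- By pigeonhole some letter at v occurs in at least a q-th part of the words. Keeping only
        -- these makes v constant, so its deletion loses no information.
        cut : ∀ {U v k} → v < n → U v ≡ true → Storage U (suc b ^ suc k) → Storage (del U v) (suc b ^ k)
        cut {U} {v} {k} v<n v∈U (storage c dig dist safe) = storage (c ∘ σ) (dig ∘ σ)
            (λ i j p q r → let w , w<n , m , d = dist (σ i) (σ j) (σ< p) (σ< q) (r ∘ σ-injective p q) in
              w , w<n , trans (del-other U λ e → d (subst (λ z → c (σ i) z ≡ c (σ j) z) (sym e) (trans (at-v p) (sym (at-v q))))) m , d)
            (λ i j p q r cl → safe (σ i) (σ j) (σ< p) (σ< q) (r ∘ σ-injective p q)
              (Clash-cong (λ w _ _ → back p w) (λ w _ _ → back q w) (Clash-put _ cl v∈U)))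
          where
            M = suc b ^ suc k
            P : ℕ → ℕ → Bool
            P a i = c i v ≡ᵇ a
            once : ∀ i → count (suc b) (λ a → P a i) ≡ 1
            once i = trans (count-cong (suc b) λ a _ → bool-ext (λ p → ≡ᵇ-complete (sym (≡ᵇ-sound {c i v} p))) (λ p → ≡ᵇ-complete (sym (≡ᵇ-sound {a} p))))
              (count-single (suc b) (c i v) (dig i v))
            total : sum (suc b) (λ a → count M (P a)) ≡ M
            total = trans (sum-swap (suc b) M (λ a i → 𝟙 (P a i)))
              (trans (sum-cong M λ i _ → once i) (count-true M))
            chosen : ∃[ a ] a < suc b × suc b ^ k ≤ count M (P a)
            chosen = pigeonhole (suc b) (≤-reflexive (sym total)) z<s
            a = proj₁ chosen
            σ = select M (P a)
            spec : ∀ {i} → i < suc b ^ k → Selected M (P a) i (σ i)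
            spec p = select-spec M (P a) (≤-trans p (proj₂ (proj₂ chosen)))
            σ< : ∀ {i} → i < suc b ^ k → σ i < M
            σ< p = Selected.bound (spec p)
            at-v : ∀ {i} → i < suc b ^ k → c (σ i) v ≡ a
            at-v p = ≡ᵇ-sound (Selected.member (spec p))
            σ-injective : ∀ {i j} → i < suc b ^ k → j < suc b ^ k → σ i ≡ σ j → i ≡ j
            σ-injective p q e = trans (sym (Selected.ranked (spec p))) (trans (cong (λ z → count z (P a)) e) (Selected.ranked (spec q)))
            back : ∀ {i} → i < suc b ^ k → ∀ w → put v a (c (σ i)) w ≡ c (σ i) w
            back {i} p = put-idle v (c (σ i)) (at-v p)

        -- An isolated vertex sees nothing, so all words of the code carry the same letter there and
        -- remain distinct without it.
        lone : ∀ {U v k} → v < n → U v ≡ true → (∀ u → u < n → U u ≡ true → E v u ≡ false) →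
          Storage U (suc b ^ k) → Storage (del U v) (suc b ^ k)
        lone {U} {v} {k} v<n v∈U iso (storage c dig dist safe) = storage c dig
            (λ i j p q r → let w , w<n , m , d = dist i j p q r in
              w , w<n , trans (del-other U λ e → d (subst (λ z → c i z ≡ c j z) (sym e) (same p q r))) m , d)
            (λ i j p q r cl → safe i j p q r
              (Clash-cong (λ w _ _ → put-idle v (c i) refl w) (λ w _ _ → put-idle v (c j) (sym (same p q r)) w) (Clash-put (c i v) cl v∈U)))
          where
            same : ∀ {i j} → i < suc b ^ k → j < suc b ^ k → i ≢ j → c i v ≡ c j v
            same {i} {j} p q r with c i v ≟ c j v
            ... | yes e = e
            ... | no d = ⊥-elim (safe i j p q r (clashes v<n v∈U d λ u u<n a e → absurd e (iso u u<n a)))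

-- Index codes

base-ext : ∀ {Q a a′ d d′} → a < Q → a′ < Q → a + d * Q ≡ a′ + d′ * Q → a ≡ a′ × d ≡ d′
base-ext {suc Q} {a} {a′} {d} {d′} p q e = a≡ , *-cancelʳ-≡ d d′ (suc Q) (+-cancelˡ-≡ a _ _ (trans e (cong (_+ d′ * suc Q) (sym a≡))))
  where
    low : ∀ {a} d → a < suc Q → (a + d * suc Q) % suc Q ≡ a
    low {a} d p = trans ([m+kn]%n≡m%n a d (suc Q)) (m<n⇒m%n≡m p)
    a≡ = trans (sym (low d p)) (trans (cong (_% suc Q) e) (low d′ q))

-- Adding s is undone modulo q by adding q s - s, which avoids negative numbers.
%-cancel : ∀ {q a a′} s → a < suc q → a′ < suc q → (a + s) % suc q ≡ (a′ + s) % suc q → a ≡ a′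
%-cancel {q} {a} {a′} s p p′ e = trans (sym (undo a p)) (trans (cong (λ z → (z + t) % suc q) e) (undo a′ p′))
  where
    t = suc q * s ∸ s
    undo : ∀ a → a < suc q → ((a + s) % suc q + t) % suc q ≡ a
    undo a p = begin
      ((a + s) % suc q + t) % suc q             ≡⟨ %-distribˡ-+ ((a + s) % suc q) t (suc q) ⟩
      ((a + s) % suc q % suc q + t % suc q) % suc q ≡⟨ cong (λ z → (z + t % suc q) % suc q) (m%n%n≡m%n (a + s) (suc q)) ⟩
      ((a + s) % suc q + t % suc q) % suc q     ≡⟨ %-distribˡ-+ (a + s) t (suc q) ⟨
      (a + s + t) % suc q                       ≡⟨ cong (_% suc q) (trans (+-assoc a s t) (cong (a +_) (m+[n∸m]≡n (m≤n*m s (suc q))))) ⟩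
      (a + suc q * s) % suc q                   ≡⟨ encode-low q a s p ⟩
      a                                         ∎
      where open ≡-Reasoning

digit-zero : ∀ b i → digit b i 0 ≡ 0
digit-zero b i = cong (_% suc b) (drop-zero i)
  where
    drop-zero : ∀ i → drop b i 0 ≡ 0
    drop-zero zero    = refl
    drop-zero (suc i) = cong (_/ suc b) (drop-zero i)

module Colourings (b n : ℕ) (E : ℕ → ℕ → Bool) where
  open Words b n E public

  -- The values of an index code of length ℓ are q ^ ℓ colours that separate clashing words.
  record Colouring (U : ℕ → Bool) (c : ℕ) : Set where
    constructor colouring
    field
      colour : ℕ → ℕ
      bounded : ∀ x → x < suc b ^ n → colour x < c
      proper  : ∀ x y → x < suc b ^ n → y < suc b ^ n →
                Clash U (λ v → digit b v x) (λ v → digit b v y) → colour x ≢ colour y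

  Indexable : (ℕ → Bool) → ℕ → Set
  Indexable U k = ∃[ ℓ ] ℓ + k ≤ count n U × Colouring U (suc b ^ ℓ)

  private
    q = suc b

    word : ℕ → Word
    word x v = digit b v x

    word-encode : ∀ {f} → (∀ v → f v < q) → ∀ v → v < n → word (encode b n f) v ≡ f v
    word-encode h = digit-encode b n _ (λ i _ → h i)

  overwrite : ℕ → ℕ → ℕ → ℕ
  overwrite v a x = encode b n (put v a (word x))

  overwrite< : ∀ v {a} x → a < q → overwrite v a x < q ^ n
  overwrite< v x p = full-code< b n (put-bound v p λ u → digit<base b u x)

  word-overwrite : ∀ v {a} x → a < q → ∀ u → u < n → word (overwrite v a x) u ≡ put v a (word x) u
  word-overwrite v x p = word-encode (put-bound v p λ u → digit<base b u x)

  Clash-overwrite : ∀ {U v a x y} → a < q → U v ≡ true → Clash (del U v) (word x) (word y) →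
    Clash U (word (overwrite v a x)) (word (overwrite v a y))
  Clash-overwrite {v = v} {a} {x} {y} p m cl = Clash-cong
    (λ u u<n _ → sym (word-overwrite v x p u u<n)) (λ u u<n _ → sym (word-overwrite v y p u u<n)) (Clash-put a cl m)

  -- The letter `d x` is transmitted in addition, as the leading digit of the new colour. The old
  -- colouring has to separate only those clashes that this letter leaves open.
  widen : ∀ {U ℓ} (C : Colouring U (q ^ ℓ)) (d : ℕ → ℕ) {Z} → (∀ x → d x < q) →
    (∀ x y → Clash Z (word x) (word y) → d x ≡ d y → Clash U (word x) (word y)) → Colouring Z (q ^ suc ℓ)
  widen {ℓ = ℓ} (colouring col bd pr) d d< h = colouring (λ x → col x + d x * q ^ ℓ)
    (λ x x< → ≤-trans (+-monoˡ-≤ (d x * q ^ ℓ) (bd x x<)) (*-monoˡ-≤ (q ^ ℓ) (d< x)))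
    (λ x y x< y< cl e → let e₁ , e₂ = base-ext (bd x x<) (bd y y<) e in pr x y x< y< (h x y cl e₂) e₁)

  module _ (1≤b : 1 ≤ b) (E-sym : ∀ u v → u < n → v < n → E u v ≡ E v u) where

    indexable-saving : Saving n E Indexable
    indexable-saving = record
      { ext = λ {U} {Z} {k} → ext {U} {Z} {k} ; empty = empty ; lower = λ {U} {k} → lower {U} {k}
      ; grow = λ {U} {v} {k} → grow {U} {v} {k} ; pair = λ {U} {u} {v} {k} → pair {U} {u} {v} {k}
      ; cut = λ {U} {v} {k} → cut {U} {v} {k} ; lone = λ {U} {v} {k} → lone {U} {v} {k} }
      where
        ext : ∀ {U Z k} → (∀ i → i < n → U i ≡ Z i) → Indexable U k → Indexable Z k
        ext f (ℓ , le , colouring col bd pr) = ℓ , subst (_ ≤_) (count-cong n f) le ,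
          colouring col bd (λ x y x< y< cl → pr x y x< y< (Clash-ext (λ i i<n → sym (f i i<n)) cl))

        empty : Indexable (λ _ → false) 0
        empty = 0 , z≤n , colouring (λ _ → 0) (λ _ _ → z<s) λ _ _ _ _ cl → case Clash.member cl of λ ()

        lower : ∀ {U k} → Indexable U (suc k) → Indexable U k
        lower {k = k} (ℓ , le , C) = ℓ , ≤-trans (+-monoʳ-≤ ℓ (n≤1+n k)) le , C

        grow : ∀ {U v k} → v < n → U v ≡ false → Indexable U k → Indexable (ins U v) k
        grow {U} {v} v<n v∉U (ℓ , le , C) = suc ℓ , ≤-trans (s≤s le) (≤-reflexive (sym (count-ins n v<n v∉U))) ,
          widen {ℓ = ℓ} C (λ x → word x v) (λ x → digit<base b v x) reduce
          where
            reduce : ∀ x y → Clash (ins U v) (word x) (word y) → word x v ≡ word y v → Clash U (word x) (word y)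
            reduce x y (clashes w<n m d f) e with ins-elim U m
            ... | inj₂ refl = ⊥-elim (d e)
            ... | inj₁ w∈U = clashes w<n w∈U d λ u u<n a → f u u<n (ins-old U v a)

        -- The additional letter is the sum of the letters at u and v modulo q. Each of the two
        -- vertices sees the other one and subtracts, so two vertices are served by one letter.
        pair : ∀ {U u v k} → u < n → v < n → U u ≡ false → ins U u v ≡ false → E u v ≡ true →
          Indexable U k → Indexable (ins (ins U u) v) (suc k)
        pair {U} {u} {v} {k} u<n v<n u∉ v∉ e (ℓ , le , C) = suc ℓ ,
          ≤-trans (s≤s (≤-trans (≤-reflexive (+-suc ℓ k)) (s≤s le)))
            (≤-reflexive (sym (trans (count-ins n v<n v∉) (cong suc (count-ins n u<n u∉))))) ,
          widen {ℓ = ℓ} C (λ x → (word x u + word x v) % q) (λ x → m%n<n (word x u + word x v) q) reduce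
          where
            reduce : ∀ x y → Clash (ins (ins U u) v) (word x) (word y) → (word x u + word x v) % q ≡ (word y u + word y v) % q →
              Clash U (word x) (word y)
            reduce x y (clashes w<n m d f) s with ins-elim (ins U u) m
            ... | inj₂ refl = ⊥-elim (d (%-cancel (word x u) (digit<base b v x) (digit<base b v y)
                  (trans (cong (_% q) (+-comm (word x v) (word x u))) (trans s (cong (_% q)
                    (trans (+-comm (word y u) (word y v)) (cong (word y v +_)
                      (sym (f u u<n (ins-old (ins U u) v (ins-self U u)) (trans (E-sym v u v<n u<n) e))))))))))
            ... | inj₁ m′ with ins-elim U m′
            ...   | inj₂ refl = ⊥-elim (d (%-cancel (word x v) (digit<base b u x) (digit<base b u y)
                    (trans s (cong (λ z → (word y u + z) % q) (sym (f v v<n (ins-self (ins U u) v) e))))))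
            ...   | inj₁ w∈U = clashes w<n w∈U d λ z z<n a → f z z<n (ins-old (ins U u) v (ins-old U u a))

        -- The old colouring is applied to the words whose letter at v is fixed to 0; the length
        -- stays, and the vertex count drops by one.
        cut : ∀ {U v k} → v < n → U v ≡ true → Indexable U (suc k) → Indexable (del U v) k
        cut {U} {v} {k} v<n v∈U (ℓ , le , colouring col bd pr) =
          ℓ , ≤-pred (≤-trans (≤-reflexive (sym (+-suc ℓ k))) (≤-trans le (≤-reflexive (count-del n v<n v∈U)))) ,
          colouring (col ∘ overwrite v 0) (λ x _ → bd _ (overwrite< v x z<s))
            λ x y _ _ cl → pr _ _ (overwrite< v x z<s) (overwrite< v y z<s) (Clash-overwrite {x = x} {y} z<s v∈U cl)

        -- The words with distinct letters at an isolated vertex use disjoint sets of colours,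
        -- so some letter uses at most a q-th part of all colours.
        lone : ∀ {U v k} → v < n → U v ≡ true → (∀ u → u < n → U u ≡ true → E v u ≡ false) →
          Indexable U k → Indexable (del U v) k
        lone {U} {v} {k} v<n v∈U iso (ℓ , le , colouring col bd pr) = shrunk ℓ le total
          where
            hit : ℕ → ℕ → Bool
            hit a c = any (q ^ n) λ x → (word x v ≡ᵇ a) ∧ (col x ≡ᵇ c)

            hit-intro : ∀ {a x} → x < q ^ n → word x v ≡ a → hit a (col x) ≡ true
            hit-intro {a} {x} x< e = any-intro (q ^ n) x< (∧-intro (≡ᵇ-complete e) (≡ᵇ-refl (col x)))

            unique : ∀ c a a′ → hit a c ≡ true → hit a′ c ≡ true → a ≡ a′
            unique c a a′ h h′ with any-elim (q ^ n) h | any-elim (q ^ n) h′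
            ... | x , x< , p | y , y< , r with word x v ≟ word y v
            ...   | yes e = trans (sym (≡ᵇ-sound {word x v} (∧-left p))) (trans e (≡ᵇ-sound {word y v} (∧-left r)))
            ...   | no d = ⊥-elim (pr x y x< y< (clashes v<n v∈U d λ u u<n m e → absurd e (iso u u<n m))
                    (trans (≡ᵇ-sound {col x} (∧-right {word x v ≡ᵇ a} p)) (sym (≡ᵇ-sound {col y} (∧-right {word y v ≡ᵇ a′} r)))))

            once : ∀ c → count q (λ a → hit a c) ≤ 1
            once c with search q (λ a → hit a c)
            ... | inj₂ none = ≤-trans (≤-reflexive (count-none q none)) z≤n
            ... | inj₁ (a , a<q , h) = ≤-trans (count-mono q {λ a → hit a c} {_≡ᵇ a} λ a′ _ h′ → ≡ᵇ-complete (unique c a′ a h′ h))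
                    (≤-reflexive (count-single q a a<q))

            total : sum q (λ a → count (q ^ ℓ) (hit a)) ≤ q ^ ℓ
            total = ≤-trans (≤-reflexive (sum-swap q (q ^ ℓ) (λ a c → 𝟙 (hit a c))))
              (≤-trans (sum-mono (q ^ ℓ) λ c _ → once c) (≤-reflexive (count-true (q ^ ℓ))))

            -- All words are given the letter a at v, and the colours that occur with a are
            -- renumbered by their rank among them.
            recolour : ∀ {a c} → a < q → count (q ^ ℓ) (hit a) ≤ c → Colouring (del U v) c
            recolour {a} a<q le = colouring (λ x → count (col (overwrite v a x)) (hit a))
              (λ x _ → ≤-trans (rank-< (hit a) (hits x) (bd _ (overwrite< v x a<q))) le)
              (λ x y _ _ cl e → pr _ _ (overwrite< v x a<q) (overwrite< v y a<q) (Clash-overwrite {x = x} {y} a<q v∈U cl)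
                (rank-injective (hit a) (hits x) (hits y) e))
              where
                hits : ∀ x → hit a (col (overwrite v a x)) ≡ true
                hits x = hit-intro (overwrite< v x a<q) (trans (word-overwrite v x a<q v v<n) (put-same v a (word x)))

            shrunk : ∀ ℓ′ → ℓ′ + k ≤ count n U → sum q (λ a → count (q ^ ℓ) (hit a)) ≤ q ^ ℓ′ → Indexable (del U v) k
            -- A single colour is impossible: each of the q ≥ 2 letters at v uses some colour, and
            -- no two letters share one.
            shrunk zero _ tot = ⊥-elim (<-irrefl refl (≤-trans (s≤s 1≤b) (≤-trans everywhere tot)))
              where
                everywhere : q ≤ sum q (λ a → count (q ^ ℓ) (hit a))
                everywhere = ≤-trans (≤-reflexive (sym (count-true q))) (sum-mono q λ a a<q →
                  count-pos (q ^ ℓ) (bd _ (overwrite< v 0 a<q))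
                    (hit-intro (overwrite< v 0 a<q) (trans (word-overwrite v 0 a<q v v<n) (put-same v a (word 0)))))
            shrunk (suc ℓ′) le′ tot = let a , a<q , small = pigeonhole-low q tot z<s in
              ℓ′ , ≤-pred (≤-trans le′ (≤-reflexive (count-del n v<n v∈U))) , recolour a<q small

  module Table (U : ℕ → Bool) where
    open Brute U public

    everything : ℕ
    everything = mask universe (λ _ → true)

    without : ℕ → ℕ → ℕ
    without X Y = mask universe λ x → bit x X ∧ not (bit x Y)

    -- A set of words has c + 1 colours if removing some independent set Y leaves one with c
    -- colours. Y may contain words outside X, as only their removal from X counts, so every mask
    -- can be tried.
    colourable : ℕ → ℕ → Bool
    colourable zero    X = X ≡ᵇ 0
    colourable (suc c) X = any (2 ^ universe) λ Y → independent Y ∧ colourable c (without X Y)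

    record Partial (c X : ℕ) : Set where
      constructor partial
      field
        colour  : ℕ → ℕ
        bounded : ∀ x → x < universe → bit x X ≡ true → colour x < c
        proper  : ∀ x y → x < universe → y < universe → bit x X ≡ true → bit y X ≡ true →
                  Clash U (letter U x) (letter U y) → colour x ≢ colour y

    colourable-sound : ∀ c {X} → colourable c X ≡ true → Partial c X
    colourable-sound zero {X} p = partial (λ x → x) (λ x _ bx → none x bx) λ x _ _ _ bx _ _ _ → none x bx
      where
        none : ∀ x {A : Set} → bit x X ≡ true → A
        none x bx = absurd bx (cong (_≡ᵇ 1) (trans (cong (digit 1 x) (≡ᵇ-sound {X} p)) (digit-zero 1 x)))
    colourable-sound (suc c) {X} p with any-elim (2 ^ universe) p
    ... | Y , _ , r with colourable-sound c {without X Y} (∧-right {independent Y} r)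
    ...   | partial col bd pr = partial (λ x → if bit x Y then c else col x) bounded proper
      where
        outside : ∀ {x} → x < universe → bit x X ≡ true → bit x Y ≡ false → bit x (without X Y) ≡ true
        outside x< bx by = trans (bit-mask universe (λ x → bit x X ∧ not (bit x Y)) x<) (∧-intro bx (not-intro by))

        bounded : ∀ x → x < universe → bit x X ≡ true → (if bit x Y then c else col x) < suc c
        bounded x x< bx with bit x Y in by
        ... | true  = ≤-refl
        ... | false = m<n⇒m<1+n (bd x x< (outside x< bx by))

        proper : ∀ x y → x < universe → y < universe → bit x X ≡ true → bit y X ≡ true →
          Clash U (letter U x) (letter U y) → (if bit x Y then c else col x) ≢ (if bit y Y then c else col y)
        proper x y x< y< bx by cl e with bit x Y in x∈ | bit y Y in y∈
        ... | true  | true  = independent-elim (∧-left r) x< y< x∈ y∈ cl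
        ... | true  | false = <-irrefl (sym e) (bd y y< (outside y< by y∈))
        ... | false | true  = <-irrefl e (bd x x< (outside x< bx x∈))
        ... | false | false = pr x y x< y< (outside x< bx x∈) (outside y< by y∈) cl e

    colourable-complete : ∀ c {X} → X < 2 ^ universe → Partial c X → colourable c X ≡ true
    colourable-complete zero {X} X< (partial col bd pr) = ≡ᵇ-complete (digit-ext 1 universe X< (m^n>0 2 universe) λ x x< →
      trans (digit₁ x X) (trans (cong 𝟙 (≢true λ bx → n≮0 (bd x x< bx))) (sym (digit-zero 1 x))))
    colourable-complete (suc c) {X} X< (partial col bd pr) = any-intro (2 ^ universe) (mask< universe C)
      (∧-intro
        (independent-intro λ x y x< y< bx by cl → let p = trans (sym (in-C x<)) bx ; r = trans (sym (in-C y<)) by in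
          pr x y x< y< (∧-left p) (∧-left r) cl (trans (≡ᵇ-sound {col x} (∧-right {bit x X} p)) (sym (≡ᵇ-sound {col y} (∧-right {bit y X} r)))))
        (colourable-complete c (mask< universe _) (partial col
          (λ x x< bx → let p = trans (sym (in-W x<)) bx in ≤∧≢⇒< (≤-pred (bd x x< (∧-left p)))
            λ e → absurd (trans (in-C x<) (∧-intro (∧-left p) (≡ᵇ-complete e))) (not-elim (∧-right {bit x X} p)))
          (λ x y x< y< bx by → pr x y x< y< (∧-left (trans (sym (in-W x<)) bx)) (∧-left (trans (sym (in-W y<)) by))))))
      where
        C : ℕ → Bool
        C x = bit x X ∧ (col x ≡ᵇ c)
        in-C : ∀ {x} → x < universe → bit x (mask universe C) ≡ C x
        in-C = bit-mask universe C
        W : ℕ → Bool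
        W x = bit x X ∧ not (bit x (mask universe C))
        in-W : ∀ {x} → x < universe → bit x (mask universe W) ≡ W x
        in-W = bit-mask universe W

    paintable : ℕ → Bool
    paintable c = colourable c everything

    paintable-sound : ∀ {c} → paintable c ≡ true → Colouring U c
    paintable-sound {c} p with colourable-sound c p
    ... | partial col bd pr = colouring (col ∘ κ)
        (λ x _ → bd (κ x) (κ< x) (bit-mask universe (λ _ → true) (κ< x)))
        (λ x y _ _ cl → pr (κ x) (κ y) (κ< x) (κ< y) (bit-mask universe (λ _ → true) (κ< x)) (bit-mask universe (λ _ → true) (κ< y))
          (Clash-cong (λ v v<n m → sym (letter-code (digits x) v<n m)) (λ v v<n m → sym (letter-code (digits y) v<n m)) cl))
      where
        digits : ∀ x v → digit b v x < suc b
        digits x v = digit<base b v x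
        κ : ℕ → ℕ
        κ x = code b n U (λ v → digit b v x)
        κ< : ∀ x → κ x < universe
        κ< x = code< b n U (digits x)

    paintable-complete : ∀ {c} → Colouring U c → paintable c ≡ true
    paintable-complete {c} (colouring col bd pr) = colourable-complete c (mask< universe (λ _ → true))
      (partial (col ∘ κ) (λ x _ _ → bd (κ x) (κ< x)) λ x y _ _ _ _ cl → pr (κ x) (κ y) (κ< x) (κ< y)
        (Clash-cong (λ v v<n _ → sym (word-encode (digits x) v v<n)) (λ v v<n _ → sym (word-encode (digits y) v v<n)) cl))
      where
        digits : ∀ x v → letter U x v < suc b
        digits x v = digit<base b (count v U) x
        κ : ℕ → ℕ
        κ x = encode b n (letter U x)
        κ< : ∀ x → κ x < suc b ^ n
        κ< x = full-code< b n (digits x)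

    -- A shorter code also gives a colouring with more colours, so only the greatest admissible
    -- length, |U| - k, has to be tested.
    indexes : ℕ → Bool
    indexes k = (k ≤ᵇ count n U) ∧ paintable (suc b ^ (count n U ∸ k))

    indexes-sound : ∀ {k} → indexes k ≡ true → Indexable U k
    indexes-sound {k} p = count n U ∸ k , ≤-reflexive (m∸n+n≡m (≤ᵇ-sound {k} (∧-left p))) ,
      paintable-sound (∧-right {k ≤ᵇ count n U} p)

    indexes-complete : ∀ {k} → Indexable U k → indexes k ≡ true
    indexes-complete {k} (ℓ , le , colouring col bd pr) = ∧-intro (≤ᵇ-complete (≤-trans (m≤n+m k ℓ) le))
      (paintable-complete (colouring col
        (λ x x< → ≤-trans (bd x x<) (^-monoʳ-≤ (suc b) (≤-trans (≤-reflexive (sym (m+n∸n≡m ℓ k))) (∸-monoˡ-≤ k le)))) pr))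

-- Minrank

module LinearSums {c ℓ} (F : FiniteField c ℓ) where
  module FF = FiniteField F
  open FF using (Carrier; _≈_; _+ᶠ_; _*ᶠ_; 0#; 1#; -_) public

  module FR = Algebra.Properties.Ring FF.ring

  infixr 4 _⟶_
  _⟶_ : ∀ {x y z} → x ≈ y → y ≈ z → x ≈ z
  _⟶_ = FF.trans

  ≡⇒≈ : ∀ {x y} → x ≡ y → x ≈ y
  ≡⇒≈ refl = FF.refl

  Σᶠ : ℕ → (ℕ → Carrier) → Carrier
  Σᶠ zero    f = 0#
  Σᶠ (suc n) f = Σᶠ n f +ᶠ f n

  Σ-cong : ∀ n {f g} → (∀ j → j < n → f j ≈ g j) → Σᶠ n f ≈ Σᶠ n g
  Σ-cong zero    h = FF.refl
  Σ-cong (suc n) h = FF.+-cong (Σ-cong n λ j p → h j (m<n⇒m<1+n p)) (h n ≤-refl)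

  Σ-zero : ∀ n {f} → (∀ j → j < n → f j ≈ 0#) → Σᶠ n f ≈ 0#
  Σ-zero zero    h = FF.refl
  Σ-zero (suc n) h = FF.+-cong (Σ-zero n λ j p → h j (m<n⇒m<1+n p)) (h n ≤-refl) ⟶ FF.+-identityˡ 0#

  Σ-+ : ∀ n f g → Σᶠ n (λ j → f j +ᶠ g j) ≈ Σᶠ n f +ᶠ Σᶠ n g
  Σ-+ zero    f g = FF.sym (FF.+-identityˡ 0#)
  Σ-+ (suc n) f g = FF.+-congʳ (Σ-+ n f g) ⟶ swap (Σᶠ n f) (Σᶠ n g) (f n) (g n)
    where
      swap : ∀ a b x y → (a +ᶠ b) +ᶠ (x +ᶠ y) ≈ (a +ᶠ x) +ᶠ (b +ᶠ y)
      swap a b x y = FF.+-assoc a b (x +ᶠ y)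
        ⟶ FF.+-congˡ (FF.sym (FF.+-assoc b x y) ⟶ FF.+-congʳ (FF.+-comm b x) ⟶ FF.+-assoc x b y)
        ⟶ FF.sym (FF.+-assoc a x (b +ᶠ y))

  Σ-single : ∀ n {f v} → v < n → (∀ j → j < n → j ≢ v → f j ≈ 0#) → Σᶠ n f ≈ f v
  Σ-single (suc n) {f} {v} v<n h = <suc-case v<n
    (λ p → FF.+-cong (Σ-single n p λ j q → h j (m<n⇒m<1+n q)) (h n ≤-refl λ e → <-irrefl (sym e) p) ⟶ FF.+-identityʳ (f v))
    (λ where refl → FF.+-congʳ (Σ-zero v λ j q → h j (m<n⇒m<1+n q) (<⇒≢ q)) ⟶ FF.+-identityˡ (f v))

  Σ-pair : ∀ n {f u v} → u < n → v < n → u ≢ v → (∀ j → j < n → j ≢ u → j ≢ v → f j ≈ 0#) → Σᶠ n f ≈ f u +ᶠ f v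
  Σ-pair n {f} {u} {v} u<n v<n u≢v h = Σ-cong n parts ⟶ Σ-+ n (only u) (only v) ⟶ FF.+-cong (single u<n) (single v<n)
    where
      only : ℕ → ℕ → Carrier
      only w j = if j ≡ᵇ w then f j else 0#
      hit : ∀ w → only w w ≡ f w
      hit w rewrite ≡ᵇ-refl w = refl
      miss : ∀ {w j} → j ≢ w → only w j ≡ 0#
      miss {w} {j} p rewrite ≢⇒≡ᵇ j w p = refl
      single : ∀ {w} → w < n → Σᶠ n (only w) ≈ f w
      single {w} w<n = Σ-single n w<n (λ j _ p → ≡⇒≈ (miss p)) ⟶ ≡⇒≈ (hit w)
      parts : ∀ j → j < n → f j ≈ only u j +ᶠ only v j
      parts j j<n with j ≟ u | j ≟ v
      ... | yes refl | _ = FF.sym (FF.+-identityʳ (f j)) ⟶ ≡⇒≈ (cong₂ _+ᶠ_ (sym (hit j)) (sym (miss u≢v)))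
      ... | no p | yes refl = FF.sym (FF.+-identityˡ (f j)) ⟶ ≡⇒≈ (cong₂ _+ᶠ_ (sym (miss p)) (sym (hit j)))
      ... | no p | no q = h j j<n p q ⟶ FF.sym (FF.+-identityˡ 0#) ⟶ ≡⇒≈ (cong₂ _+ᶠ_ (sym (miss p)) (sym (miss q)))

  -- The coefficients of the relation e_u - e_v.
  opposite : ℕ → ℕ → ℕ → Carrier
  opposite u v j = if j ≡ᵇ u then 1# else (if j ≡ᵇ v then - 1# else 0#)

  opposite-first : ∀ u v → opposite u v u ≡ 1#
  opposite-first u v rewrite ≡ᵇ-refl u = refl

  opposite-second : ∀ {u v} → u ≢ v → opposite u v v ≡ - 1#
  opposite-second {u} {v} p rewrite ≢⇒≡ᵇ v u (p ∘ sym) | ≡ᵇ-refl v = refl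

  opposite-other : ∀ {u v j} → j ≢ u → j ≢ v → opposite u v j ≡ 0#
  opposite-other {u} {v} {j} p q rewrite ≢⇒≡ᵇ j u p | ≢⇒≡ᵇ j v q = refl

  opposite-cancel : ∀ {u v x y} → u ≢ v → x ≈ y → opposite u v u *ᶠ x +ᶠ opposite u v v *ᶠ y ≈ 0#
  opposite-cancel {u} {v} {x} {y} p e =
    FF.+-cong (FF.*-congʳ (≡⇒≈ (opposite-first u v)) ⟶ FF.*-identityˡ x)
              (FF.*-congʳ (≡⇒≈ (opposite-second p)) ⟶ FR.-1*x≈-x y ⟶ FF.-‿cong (FF.sym e))
    ⟶ FF.-‿inverseʳ x

  Σ-head : ∀ n f → Σᶠ (suc n) f ≈ f 0 +ᶠ Σᶠ n (f ∘ suc)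
  Σ-head zero    f = FF.+-comm 0# (f 0)
  Σ-head (suc n) f = FF.+-congʳ (Σ-head n f) ⟶ FF.+-assoc (f 0) _ _

  cancel : ∀ {x y} → ¬ (y ≈ 0#) → x *ᶠ y ≈ 0# → x ≈ 0#
  cancel {x} {y} y≉0 e with FF.inverse y y≉0
  ... | y⁻¹ , i = FF.sym (FF.*-identityʳ x) ⟶ FF.*-congˡ (FF.sym i) ⟶ FF.sym (FF.*-assoc x y y⁻¹) ⟶ FF.*-congʳ e ⟶ FF.zeroˡ y⁻¹

module Representations {c ℓ} (F : FiniteField c ℓ) (n : ℕ) (E : ℕ → ℕ → Bool) where
  open LinearSums F public

  Mat : Set c
  Mat = ℕ → ℕ → Carrier

  term : (ℕ → Bool) → (ℕ → Carrier) → Mat → ℕ → ℕ → Carrier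
  term X z A i j = if X j then z j *ᶠ A i j else 0#

  combination : (ℕ → Bool) → (ℕ → Carrier) → Mat → ℕ → Carrier
  combination X z A i = Σᶠ n (term X z A i)

  Free : Mat → (ℕ → Bool) → (ℕ → Bool) → Set _
  Free A U X = ∀ z → (∀ i → i < n → U i ≡ true → combination X z A i ≈ 0#) → ∀ j → j < n → X j ≡ true → z j ≈ 0#

  Represented : Mat → (ℕ → Bool) → Set ℓ
  Represented A U =
    (∀ i → i < n → U i ≡ true → ¬ (A i i ≈ 0#)) ×
    (∀ i j → i < n → j < n → U i ≡ true → U j ≡ true → i ≢ j → E i j ≡ false → A i j ≈ 0#)

  -- Some matrix representing the graph on U has rank at most |U| - k. The rank is bounded through
  -- all independent sets of columns, so it need not be computed.
  LowRank : (ℕ → Bool) → ℕ → Set _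
  LowRank U k = ∃[ A ] Represented A U × (∀ X → Sub n X U → Free A U X → count n X + k ≤ count n U)

  -- The block-diagonal matrix with an all-ones block on B, of rank one, and A elsewhere. It
  -- represents the enlarged graph when B is a clique: a new vertex for `grow`, an edge for `pair`.
  block : (ℕ → Bool) → Mat → Mat
  block B A i j = if B i ∧ B j then 1# else (if B i ∨ B j then 0# else A i j)

  block-in : ∀ B A {i j} → B i ≡ true → B j ≡ true → block B A i j ≡ 1#
  block-in B A p q rewrite p | q = refl

  block-left : ∀ B A {i j} → B i ≡ true → B j ≡ false → block B A i j ≡ 0#
  block-left B A p q rewrite p | q = refl

  block-right : ∀ B A {i j} → B i ≡ false → B j ≡ true → block B A i j ≡ 0#
  block-right B A p q rewrite p | q = refl

  block-out : ∀ B A {i j} → B i ≡ false → B j ≡ false → block B A i j ≡ A i j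
  block-out B A p q rewrite p | q = refl

  term-out : ∀ {X} z A i {j} → X j ≡ false → term X z A i j ≡ 0#
  term-out z A i p rewrite p = refl

  term-in : ∀ {X} z A i {j} → X j ≡ true → term X z A i j ≡ z j *ᶠ A i j
  term-in z A i p rewrite p = refl

  term-vector : ∀ {X z A i j} → z j ≈ 0# → term X z A i j ≈ 0#
  term-vector {X} {z} {A} {i} {j} e with X j
  ... | true  = FF.*-congʳ e ⟶ FF.zeroˡ (A i j)
  ... | false = FF.refl

  term-matrix : ∀ {X z A i j} → A i j ≈ 0# → term X z A i j ≈ 0#
  term-matrix {X} {z} {A} {i} {j} e with X j
  ... | true  = FF.*-congˡ e ⟶ FF.zeroʳ (z j)
  ... | false = FF.refl

  -- A relation between columns of A, extended by zero on B, is a relation between columns of the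
  -- block matrix.
  block-free : ∀ {A U Z B X} → (∀ i → i < n → Z i ≡ true → B i ≡ false → U i ≡ true) →
    Free (block B A) Z X → Free A U (λ j → X j ∧ not (B j))
  block-free {A} {U} {Z} {B} {X} split free z eqs j j<n p =
    subst (_≈ 0#) (old (not-elim (∧-right {X j} p))) (free z′ rows j j<n (∧-left p))
    where
      M = block B A

      z′ : ℕ → Carrier
      z′ j = if B j then 0# else z j

      new : ∀ {j} → B j ≡ true → z′ j ≡ 0#
      new p rewrite p = refl

      old : ∀ {j} → B j ≡ false → z′ j ≡ z j
      old p rewrite p = refl

      rows : ∀ i → i < n → Z i ≡ true → combination X z′ (block B A) i ≈ 0#
      rows i i<n m with b-dec (B i)
      ... | inj₁ b = Σ-zero n zeros
        where
          zeros : ∀ j → j < n → term X z′ (block B A) i j ≈ 0#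
          zeros j _ with b-dec (B j)
          ... | inj₁ b′ = term-vector {X} {z′} {M} {i} {j} (≡⇒≈ (new b′))
          ... | inj₂ b′ = term-matrix {X} {z′} {M} {i} {j} (≡⇒≈ (block-left B A b b′))
      ... | inj₂ b = Σ-cong n same ⟶ eqs i i<n (split i i<n m b)
        where
          X′ : ℕ → Bool
          X′ j = X j ∧ not (B j)
          same : ∀ j → j < n → term X z′ (block B A) i j ≈ term X′ z A i j
          same j _ with b-dec (X j) | b-dec (B j)
          ... | inj₂ x | _ = ≡⇒≈ (trans (term-out {X} z′ M i x) (sym (term-out {X′} z A i (cong (_∧ not (B j)) x))))
          ... | inj₁ x | inj₁ b′ = term-vector {X} {z′} {M} {i} {j} (≡⇒≈ (new b′)) ⟶
                ≡⇒≈ (sym (term-out {X′} z A i (≢true λ p → absurd b′ (not-elim (∧-right {X j} p)))))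
          ... | inj₁ x | inj₂ b′ = ≡⇒≈ (trans (term-in {X} z′ M i x)
                (trans (cong₂ _*ᶠ_ (old b′) (block-out B A b b′)) (sym (term-in {X′} z A i (∧-intro x (not-intro b′))))))

  block-represented : ∀ {A U Z B} → (∀ i → i < n → Z i ≡ true → B i ≡ false → U i ≡ true) →
    (∀ i j → B i ≡ true → B j ≡ true → i ≢ j → E i j ≡ true) →
    Represented A U → Represented (block B A) Z
  block-represented {A} {U} {Z} {B} split clique (diag , off) = diag′ , off′
    where
      diag′ : ∀ i → i < n → Z i ≡ true → ¬ (block B A i i ≈ 0#)
      diag′ i i<n m with b-dec (B i)
      ... | inj₁ b = λ e → FF.0≉1 (FF.sym (subst (_≈ 0#) (block-in B A b b) e))
      ... | inj₂ b = λ e → diag i i<n (split i i<n m b) (subst (_≈ 0#) (block-out B A b b) e)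
      off′ : ∀ i j → i < n → j < n → Z i ≡ true → Z j ≡ true → i ≢ j → E i j ≡ false → block B A i j ≈ 0#
      off′ i j i<n j<n p q i≢j e with b-dec (B i) | b-dec (B j)
      ... | inj₁ b | inj₁ b′ = absurd (clique i j b b′ i≢j) e
      ... | inj₁ b | inj₂ b′ = ≡⇒≈ (block-left B A b b′)
      ... | inj₂ b | inj₁ b′ = ≡⇒≈ (block-right B A b b′)
      ... | inj₂ b | inj₂ b′ = ≡⇒≈ (block-out B A b b′) ⟶ off i j i<n j<n (split i i<n p b) (split j j<n q b′) i≢j e

  -- B consists of d + 1 new vertices but contributes at most one independent column, so the gap
  -- between size and rank grows by d.
  block-lowRank : ∀ {U Z B k} d → (∀ i → i < n → Z i ≡ true → B i ≡ false → U i ≡ true) →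
    (∀ i j → B i ≡ true → B j ≡ true → i ≢ j → E i j ≡ true) →
    count n Z ≡ suc (d + count n U) →
    (∀ A (X : ℕ → Bool) → Free (block B A) Z X → Sub n X Z → count n (λ j → X j ∧ B j) ≤ 1) →
    LowRank U k → LowRank Z (d + k)
  block-lowRank {U} {Z} {B} {k} d split clique size single (A , rep , low) =
    block B A , block-represented split clique rep , λ X s free → begin
      count n X + (d + k) ≤⟨ +-monoˡ-≤ (d + k) (count-⊆∪ n {λ j → X j ∧ not (B j)} {λ j → X j ∧ B j} (partition X)) ⟩
      (count n (λ j → X j ∧ not (B j)) + count n (λ j → X j ∧ B j)) + (d + k)
        ≤⟨ +-monoˡ-≤ (d + k) (+-monoʳ-≤ (count n (λ j → X j ∧ not (B j))) (single A X free s)) ⟩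
      (count n (λ j → X j ∧ not (B j)) + 1) + (d + k) ≡⟨ shuffle (count n (λ j → X j ∧ not (B j))) d k ⟩
      suc (d + (count n (λ j → X j ∧ not (B j)) + k))
        ≤⟨ s≤s (+-monoʳ-≤ d (low _ (λ j j<n p → split j j<n (s j j<n (∧-left p)) (not-elim (∧-right {X j} p))) (block-free split free))) ⟩
      suc (d + count n U) ≡⟨ size ⟨
      count n Z ∎
    where
      open ≤-Reasoning
      shuffle : ∀ x d k → (x + 1) + (d + k) ≡ suc (d + (x + k))
      shuffle = solve-∀
      partition : ∀ (X : ℕ → Bool) i → i < n → X i ≡ true → (X i ∧ not (B i)) ∨ (X i ∧ B i) ≡ true
      partition X i _ x rewrite x with B i
      ... | true  = refl
      ... | false = refl

  module _ (E-sym : ∀ u v → u < n → v < n → E u v ≡ E v u) where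

    lowRank-saving : Saving n E LowRank
    lowRank-saving = record
      { ext = λ {U} {Z} {k} → ext {U} {Z} {k} ; empty = empty ; lower = λ {U} {k} → lower {U} {k}
      ; grow = λ {U} {v} {k} → grow {U} {v} {k} ; pair = λ {U} {u} {v} {k} → pair {U} {u} {v} {k}
      ; cut = λ {U} {v} {k} → cut {U} {v} {k} ; lone = λ {U} {v} {k} → lone {U} {v} {k} }
      where
        ext : ∀ {U Z k} → (∀ i → i < n → U i ≡ Z i) → LowRank U k → LowRank Z k
        ext {U} {Z} {k} f (A , (diag , off) , low) = A ,
          ((λ i i<n p → diag i i<n (trans (f i i<n) p)) ,
           (λ i j i<n j<n p q → off i j i<n j<n (trans (f i i<n) p) (trans (f j j<n) q))) ,
          λ X s free → subst (count n X + k ≤_) (count-cong n f)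
            (low X (λ i i<n p → trans (f i i<n) (s i i<n p)) λ z eqs → free z λ i i<n p → eqs i i<n (trans (f i i<n) p))

        empty : LowRank (λ _ → false) 0
        empty = (λ _ _ → 1#) , ((λ _ _ ()) , λ _ _ _ _ ()) ,
          λ X s _ → ≤-trans (≤-reflexive (+-identityʳ (count n X))) (count-mono n s)

        lower : ∀ {U k} → LowRank U (suc k) → LowRank U k
        lower {U} {k} (A , rep , low) = A , rep , λ X s free → ≤-trans (+-monoʳ-≤ (count n X) (n≤1+n k)) (low X s free)

        grow : ∀ {U v k} → v < n → U v ≡ false → LowRank U k → LowRank (ins U v) k
        grow {U} {v} {k} v<n v∉U = block-lowRank {U} {ins U v} {_≡ᵇ v} {k} 0
          (λ i i<n p b → case ins-elim U p of λ where (inj₁ q) → q ; (inj₂ refl) → absurd (≡ᵇ-refl v) b)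
          (λ i j p q i≢j → ⊥-elim (i≢j (trans (≡ᵇ-sound {i} {v} p) (sym (≡ᵇ-sound {j} {v} q)))))
          (count-ins n v<n v∉U)
          (λ A X _ _ → ≤-trans (count-mono n λ i _ → ∧-right {X i}) (≤-reflexive (count-single n v v<n)))

        pair : ∀ {U u v k} → u < n → v < n → U u ≡ false → ins U u v ≡ false → E u v ≡ true →
          LowRank U k → LowRank (ins (ins U u) v) (suc k)
        pair {U} {u} {v} {k} u<n v<n u∉ v∉ e = block-lowRank {U} {Z} {B} {k} 1 split clique
          (trans (count-ins n v<n v∉) (cong suc (count-ins n u<n u∉))) single
          where
            Z B : ℕ → Bool
            Z = ins (ins U u) v
            B i = (i ≡ᵇ u) ∨ (i ≡ᵇ v)

            B-elim : ∀ {i} → B i ≡ true → i ≡ u ⊎ i ≡ v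
            B-elim {i} p with ∨-elim {i ≡ᵇ u} p
            ... | inj₁ q = inj₁ (≡ᵇ-sound {i} q)
            ... | inj₂ q = inj₂ (≡ᵇ-sound {i} q)

            Bu : B u ≡ true
            Bu = ∨-left (≡ᵇ-refl u)

            Bv : B v ≡ true
            Bv = ∨-right {v ≡ᵇ u} (≡ᵇ-refl v)

            u≢v : u ≢ v
            u≢v refl = absurd (ins-self U u) v∉

            split : ∀ i → i < n → Z i ≡ true → B i ≡ false → U i ≡ true
            split i i<n p b with ins-elim (ins U u) p
            ... | inj₂ refl = absurd Bv b
            ... | inj₁ q with ins-elim U q
            ...   | inj₂ refl = absurd Bu b
            ...   | inj₁ r = r

            clique : ∀ i j → B i ≡ true → B j ≡ true → i ≢ j → E i j ≡ true
            clique i j p q i≢j with B-elim {i} p | B-elim {j} q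
            ... | inj₁ refl | inj₁ refl = ⊥-elim (i≢j refl)
            ... | inj₁ refl | inj₂ refl = e
            ... | inj₂ refl | inj₁ refl = trans (E-sym v u v<n u<n) e
            ... | inj₂ refl | inj₂ refl = ⊥-elim (i≢j refl)

            -- The columns of u and v agree, so e_u - e_v is a nontrivial relation between them.
            not-both : ∀ A X → Free (block B A) Z X → X u ≡ true → X v ≡ true → ⊥
            not-both A X free xu xv = FF.0≉1 (FF.sym (subst (_≈ 0#) (opposite-first u v) (free (opposite u v) rows u u<n xu)))
              where
                M = block B A
                column : ∀ i → M i u ≡ M i v
                column i with b-dec (B i)
                ... | inj₁ b = trans (block-in B A {i} {u} b Bu) (sym (block-in B A {i} {v} b Bv))
                ... | inj₂ b = trans (block-right B A {i} {u} b Bu) (sym (block-right B A {i} {v} b Bv))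
                rows : ∀ i → i < n → Z i ≡ true → combination X (opposite u v) M i ≈ 0#
                rows i _ _ = Σ-pair n u<n v<n u≢v
                    (λ j _ p q → term-vector {X} {opposite u v} {M} {i} {j} (≡⇒≈ (opposite-other p q)))
                  ⟶ ≡⇒≈ (cong₂ _+ᶠ_ (term-in {X} (opposite u v) M i xu) (term-in {X} (opposite u v) M i xv))
                  ⟶ opposite-cancel u≢v (≡⇒≈ (column i))

            single : ∀ A X → Free (block B A) Z X → Sub n X Z → count n (λ j → X j ∧ B j) ≤ 1
            single A X free _ with b-dec (X u)
            ... | inj₂ xu = ≤-trans (count-mono n {λ j → X j ∧ B j} {_≡ᵇ v} only) (≤-reflexive (count-single n v v<n))
              where
                only : ∀ i → i < n → X i ∧ B i ≡ true → (i ≡ᵇ v) ≡ true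
                only i _ p with B-elim {i} (∧-right {X i} p)
                ... | inj₁ refl = absurd (∧-left p) xu
                ... | inj₂ refl = ≡ᵇ-refl v
            ... | inj₁ xu = ≤-trans (count-mono n {λ j → X j ∧ B j} {_≡ᵇ u} only) (≤-reflexive (count-single n u u<n))
              where
                only : ∀ i → i < n → X i ∧ B i ≡ true → (i ≡ᵇ u) ≡ true
                only i _ p with B-elim {i} (∧-right {X i} p)
                ... | inj₁ refl = ≡ᵇ-refl u
                ... | inj₂ refl = ⊥-elim (not-both A X free xu (∧-left p))

        -- The matrix is restricted. Columns that are independent on fewer rows are independent on
        -- all rows, so the rank does not rise while the size drops by one.
        cut : ∀ {U v k} → v < n → U v ≡ true → LowRank U (suc k) → LowRank (del U v) k
        cut {U} {v} {k} v<n v∈U (A , (diag , off) , low) = A ,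
          ((λ i i<n p → diag i i<n (del⊆ U p)) , (λ i j i<n j<n p q → off i j i<n j<n (del⊆ U p) (del⊆ U q))) ,
          λ X s free → ≤-pred (≤-trans (≤-reflexive (sym (+-suc (count n X) k)))
            (≤-trans (low X (λ i i<n p → del⊆ U (s i i<n p)) λ z eqs → free z λ i i<n p → eqs i i<n (del⊆ U p))
              (≤-reflexive (count-del n v<n v∈U))))

        -- Row and column v vanish off the diagonal. Hence v can be added to any free set of the
        -- smaller matrix: on the other rows its column contributes nothing, and row v of a relation
        -- reads `z v * A v v = 0`. So deleting v lowers the rank as well.
        lone : ∀ {U v k} → v < n → U v ≡ true → (∀ u → u < n → U u ≡ true → E v u ≡ false) →
          LowRank U k → LowRank (del U v) k
        lone {U} {v} {k} v<n v∈U iso (A , (diag , off) , low) = A ,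
          ((λ i i<n p → diag i i<n (del⊆ U p)) , (λ i j i<n j<n p q → off i j i<n j<n (del⊆ U p) (del⊆ U q))) ,
          λ X s free → ≤-pred (≤-trans (≤-reflexive (cong (_+ k) (sym (count-ins n v<n (v∉ s)))))
            (≤-trans (low (ins X v) (sub s) (extend-free s free)) (≤-reflexive (count-del n v<n v∈U))))
          where
            v∉ : ∀ {X} → Sub n X (del U v) → X v ≡ false
            v∉ s = ≢true λ x → del-≢ U (s v v<n x) refl

            sub : ∀ {X} → Sub n X (del U v) → Sub n (ins X v) U
            sub {X} s i i<n p with ins-elim X p
            ... | inj₁ q = del⊆ U (s i i<n q)
            ... | inj₂ refl = v∈U

            extend-free : ∀ {X} → Sub n X (del U v) → Free A (del U v) X → Free A U (ins X v)
            extend-free {X} s free z eqs j j<n p with ins-elim X p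
            ... | inj₁ q = free z rows j j<n q
              where
                rows : ∀ i → i < n → del U v i ≡ true → combination X z A i ≈ 0#
                rows i i<n m = Σ-cong n same ⟶ eqs i i<n (del⊆ U m)
                  where
                    aiv : A i v ≈ 0#
                    aiv = off i v i<n v<n (del⊆ U m) v∈U (del-≢ U m) (trans (E-sym i v i<n v<n) (iso i i<n (del⊆ U m)))
                    same : ∀ j → j < n → term X z A i j ≈ term (ins X v) z A i j
                    same j _ with j ≟ v
                    ... | yes refl = term-matrix {X} {z} {A} {i} {j} aiv ⟶ FF.sym (term-matrix {ins X j} {z} {A} {i} {j} aiv)
                    ... | no j≢v = ≡⇒≈ (cong (λ b → if b then z j *ᶠ A i j else 0#) (sym (ins-other X j≢v)))
            ... | inj₂ refl = cancel (diag j j<n v∈U) (≡⇒≈ (sym (term-in {ins X j} z A j (ins-self X j)))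
                ⟶ FF.sym (Σ-single n j<n zeros) ⟶ eqs j j<n v∈U)
              where
                zeros : ∀ i → i < n → i ≢ j → term (ins X j) z A j i ≈ 0#
                zeros i i<n i≢j with b-dec (X i)
                ... | inj₂ x = ≡⇒≈ (term-out {ins X j} z A j (trans (ins-other X i≢j) x))
                ... | inj₁ x = term-matrix {ins X j} {z} {A} {j} {i}
                      (off j i j<n i<n v∈U (del⊆ U (s i i<n x)) (i≢j ∘ sym) (iso i i<n (del⊆ U (s i i<n x))))

-- Field elements as digits to base `suc b`, the order of the field, so that vectors and matrices
-- become numbers as words do.
record Coding {c ℓ} (F : FiniteField c ℓ) : Set (c Level.⊔ ℓ) where
  open FiniteField F using (Carrier; _≈_; order)
  field
    b        : ℕ
    order≡   : order ≡ suc b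
    enc      : Carrier → ℕ
    dec      : ℕ → Carrier
    enc<     : ∀ x → enc x < suc b
    enc-cong : ∀ {x y} → x ≈ y → enc x ≡ enc y
    dec-enc  : ∀ x → dec (enc x) ≈ x
    enc-dec  : ∀ a → a < suc b → enc (dec a) ≡ a

coding : ∀ {c ℓ} (F : FiniteField c ℓ) → Coding F
coding F = build (FiniteField.order F) (FiniteField.finite F) refl
  where
    open FiniteField F using (Carrier; 0#; setoidᶠ)
    -- The order is generalized so that it can be matched as a successor. Reduction modulo the order
    -- makes decoding total.
    build : ∀ o → Inverse setoidᶠ (setoid (Fin o)) → FiniteField.order F ≡ o → Coding F
    build zero    I e = ⊥-elim (¬Fin0 (Inverse.to I 0#))
    build (suc b) I e = record
      { b = b ; order≡ = e ; enc = toℕ ∘ Inverse.to I ; dec = dec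
      ; enc< = λ x → toℕ<n (Inverse.to I x)
      ; enc-cong = cong toℕ ∘ Inverse.to-cong I
      ; dec-enc = λ x → FiniteField.trans F (Inverse.from-cong I (toℕ-injective
          (trans (toℕ-fromℕ< _) (m<n⇒m%n≡m (toℕ<n (Inverse.to I x))))))
          (Inverse.strictlyInverseʳ I x)
      ; enc-dec = λ a a< → trans (cong toℕ (Inverse.strictlyInverseˡ I _))
          (trans (toℕ-fromℕ< _) (m<n⇒m%n≡m a<)) }
      where
        dec : ℕ → Carrier
        dec a = Inverse.from I (fromℕ< (m%n<n a (suc b)))

module CodedRank {c ℓ} (F : FiniteField c ℓ) (C : Coding F) (n : ℕ) (E : ℕ → ℕ → Bool) (U : ℕ → Bool) where
  open Representations F n E
  open Coding C

  q w ζ : ℕ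
  q = suc b
  w = count n U
  ζ = enc 0#

  addᶜ mulᶜ : ℕ → ℕ → ℕ
  addᶜ a a′ = enc (dec a +ᶠ dec a′)
  mulᶜ a a′ = enc (dec a *ᶠ dec a′)

  entryᶜ : ℕ → ℕ → ℕ → ℕ
  entryᶜ M i j = digit b (count i U * w + count j U) M

  coeffᶜ : ℕ → ℕ → ℕ
  coeffᶜ z j = digit b (count j U) z

  chosen : ℕ → ℕ → Bool
  chosen X j = U j ∧ bit (count j U) X

  combᶜ : ℕ → ℕ → ℕ → ℕ → ℕ → ℕ
  combᶜ M X z i zero    = ζ
  combᶜ M X z i (suc j) =
    if chosen X j then addᶜ (combᶜ M X z i j) (mulᶜ (coeffᶜ z j) (entryᶜ M i j)) else combᶜ M X z i j

  represents : ℕ → Bool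
  represents M = all n λ i → all n λ j → not (U i ∧ U j) ∨
    (((i ≡ᵇ j) ∧ not (entryᶜ M i j ≡ᵇ ζ)) ∨ (not (i ≡ᵇ j) ∧ (E i j ∨ (entryᶜ M i j ≡ᵇ ζ))))

  -- Independence is tested by trying every coefficient vector instead of eliminating. Vectors range
  -- over all of U; coefficients outside the chosen columns do not enter the combination.
  free : ℕ → ℕ → Bool
  free M X = all (q ^ w) λ z → any n (λ i → U i ∧ not (combᶜ M X z i n ≡ᵇ ζ)) ∨
    all n (λ j → not (chosen X j) ∨ (coeffᶜ z j ≡ᵇ ζ))

  ranked : ℕ → Bool
  ranked k = any (q ^ (w * w)) λ M → represents M ∧
    all (2 ^ w) λ X → not (free M X) ∨ (count n (chosen X) + k ≤ᵇ w)

  decoded : ℕ → Mat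
  decoded M i j = dec (entryᶜ M i j)

  enc-injective : ∀ {x y} → enc x ≡ enc y → x ≈ y
  enc-injective {x} {y} e = FF.sym (dec-enc x) ⟶ ≡⇒≈ (cong dec e) ⟶ dec-enc y

  dec-zero : ∀ {a} → a ≡ ζ → dec a ≈ 0#
  dec-zero refl = dec-enc 0#

  zero-dec : ∀ {a} → a < q → dec a ≈ 0# → a ≡ ζ
  zero-dec {a} a< e = trans (sym (enc-dec a a<)) (enc-cong e)

  combᶜ-sum : ∀ M X z i t → combᶜ M X z i t ≡ enc (Σᶠ t (term (chosen X) (dec ∘ coeffᶜ z) (decoded M) i))
  combᶜ-sum M X z i zero    = refl
  combᶜ-sum M X z i (suc t) with chosen X t
  ... | false = trans (combᶜ-sum M X z i t) (enc-cong (FF.sym (FF.+-identityʳ _)))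
  ... | true  = trans (cong (λ a → addᶜ a (mulᶜ (coeffᶜ z t) (entryᶜ M i t))) (combᶜ-sum M X z i t))
    (enc-cong (FF.+-cong (dec-enc _) (dec-enc _)))

  Free-cong : ∀ {A A′ X X′} → (∀ i j → i < n → j < n → U i ≡ true → X j ≡ true → A i j ≈ A′ i j) →
    (∀ j → j < n → X j ≡ X′ j) → Free A U X → Free A′ U X′
  Free-cong {A} {A′} {X} {X′} f g free z eqs j j<n p = free z
      (λ i i<n u → Σ-cong n (same i i<n u) ⟶ eqs i i<n u) j j<n (trans (g j j<n) p)
    where
      same : ∀ i → i < n → U i ≡ true → ∀ j → j < n → term X z A i j ≈ term X′ z A′ i j
      same i i<n u j j<n with b-dec (X j)
      ... | inj₁ x = ≡⇒≈ (term-in {X} z A i x) ⟶ FF.*-congˡ (f i j i<n j<n u x) ⟶ ≡⇒≈ (sym (term-in {X′} z A′ i (trans (sym (g j j<n)) x)))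
      ... | inj₂ x = ≡⇒≈ (trans (term-out {X} z A i x) (sym (term-out {X′} z A′ i (trans (sym (g j j<n)) x))))

  free-sound : ∀ {M X} → free M X ≡ true → Free (decoded M) U (chosen X)
  free-sound {M} {X} p z eqs j j<n x with ∨-elim {any n (λ i → U i ∧ not (combᶜ M X (code b n U (enc ∘ z)) i n ≡ᵇ ζ))}
      (all-elim (q ^ w) p (code< b n U (enc< ∘ z)))
  ... | inj₁ bad = let i , i<n , r = any-elim n bad in
    ⊥-elim (≡ᵇ-false (combᶜ M X zᶜ i n) ζ (not-elim (∧-right {U i} r)) (trans (combᶜ-sum M X zᶜ i n) (enc-cong (Σ-cong n (same i) ⟶ eqs i i<n (∧-left r)))))
    where
      zᶜ = code b n U (enc ∘ z)
      same : ∀ i j → j < n → term (chosen X) (dec ∘ coeffᶜ zᶜ) (decoded M) i j ≈ term (chosen X) z (decoded M) i j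
      same i j j<n with b-dec (chosen X j)
      ... | inj₁ y = ≡⇒≈ (term-in {chosen X} (dec ∘ coeffᶜ zᶜ) (decoded M) i y)
              ⟶ FF.*-congʳ (≡⇒≈ (cong dec (digit-code b n U (enc< ∘ z) j<n (∧-left y))) ⟶ dec-enc (z j))
              ⟶ ≡⇒≈ (sym (term-in {chosen X} z (decoded M) i y))
      ... | inj₂ y = ≡⇒≈ (trans (term-out {chosen X} (dec ∘ coeffᶜ zᶜ) (decoded M) i y) (sym (term-out {chosen X} z (decoded M) i y)))
  ... | inj₂ good with ∨-elim {not (chosen X j)} (all-elim n good j<n)
  ...   | inj₁ y = absurd x (not-elim y)
  ...   | inj₂ y = enc-injective (trans (sym (digit-code b n U (enc< ∘ z) j<n (∧-left x)))
          (≡ᵇ-sound {coeffᶜ (code b n U (enc ∘ z)) j} {ζ} y))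

  free-complete : ∀ {M X} → Free (decoded M) U (chosen X) → free M X ≡ true
  free-complete {M} {X} F′ = all-intro (q ^ w) λ z _ → test z
    where
      test : ∀ z → any n (λ i → U i ∧ not (combᶜ M X z i n ≡ᵇ ζ)) ∨ all n (λ j → not (chosen X j) ∨ (coeffᶜ z j ≡ᵇ ζ)) ≡ true
      test z with b-dec (any n (λ i → U i ∧ not (combᶜ M X z i n ≡ᵇ ζ)))
      ... | inj₁ p = ∨-left p
      ... | inj₂ p = ∨-right {any n (λ i → U i ∧ not (combᶜ M X z i n ≡ᵇ ζ))} (all-intro n vanishing)
        where
          rows : ∀ i → i < n → U i ≡ true → combination (chosen X) (dec ∘ coeffᶜ z) (decoded M) i ≈ 0#
          rows i i<n u = enc-injective (trans (sym (combᶜ-sum M X z i n)) (≡ᵇ-sound {combᶜ M X z i n} {ζ}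
            (not-false (trans (cong (_∧ not (combᶜ M X z i n ≡ᵇ ζ)) (sym u)) (any-false n p i<n)))))
          vanishing : ∀ j → j < n → not (chosen X j) ∨ (coeffᶜ z j ≡ᵇ ζ) ≡ true
          vanishing j j<n with b-dec (chosen X j)
          ... | inj₂ x = ∨-left (not-intro x)
          ... | inj₁ x = ∨-right {not (chosen X j)} (≡ᵇ-complete (zero-dec (digit<base b (count j U) z)
                (F′ (dec ∘ coeffᶜ z) rows j j<n x)))

  represents-sound : ∀ {M} → represents M ≡ true → Represented (decoded M) U
  represents-sound {M} p = diag , off
    where
      at : ∀ i j → i < n → j < n → U i ≡ true → U j ≡ true →
        ((i ≡ᵇ j) ∧ not (entryᶜ M i j ≡ᵇ ζ)) ∨ (not (i ≡ᵇ j) ∧ (E i j ∨ (entryᶜ M i j ≡ᵇ ζ))) ≡ true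
      at i j i<n j<n u v with ∨-elim {not (U i ∧ U j)} (all-elim n (all-elim n p i<n) j<n)
      ... | inj₁ f = absurd (∧-intro u v) (not-elim f)
      ... | inj₂ r = r
      diag : ∀ i → i < n → U i ≡ true → ¬ (decoded M i i ≈ 0#)
      diag i i<n u e with ∨-elim {(i ≡ᵇ i) ∧ not (entryᶜ M i i ≡ᵇ ζ)} (at i i i<n i<n u u)
      ... | inj₁ r = ≡ᵇ-false (entryᶜ M i i) ζ (not-elim (∧-right {i ≡ᵇ i} r)) (zero-dec (digit<base b (count i U * w + count i U) M) e)
      ... | inj₂ r = absurd (≡ᵇ-refl i) (not-elim (∧-left r))
      off : ∀ i j → i < n → j < n → U i ≡ true → U j ≡ true → i ≢ j → E i j ≡ false → decoded M i j ≈ 0#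
      off i j i<n j<n u v i≢j e with ∨-elim {(i ≡ᵇ j) ∧ not (entryᶜ M i j ≡ᵇ ζ)} (at i j i<n j<n u v)
      ... | inj₁ r = ⊥-elim (i≢j (≡ᵇ-sound {i} {j} (∧-left r)))
      ... | inj₂ r with ∨-elim {E i j} (∧-right {not (i ≡ᵇ j)} r)
      ...   | inj₁ e′ = absurd e′ e
      ...   | inj₂ z = dec-zero (≡ᵇ-sound {entryᶜ M i j} {ζ} z)

  represents-complete : ∀ {M} → Represented (decoded M) U → represents M ≡ true
  represents-complete {M} (diag , off) = all-intro n λ i i<n → all-intro n λ j j<n → at i j i<n j<n
    where
      at : ∀ i j → i < n → j < n → not (U i ∧ U j) ∨
        (((i ≡ᵇ j) ∧ not (entryᶜ M i j ≡ᵇ ζ)) ∨ (not (i ≡ᵇ j) ∧ (E i j ∨ (entryᶜ M i j ≡ᵇ ζ)))) ≡ true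
      at i j i<n j<n with b-dec (U i ∧ U j) | i ≟ j | b-dec (E i j)
      ... | inj₂ f | _ | _ = ∨-left (not-intro f)
      ... | inj₁ u | yes refl | _ = ∨-right {not (U i ∧ U i)} (∨-left (∧-intro (≡ᵇ-refl i)
            (not-intro (≢⇒≡ᵇ _ ζ λ e → diag i i<n (∧-left u) (dec-zero e)))))
      ... | inj₁ u | no i≢j | inj₁ e = ∨-right {not (U i ∧ U j)} (∨-right {(i ≡ᵇ j) ∧ not (entryᶜ M i j ≡ᵇ ζ)}
            (∧-intro (not-intro (≢⇒≡ᵇ i j i≢j)) (∨-left e)))
      ... | inj₁ u | no i≢j | inj₂ e = ∨-right {not (U i ∧ U j)} (∨-right {(i ≡ᵇ j) ∧ not (entryᶜ M i j ≡ᵇ ζ)}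
            (∧-intro (not-intro (≢⇒≡ᵇ i j i≢j)) (∨-right {E i j} (≡ᵇ-complete (zero-dec (digit<base b (count i U * w + count j U) M)
              (off i j i<n j<n (∧-left u) (∧-right {U i} u) i≢j e))))))

  -- An arbitrary set of columns is replaced by its code on U. Kept separate from `ranked-sound`
  -- because the exact rank of one particular matrix M is needed later.
  ranked-low : ∀ {M k} → all (2 ^ w) (λ X → not (free M X) ∨ (count n (chosen X) + k ≤ᵇ w)) ≡ true →
    ∀ X → Sub n X U → Free (decoded M) U X → count n X + k ≤ w
  ranked-low {M} {k} r X s F′ with ∨-elim {not (free M Xᶜ)} (all-elim (2 ^ w) r (code< 1 n U (λ v → s≤s (𝟙≤1 (X v)))))
    where Xᶜ = code 1 n U (𝟙 ∘ X)
  ... | inj₁ f = absurd (free-complete {M} {code 1 n U (𝟙 ∘ X)} (Free-cong {decoded M} {decoded M} {X} (λ _ _ _ _ _ _ → FF.refl) same F′)) (not-elim f)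
    where
      same : ∀ j → j < n → X j ≡ chosen (code 1 n U (𝟙 ∘ X)) j
      same j j<n with b-dec (U j)
      ... | inj₁ u = sym (trans (cong (_∧ bit (count j U) (code 1 n U (𝟙 ∘ X))) u)
              (trans (cong (_≡ᵇ 1) (digit-code 1 n U (λ v → s≤s (𝟙≤1 (X v))) j<n u)) (𝟙-≡ᵇ1 (X j))))
      ... | inj₂ u = trans (≢true λ x → absurd (s j j<n x) u) (sym (cong (_∧ bit (count j U) (code 1 n U (𝟙 ∘ X))) u))
  ... | inj₂ le = subst (λ c → c + k ≤ w) (count-cong n same) (≤ᵇ-sound le)
    where
      same : ∀ j → j < n → chosen (code 1 n U (𝟙 ∘ X)) j ≡ X j
      same j j<n with b-dec (U j)
      ... | inj₁ u = trans (cong (_∧ bit (count j U) (code 1 n U (𝟙 ∘ X))) u)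
              (trans (cong (_≡ᵇ 1) (digit-code 1 n U (λ v → s≤s (𝟙≤1 (X v))) j<n u)) (𝟙-≡ᵇ1 (X j)))
      ... | inj₂ u = trans (cong (_∧ bit (count j U) (code 1 n U (𝟙 ∘ X))) u) (sym (≢true λ x → absurd (s j j<n x) u))

  ranked-sound : ∀ {k} → ranked k ≡ true → LowRank U k
  ranked-sound {k} p = let M , _ , r = any-elim (q ^ (w * w)) p in
    decoded M , represents-sound {M} (∧-left r) , ranked-low {M} {k} (∧-right {represents M} r)

  encodeMat : Mat → ℕ
  encodeMat A = encode b (w * w) λ p → enc (A (select n U (row w p)) (select n U (col w p)))

  decoded-encode : ∀ A i j → i < n → j < n → U i ≡ true → U j ≡ true → decoded (encodeMat A) i j ≈ A i j
  decoded-encode A i j i<n j<n u v =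
    let lt , r , s = position w (count i U) (count j U) (rank-< U u i<n) (rank-< U v j<n)
    in ≡⇒≈ (cong dec (trans (digit-encode b (w * w) (λ p → enc (A (select n U (row w p)) (select n U (col w p)))) (λ _ _ → enc< _) _ lt)
         (cong₂ (λ x y → enc (A x y)) (trans (cong (select n U) r) (select-rank n U i<n u)) (trans (cong (select n U) s) (select-rank n U j<n v)))))
       ⟶ dec-enc (A i j)

  ranked-complete : ∀ {k} → LowRank U k → ranked k ≡ true
  ranked-complete {k} (A , (diag , off) , low) = any-intro (q ^ (w * w)) (encode< b (w * w) _ λ _ _ → enc< _)
    (∧-intro (represents-complete {M} ((λ i i<n u e → diag i i<n u (FF.sym (decoded-encode A i i i<n i<n u u) ⟶ e)) ,
        λ i j i<n j<n u v i≢j e → decoded-encode A i j i<n j<n u v ⟶ off i j i<n j<n u v i≢j e))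
      (all-intro (2 ^ w) λ X _ → test X))
    where
      M = encodeMat A
      test : ∀ X → not (free M X) ∨ (count n (chosen X) + k ≤ᵇ w) ≡ true
      test X with b-dec (free M X)
      ... | inj₂ f = ∨-left (not-intro f)
      ... | inj₁ f = ∨-right {not (free M X)} (≤ᵇ-complete (low (chosen X) (λ _ _ → ∧-left)
            (Free-cong {decoded M} {A} {chosen X} {chosen X} (λ i j i<n j<n u x → decoded-encode A i j i<n j<n u (∧-left x)) (λ _ _ → refl) (free-sound {M} {X} f))))

-- Brute-force search on a core

letterT : ℕ → Term → Term → Term → Term
letterT b W v x = letT (rankT W v) λ r → digitT b r x

clashT : ℕ → Term → Term → Term → Term
clashT b W x y = anyT orderT λ v → andT (bitT v W) (letT (letterT b W v x) λ a → letT (letterT b W v y) λ c →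
  andT (notT (eqT a c)) (allT orderT λ u →
    orT (notT (andT (bitT u W) (edgeT v u))) (eqT (letterT b W u x) (letterT b W u y))))

independentT : ℕ → Term → Term → Term → Term
independentT b W N X = allT N λ x → allT N λ y → notT (andT (bitT x X) (andT (bitT y X) (clashT b W x y)))

withUniverseT : ℕ → Term → (Term → Term → Term → Term) → Term
withUniverseT b W f = letT (sizeT W) λ w → letT (powT (const (suc b)) w) λ N → letT (powT (const 2) N) λ t → f w N t

storesT : ℕ → Term → Term → Term
storesT b W k = withUniverseT b W λ w N t → letT (powT (const (suc b)) k) λ m →
  anyT t λ X → andT (independentT b W N X) (leT m (sumT N λ x → bitT x X))

withoutT : Term → Term → Term → Term
withoutT N X Y = maskT N λ x → andT (bitT x X) (notT (bitT x Y))

-- `A` is the table of all sets colourable with the colours so far, one bit for each of the 2 ^ N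
-- masks, packed into a single number; the result is the table for one colour more.
roundT : ℕ → Term → Term → Term → Term → Term
roundT b W N t A = maskT t λ X → anyT t λ Y → andT (independentT b W N Y) (letT (withoutT N X Y) λ Z → bitT Z A)

indexesT : ℕ → Term → Term → Term
indexesT b W k = withUniverseT b W λ w N t →
  letT (opT monus w k) λ d → letT (powT (const (suc b)) d) λ c →
  -- Without colours only the empty set is colourable. Its mask is 0, so the initial table has just
  -- bit 0 set and is the number 1.
  letT (loopT c (const 1) λ _ A → roundT b W N t A) λ A →
  letT (maskT N λ _ → const 1) λ Z → andT (leT k w) (bitT Z A)

mask-zero : ∀ t → 0 < t → mask t (_≡ᵇ 0) ≡ 1
mask-zero (suc t) _ = cong suc (cong (2 *_) (encode-zero 1 t))

module WordProgram (n k : ℕ) (G : Graph n) (R X L : ℕ) (64≤R : 64 ≤ R) (1≤X : 1 ≤ X) (1≤L : 1 ≤ L)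
  (n²≤R : n * n ≤ R) (R<2^L : R < 2 ^ L) (n<L : n < L) (2k<2^L : k + k < 2 ^ L) (b : ℕ) (q≤R : suc b ≤ R) where

  open KernelProgram n k G R X L 64≤R 1≤X 1≤L n²≤R R<2^L n<L 2k<2^L public

  private
    n≤ : n ≤ R * X ^ 0
    n≤ = ≤R n≤R

    q-J : ∀ {w} → J w (const (suc b)) (suc b) 1 0
    q-J = const-J (suc b) (≤R⇒< q≤R)

  letter-J : ∀ {w W vT xT U v x} → Bits w W U → J w vT v 1 0 → J w xT x 1 0 → v < n →
    J w (letterT b W vT xT) (digit b (count v U) x) 9 0
  letter-J {U = U} {v} jW jv jx v<n = let-J (rank-J {U = U} jW jv (<⇒≤ v<n)) λ p jr →
    digit-J b 0 q≤R jr (up p jx) (≤R (≤-trans (count≤n v U) (≤-trans (<⇒≤ v<n) n≤R)))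

  open Colourings b n (edge G)

  clash-J : ∀ {w W xT yT U x y} → Bits w W U → J w xT x 1 0 → J w yT y 1 0 →
    J w (clashT b W xT yT) (𝟙 (clash U (letter U x) (letter U y))) 45 0
  clash-J {U = U} {x} {y} jW jx jy = weakenᵇ (any-J 0 orderJ n≤ λ v v<n p jv →
    and-J (member-J {U = U} jv (up p jW) v<n)
      (let-J (letter-J {U = U} (up p jW) jv (up p jx) v<n) λ p₁ ja →
       let-J (letter-J {U = U} (up (p ∙ p₁) jW) (up p₁ jv) (up (p ∙ p₁) jy) v<n) λ p₂ jc →
       and-J (not-J (eq-J (up p₂ ja) jc)) (all-J 0 orderJ n≤ λ u u<n p₃ ju →
         or-J (not-J (and-J (member-J {U = U} ju (up (p ∙ p₁ ∙ p₂ ∙ p₃) jW) u<n) (edge-J (up (p₁ ∙ p₂ ∙ p₃) jv) ju v<n u<n)))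
           (eq-J (letter-J {U = U} (up (p ∙ p₁ ∙ p₂ ∙ p₃) jW) ju (up (p ∙ p₁ ∙ p₂ ∙ p₃) jx) u<n)
                 (letter-J {U = U} (up (p ∙ p₁ ∙ p₂ ∙ p₃) jW) ju (up (p ∙ p₁ ∙ p₂ ∙ p₃) jy) u<n)))))

  module _ (U : ℕ → Bool) (N≤R : suc b ^ count n U ≤ R) (N<L : suc b ^ count n U < L)
    (2^N≤ : 2 ^ (suc b ^ count n U) ≤ R * X ^ 1) where
    open Table U

    private
      N≤ : universe ≤ R * X ^ 0
      N≤ = ≤R N≤R

      w≤R : count n U ≤ R
      w≤R = ≤-trans (count≤n n U) n≤R

    independent-J : ∀ {w W NT YT Y} → Bits w W U → J w NT universe 1 0 → J w YT Y 1 0 →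
      J w (independentT b W NT YT) (𝟙 (independent Y)) 70 0
    independent-J {Y = Y} jW jN jY = weakenᵇ (all-J 0 jN N≤ λ x x< p jx → all-J 0 (up p jN) N≤ λ y y< p₁ jy →
      not-J (and-J (bit-J 0 (up p₁ jx) (up (p ∙ p₁) jY) (≤R (≤-trans (<⇒≤ x<) N≤R)))
        (and-J (bit-J 0 jy (up (p ∙ p₁) jY) (≤R (≤-trans (<⇒≤ y<) N≤R)))
          (clash-J {U = U} (up (p ∙ p₁) jW) (up p₁ jx) jy))))

    withUniverse-J : ∀ {w W f v δ ε} → Bits w W U →
      (∀ {w′ c NT tT} → w ⊑ w′ → J w′ c (count n U) 1 0 → J w′ NT universe 1 0 → J w′ tT (2 ^ universe) 1 0 →
        J w′ (f c NT tT) v (8 + δ) ε) →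
      J w (withUniverseT b W f) v (11 + δ) ε
    withUniverse-J jW body =
      let-J (size-J {U = U} jW) λ p₁ jc →
      let-J (pow-J 0 q-J jc (≤R w≤R) (≤R⇒< N≤R)) λ p₂ jN →
      let-J (pow-J 0 (const≤64 2) jN N≤ (^-monoʳ-< 2 ≤-refl N<L)) λ p₃ jt →
      body (p₁ ∙ p₂ ∙ p₃) (up (p₂ ∙ p₃) jc) (up p₃ jN) jt

    -- The loop over sets of words is the only exponential one and costs exactly one factor `X`. The
    -- 1.1996 bound leaves no room for a second.
    stores-J : ∀ {w W kT m} → Bits w W U → J w kT m 1 0 → m ≤ R → suc b ^ m < 2 ^ L →
      J w (storesT b W kT) (𝟙 (stores (suc b ^ m))) 100 1
    stores-J {m = m} jW jk m≤R qm< = weakenᵇ (withUniverse-J jW λ p jc jN jt →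
      let-J (pow-J 0 q-J (up p jk) (≤R m≤R) qm<) λ p₁ jm →
      any-J 1 (up p₁ jt) 2^N≤ λ Y Y< p₂ jY →
        and-J (independent-J (up (p ∙ p₁ ∙ p₂) jW) (up (p₁ ∙ p₂) jN) jY)
          (le-J (up p₂ jm) (count-J 0 (up (p₁ ∙ p₂) jN) N≤ λ x x< p₃ jx →
            bit-J 0 jx (up p₃ jY) (≤R (≤-trans (<⇒≤ x<) N≤R)))))

    without-J : ∀ {w NT YT ZT Y Z} → J w NT universe 1 0 → J w YT Y 1 0 → J w ZT Z 1 0 →
      J w (withoutT NT YT ZT) (without Y Z) 14 0
    without-J {Y = Y} {Z} jN jY jZ = weakenᵇ (mask-J 0 jN N≤ (<⇒≤ N<L) λ x x< p jx →
      let x≤ = ≤R (≤-trans (<⇒≤ x<) N≤R) in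
      and-J (bit-J 0 jx (up p jY) x≤) (not-J (bit-J 0 jx (up p jZ) x≤)))

    module _ (2^N≤L : 2 ^ universe ≤ L) where

      -- Three factors `X`: the entries of the new table, the candidates for the removed independent
      -- set, and the divisions that reach a bit of the old table.
      round-J : ∀ {w W NT tT AT c} → Bits w W U → J w NT universe 1 0 → J w tT (2 ^ universe) 1 0 →
        J w AT (mask (2 ^ universe) (colourable c)) 1 0 →
        J w (roundT b W NT tT AT) (mask (2 ^ universe) (colourable (suc c))) 90 3
      round-J {c = c} jW jN jt jA = weakenᵇ (mask-J 1 {colourable (suc c)} jt 2^N≤ 2^N≤L λ Y Y< p jY →
        any-J 1 (up p jt) 2^N≤ λ Z Z< p₁ jZ →
          and-J (independent-J (up (p ∙ p₁) jW) (up (p ∙ p₁) jN) jZ)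
            (let-J (without-J (up (p ∙ p₁) jN) (up p₁ jY) jZ) λ p₂ jV →
              reval (cong 𝟙 (bit-mask (2 ^ universe) (colourable c) (mask< universe _)))
                (bit-J 1 jV (up (p ∙ p₁ ∙ p₂) jA) (≤-trans (<⇒≤ (mask< universe _)) 2^N≤))))

      indexes-J : ∀ {w W kT m} → Bits w W U → J w kT m 1 0 →
        J w (indexesT b W kT) (𝟙 (indexes m)) 110 3
      indexes-J {m = m} jW jk = weakenᵇ (withUniverse-J jW λ p jc jN jt →
        let-J (monus-J jc (up p jk)) λ p₁ jd →
        let-J (pow-J 0 q-J jd (≤R (≤-trans (m∸n≤m (count n U) m) w≤R)) (≤R⇒< colours≤R)) λ p₂ jq →
        let-J (loop-J {e = 0} (λ i → mask (2 ^ universe) (colourable i)) jq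
            (reval (sym (mask-zero (2 ^ universe) (m^n>0 2 universe))) (const≤64 1)) (≤R colours≤R) λ i _ p₃ _ jA →
              round-J {c = i} (up (p ∙ p₁ ∙ p₂ ∙ p₃) jW) (up (p₁ ∙ p₂ ∙ p₃) jN) (up (p₁ ∙ p₂ ∙ p₃) jt) jA) λ p₃ jA →
        let-J (mask-J 0 {λ _ → true} (up (p₁ ∙ p₂ ∙ p₃) jN) N≤ (<⇒≤ N<L) λ _ _ _ _ → weakenᵇ {δ′ = 2} (const≤64 1)) λ p₄ jZ →
        and-J (le-J (up (p ∙ p₁ ∙ p₂ ∙ p₃ ∙ p₄) jk) (up (p₁ ∙ p₂ ∙ p₃ ∙ p₄) jc))
          (reval (cong 𝟙 (bit-mask (2 ^ universe) (colourable (suc b ^ (count n U ∸ m))) (mask< universe (λ _ → true))))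
            (bit-J 1 jZ (up p₄ jA) (≤-trans (<⇒≤ (mask< universe (λ _ → true))) 2^N≤))))
        where
          colours≤R : suc b ^ (count n U ∸ m) ≤ R
          colours≤R = ≤-trans (^-monoʳ-≤ (suc b) (m∸n≤m (count n U) m)) N≤R

-- The search for a matrix of low rank as a program

module RankTerms (b ζ tadd tmul : ℕ) where

  -- Field operations are looked up: the constant t holds the q² results of an operation as digits,
  -- and x, y address one of them in row-major order. The field is fixed, so t is a literal of the
  -- program.
  tableT : ℕ → Term → Term → Term
  tableT t x y = letT (opT add (opT mul x (const (suc b))) y) λ p → digitT b p (const t)

  matrixT : Term → Term → Term → Term → Term → Term
  matrixT W w M i j = letT (rankT W i) λ r → letT (rankT W j) λ s →
    letT (opT add (opT mul r w) s) λ p → digitT b p M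

  chosenT : Term → Term → Term → Term
  chosenT W X j = andT (bitT j W) (letT (rankT W j) λ r → bitT r X)

  combT : Term → Term → Term → Term → Term → Term → Term
  combT W w M X z i = loopT orderT (const ζ) λ j acc →
    letT (chosenT W X j) λ c → letT (letterT b W j z) λ x → letT (matrixT W w M i j) λ y →
    letT (tableT tmul x y) λ m → letT (tableT tadd acc m) λ s →
    -- A selection without branching: the truth value c picks either the new sum or the old
    -- accumulator.
    opT add (opT mul c s) (opT mul (notT c) acc)

  freeT : Term → Term → Term → Term → Term → Term
  freeT W w N M X = allT N λ z →
    orT (anyT orderT λ i → andT (bitT i W) (notT (letT (combT W w M X z i) λ a → eqT a (const ζ))))
        (allT orderT λ j → orT (notT (chosenT W X j)) (letT (letterT b W j z) λ x → eqT x (const ζ)))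

  representsT : Term → Term → Term → Term
  representsT W w M = allT orderT λ i → allT orderT λ j → orT (notT (andT (bitT i W) (bitT j W)))
    (letT (letT (matrixT W w M i j) λ x → eqT x (const ζ)) λ z →
      orT (andT (eqT i j) (notT z)) (andT (notT (eqT i j)) (orT (edgeT i j) z)))

  rankedT : Term → Term → Term
  rankedT W k = letT (sizeT W) λ w → letT (opT mul w w) λ ww → letT (powT (const (suc b)) ww) λ P →
    letT (powT (const (suc b)) w) λ N → letT (powT (const 2) w) λ t →
    anyT P λ M → andT (representsT W w M) (allT t λ X →
      orT (notT (freeT W w N M X)) (leT (opT add (sumT orderT λ j → chosenT W X j) k) w))

𝟙-if : ∀ c s a → 𝟙 c * s + 𝟙 (not c) * a ≡ (if c then s else a)
𝟙-if true  s a = trans (+-identityʳ (s + 0)) (+-identityʳ s)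
𝟙-if false s a = +-identityʳ a

module FieldTables {c ℓ} (F : FiniteField c ℓ) (C : Coding F) where
  open Coding C using (b; enc; dec)
  open FiniteField F using (0#; _+ᶠ_; _*ᶠ_)

  q : ℕ
  q = suc b

  tadd tmul : ℕ
  tadd = encode b (q * q) λ p → enc (dec (row q p) +ᶠ dec (col q p))
  tmul = encode b (q * q) λ p → enc (dec (row q p) *ᶠ dec (col q p))

  open RankTerms b (enc 0#) tadd tmul public

module RankProgram {c ℓ} (F : FiniteField c ℓ) (C : Coding F) (n k : ℕ) (G : Graph n) (R X L : ℕ)
  (64≤R : 64 ≤ R) (1≤X : 1 ≤ X) (1≤L : 1 ≤ L) (n²+n≤R : n * n + n ≤ R) (R<2^L : R < 2 ^ L) (n<L : n < L)
  (2k<2^L : k + k < 2 ^ L) (q²≤R : suc (Coding.b C) * suc (Coding.b C) ≤ R) where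

  open Coding C using (b; enc; dec; enc<)
  open FiniteField F using (0#)
  open FieldTables F C public

  q≤R : q ≤ R
  q≤R = ≤-trans (m≤m*n q q) q²≤R

  open WordProgram n k G R X L 64≤R 1≤X 1≤L (≤-trans (m≤m+n (n * n) n) n²+n≤R) R<2^L n<L 2k<2^L b q≤R public

  private
    n≤ : n ≤ R * X ^ 0
    n≤ = ≤R n≤R

    ζ-J : ∀ {w} → J w (const (enc 0#)) (enc 0#) 1 0
    ζ-J = const-J (enc 0#) (≤R⇒< (≤-trans (<⇒≤ (enc< 0#)) q≤R))

  table-J : ∀ {w x y u v} (g : ℕ → ℕ → ℕ) → (∀ x y → g x y < q) → u < q → v < q →
    encode b (q * q) (λ p → g (row q p) (col q p)) < 2 ^ L → J w x u 1 0 → J w y v 1 0 →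
    J w (tableT (encode b (q * q) (λ p → g (row q p) (col q p))) x y) (g u v) 8 0
  table-J {u = u} {v} g g< u<q v<q t< jx jy = weakenᵇ (
    let lt , r , s = position q u v u<q v<q
        p≤ = ≤-trans (<⇒≤ lt) q²≤R
    in let-J (op-J add (op-J mul jx (const-J q (≤R⇒< q≤R)) (≤R⇒< (≤-trans (m≤m+n (u * q) v) p≤))) jy (≤R⇒< p≤)) λ p jp →
      reval (trans (digit-encode b (q * q) (λ p → g (row q p) (col q p)) (λ i _ → g< _ _) _ lt) (cong₂ g r s))
        (digit-J b 0 q≤R jp (const-J _ t<) (≤R p≤)))

  module _ (U : ℕ → Bool) (tadd< : tadd < 2 ^ L) (tmul< : tmul < 2 ^ L) where
    open CodedRank F C n (edge G) U using (w; entryᶜ; coeffᶜ; chosen; combᶜ; addᶜ; mulᶜ; represents; free; ranked)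

    private
      w≤n : w ≤ n
      w≤n = count≤n n U

    matrix-J : ∀ {ω W wT MT iT jT M i j} → Bits ω W U → J ω wT w 1 0 → J ω MT M 1 0 → J ω iT i 1 0 → J ω jT j 1 0 →
      i < n → j < n → J ω (matrixT W wT MT iT jT) (entryᶜ M i j) 12 0
    matrix-J {i = i} {j} jW jw jM ji jj i<n j<n = weakenᵇ (
      let-J (rank-J {U = U} jW ji (<⇒≤ i<n)) λ p₁ jr → let-J (rank-J {U = U} (up p₁ jW) (up p₁ jj) (<⇒≤ j<n)) λ p₂ js →
      let p≤ = ≤-trans (+-mono-≤ (*-mono-≤ (≤-trans (count≤n i U) (<⇒≤ i<n)) w≤n) (≤-trans (count≤n j U) (<⇒≤ j<n))) n²+n≤R
      in let-J (op-J add (op-J mul (up p₂ jr) (up (p₁ ∙ p₂) jw) (≤R⇒< (≤-trans (m≤m+n _ (count j U)) p≤))) js (≤R⇒< p≤)) λ p₃ jp →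
      digit-J b 0 q≤R jp (up (p₁ ∙ p₂ ∙ p₃) jM) (≤R p≤))

    chosen-J : ∀ {ω W XT jT Y j} → Bits ω W U → J ω XT Y 1 0 → J ω jT j 1 0 → j < n →
      J ω (chosenT W XT jT) (𝟙 (chosen Y j)) 12 0
    chosen-J {j = j} jW jX jj j<n = weakenᵇ (and-J (member-J {U = U} jj jW j<n)
      (let-J (rank-J {U = U} jW jj (<⇒≤ j<n)) λ p jr → bit-J 0 jr (up p jX) (≤R (≤-trans (count≤n j U) (≤-trans (<⇒≤ j<n) n≤R)))))

    combᶜ< : ∀ M Y z i t → combᶜ M Y z i t < q
    combᶜ< M Y z i zero    = enc< 0#
    combᶜ< M Y z i (suc t) with chosen Y t
    ... | true  = enc< _
    ... | false = combᶜ< M Y z i t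

    comb-J : ∀ {ω W wT MT XT zT iT M Y z i} → Bits ω W U → J ω wT w 1 0 → J ω MT M 1 0 → J ω XT Y 1 0 → J ω zT z 1 0 →
      J ω iT i 1 0 → i < n → J ω (combT W wT MT XT zT iT) (combᶜ M Y z i n) 24 0
    comb-J {M = M} {Y} {z} {i} jW jw jM jX jz ji i<n = weakenᵇ
      (loop-J {e = 0} (combᶜ M Y z i) orderJ ζ-J n≤ λ j j<n p jj jacc →
        let-J (chosen-J (up p jW) (up p jX) jj j<n) λ p₁ jc →
        let-J (letter-J {U = U} (up (p ∙ p₁) jW) (up p₁ jj) (up (p ∙ p₁) jz) j<n) λ p₂ jx →
        let-J (matrix-J (up (p ∙ p₁ ∙ p₂) jW) (up (p ∙ p₁ ∙ p₂) jw) (up (p ∙ p₁ ∙ p₂) jM) (up (p ∙ p₁ ∙ p₂) ji) (up (p₁ ∙ p₂) jj) i<n j<n) λ p₃ jy →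
        let-J (table-J mulᶜ (λ _ _ → enc< _) (digit<base b (count j U) z) (digit<base b (count i U * w + count j U) M) tmul< (up p₃ jx) jy) λ p₄ jm →
        let-J (table-J addᶜ (λ _ _ → enc< _) (combᶜ< M Y z i j) (enc< _) tadd< (up (p₁ ∙ p₂ ∙ p₃ ∙ p₄) jacc) jm) λ p₅ js →
        select-J (up (p₂ ∙ p₃ ∙ p₄ ∙ p₅) jc) js (up (p₁ ∙ p₂ ∙ p₃ ∙ p₄ ∙ p₅) jacc))
      where
        select-J : ∀ {ω cT sT aT v s a} → J ω cT (𝟙 v) 1 0 → J ω sT s 1 0 → J ω aT a 1 0 →
          J ω (opT add (opT mul cT sT) (opT mul (notT cT) aT)) (if v then s else a) 4 0
        select-J {v = v} {s} {a} jc js ja = reval (𝟙-if v s a)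
          (op-J add (op-J mul jc js (≤-trans (s≤s (scale v s)) (small js))) (op-J mul (not-J jc) ja (≤-trans (s≤s (scale (not v) a)) (small ja)))
            (subst (_< 2 ^ L) (sym (𝟙-if v s a)) (choose v)))
          where
            scale : ∀ v s → 𝟙 v * s ≤ s
            scale v s = ≤-trans (*-monoˡ-≤ s (𝟙≤1 v)) (≤-reflexive (*-identityˡ s))
            choose : ∀ v → (if v then s else a) < 2 ^ L
            choose true  = small js
            choose false = small ja

    represents-J : ∀ {ω W wT MT M} → Bits ω W U → J ω wT w 1 0 → J ω MT M 1 0 →
      J ω (representsT W wT MT) (𝟙 (represents M)) 45 0
    represents-J {M = M} jW jw jM = weakenᵇ (all-J 0 orderJ n≤ λ i i<n p ji → all-J 0 orderJ n≤ λ j j<n p₁ jj →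
      or-J (not-J (and-J (member-J {U = U} (up p₁ ji) (up (p ∙ p₁) jW) i<n) (member-J {U = U} jj (up (p ∙ p₁) jW) j<n)))
        (let-J (let-J (matrix-J (up (p ∙ p₁) jW) (up (p ∙ p₁) jw) (up (p ∙ p₁) jM) (up p₁ ji) jj i<n j<n) λ p₂ jx → eq-J jx ζ-J) λ p₂ jz →
         or-J (and-J (eq-J (up (p₁ ∙ p₂) ji) (up p₂ jj)) (not-J jz))
           (and-J (not-J (eq-J (up (p₁ ∙ p₂) ji) (up p₂ jj))) (or-J (edge-J (up (p₁ ∙ p₂) ji) (up p₂ jj) i<n j<n) jz))))

    module _ (eM eN et : ℕ) (P≤ : q ^ (w * w) ≤ R * X ^ eM) (N≤ : q ^ w ≤ R * X ^ eN) (t≤ : 2 ^ w ≤ R * X ^ et)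
      (P< : q ^ (w * w) < 2 ^ L) (N< : q ^ w < 2 ^ L) (t< : 2 ^ w < 2 ^ L) where

      free-J : ∀ {ω W wT NT MT XT M Y} → Bits ω W U → J ω wT w 1 0 → J ω NT (q ^ w) 1 0 → J ω MT M 1 0 → J ω XT Y 1 0 →
        J ω (freeT W wT NT MT XT) (𝟙 (free M Y)) 55 eN
      free-J {M = M} {Y} jW jw jN jM jX = weaken (≤ᵇ⇒≤ 50 55 _) (≤-reflexive (+-identityʳ eN)) (weakenᵇ {δ′ = 50} (all-J eN jN N≤ λ z z< p jz →
        or-J (any-J 0 orderJ n≤ λ i i<n p₁ ji → and-J (member-J {U = U} ji (up (p ∙ p₁) jW) i<n)
               (not-J (let-J (comb-J (up (p ∙ p₁) jW) (up (p ∙ p₁) jw) (up (p ∙ p₁) jM) (up (p ∙ p₁) jX) (up p₁ jz) ji i<n) λ _ ja → eq-J ja ζ-J)))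
          (all-J 0 orderJ n≤ λ j j<n p₁ jj → or-J (not-J (chosen-J (up (p ∙ p₁) jW) (up (p ∙ p₁) jX) jj j<n))
            (let-J (letter-J {U = U} (up (p ∙ p₁) jW) jj (up p₁ jz) j<n) λ _ jx → eq-J jx ζ-J))))

      -- The three exponents belong to the nested searches over matrices, over sets of columns and
      -- over coefficient vectors.
      ranked-J : ∀ {ω W kT m} → Bits ω W U → J ω kT m 1 0 → n + m < 2 ^ L →
        J ω (rankedT W kT) (𝟙 (ranked m)) 100 (eM + (et + eN))
      ranked-J {m = m} jW jk m< = weakenᵇ
        (let-J (size-J {U = U} jW) λ p₁ jw → let-J (op-J mul jw jw (≤R⇒< w²≤R)) λ p₂ jww →
         let-J (pow-J 0 (const-J q (≤R⇒< q≤R)) jww (≤R w²≤R) P<) λ p₃ jP →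
         let-J (pow-J 0 (const-J q (≤R⇒< q≤R)) (up (p₂ ∙ p₃) jw) (≤R w≤R) N<) λ p₄ jN →
         let-J (pow-J 0 (const≤64 2) (up (p₂ ∙ p₃ ∙ p₄) jw) (≤R w≤R) t<) λ p₅ jt →
         any-J eM (up (p₄ ∙ p₅) jP) P≤ λ M M< p₆ jM →
         and-J (represents-J (up (p₁ ∙ p₂ ∙ p₃ ∙ p₄ ∙ p₅ ∙ p₆) jW) (up (p₂ ∙ p₃ ∙ p₄ ∙ p₅ ∙ p₆) jw) jM)
           (all-J et (up p₆ jt) t≤ λ Y Y< p₇ jY →
             weaken (≤-refl {64}) (≤-reflexive (⊔-identityʳ eN)) (weakenᵇ (or-J
               (not-J (free-J {Y = Y} (up (p₁ ∙ p₂ ∙ p₃ ∙ p₄ ∙ p₅ ∙ p₆ ∙ p₇) jW) (up (p₂ ∙ p₃ ∙ p₄ ∙ p₅ ∙ p₆ ∙ p₇) jw)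
                 (up (p₅ ∙ p₆ ∙ p₇) jN) (up p₇ jM) jY))
               (le-J (op-J add (count-J 0 orderJ n≤ λ j j<n p₈ jj →
                   chosen-J (up (p₁ ∙ p₂ ∙ p₃ ∙ p₄ ∙ p₅ ∙ p₆ ∙ p₇ ∙ p₈) jW) (up p₈ jY) jj j<n)
                 (up (p₁ ∙ p₂ ∙ p₃ ∙ p₄ ∙ p₅ ∙ p₆ ∙ p₇) jk) (≤-trans (s≤s (+-monoˡ-≤ m (count≤n n (chosen Y)))) m<))
                 (up (p₂ ∙ p₃ ∙ p₄ ∙ p₅ ∙ p₆ ∙ p₇) jw))))))
        where
          w²≤R : w * w ≤ R
          w²≤R = ≤-trans (*-mono-≤ w≤n w≤n) (≤-trans (m≤m+n (n * n) n) n²+n≤R)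
          w≤R : w ≤ R
          w≤R = ≤-trans w≤n n≤R

-- From codes and matrices back to the problems

-- The problems are defined through an optimum that must be exhibited. The Boolean brute-force tests
-- make a bounded search for it possible; `greatest` serves the maxima.
least : ∀ (B : ℕ → Bool) m → B m ≡ true → ∃[ l ] l ≤ m × B l ≡ true × (∀ i → B i ≡ true → l ≤ i)
least B zero    p = 0 , z≤n , p , λ _ _ → z≤n
least B (suc m) p with b-dec (B 0) | least (B ∘ suc) m p
... | inj₁ q | _ = 0 , z≤n , q , λ _ _ → z≤n
... | inj₂ q | l , l≤ , r , h = suc l , s≤s l≤ , r , λ where
  zero    s → absurd s q
  (suc i) s → s≤s (h i s)

greatest : ∀ (B : ℕ → Bool) N {m} → (∀ i → B i ≡ true → i ≤ N) → B m ≡ true →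
  ∃[ g ] B g ≡ true × (∀ i → B i ≡ true → i ≤ g)
greatest B zero    {m} bound p = m , p , λ i q → ≤-trans (bound i q) z≤n
greatest B (suc N) {m} bound p with b-dec (B (suc N))
... | inj₁ q = suc N , q , bound
... | inj₂ q = greatest B N (λ i r → ≤-pred (≤∧≢⇒< (bound i r) λ where refl → absurd r q)) p

module GraphFacts {n : ℕ} (G : Graph n) where

  edge-adj : ∀ i j → edge G (toℕ i) (toℕ j) ≡ adj G i j
  edge-adj i j = trans (cong (_≡ᵇ 1) value) (𝟙-≡ᵇ1 (adj G i j))
    where
      value : adjBit G (toℕ i * n + toℕ j) ≡ 𝟙 (adj G i j)
      value with toℕ i * n + toℕ j <? n * n
      ... | no f = ⊥-elim (f (proj₁ (position n (toℕ i) (toℕ j) (toℕ<n i) (toℕ<n j))))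
      ... | yes p = trans (cong (λ z → if uncurry (adj G) z then 1 else 0)
              (trans (cong (remQuot n) (toℕ-injective (trans (toℕ-fromℕ< p)
                (trans (cong (_+ toℕ j) (*-comm (toℕ i) n)) (sym (toℕ-combine i j)))))) (remQuot-combine i j))) (bit-value (adj G i j))
        where
          bit-value : ∀ b → (if b then 1 else 0) ≡ 𝟙 b
          bit-value true  = refl
          bit-value false = refl

  edge-fin : ∀ {u v} (p : u < n) (q : v < n) → edge G u v ≡ adj G (fromℕ< p) (fromℕ< q)
  edge-fin p q = trans (cong₂ (edge G) (sym (toℕ-fromℕ< p)) (sym (toℕ-fromℕ< q))) (edge-adj _ _)

  edge-sym : ∀ u v → u < n → v < n → edge G u v ≡ edge G v u
  edge-sym u v p q = trans (edge-fin p q) (trans (symmetric G _ _) (sym (edge-fin q p)))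

  edge-irr : ∀ u → u < n → edge G u u ≡ false
  edge-irr u p = trans (edge-fin p p) (loopless G _)

  module _ {A : Set} where

    map-agree : ∀ {f g : Fin n → A} S → (∀ j → j ∈ S → f j ≡ g j) → Vec.map f (Vec.fromList S) ≡ Vec.map g (Vec.fromList S)
    map-agree []      h = refl
    map-agree (x ∷ S) h = cong₂ _∷_ (h x (here refl)) (map-agree S λ j → h j ∘ there)

    map-agree⁻ : ∀ {f g : Fin n → A} S → Vec.map f (Vec.fromList S) ≡ Vec.map g (Vec.fromList S) → ∀ j → j ∈ S → f j ≡ g j
    map-agree⁻ (x ∷ S) e j (here refl) = Vec.∷-injectiveˡ e
    map-agree⁻ (x ∷ S) e j (there m)   = map-agree⁻ S (Vec.∷-injectiveʳ e) j m

    restrict-agree : ∀ {x y : Vec A n} i → (∀ j → adj G i j ≡ true → Vec.lookup x j ≡ Vec.lookup y j) → x ↾ N G i ≡ y ↾ N G i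
    restrict-agree i h = map-agree (N G i) λ j m → h j (T-true (proj₂ (∈-filter⁻ (T? ∘ adj G i) {xs = List.allFin n} m)))
      where
        T-true : ∀ {b} → T b → b ≡ true
        T-true {true} _ = refl

    restrict-agree⁻ : ∀ {x y : Vec A n} i → x ↾ N G i ≡ y ↾ N G i → ∀ j → adj G i j ≡ true → Vec.lookup x j ≡ Vec.lookup y j
    restrict-agree⁻ i e j a = map-agree⁻ (N G i) e j (∈-filter⁺ (T? ∘ adj G i) (∈-allFin j) (subst T (sym a) tt))

module Reading (b : ℕ) where

  read : ∀ {n} → Vec (Fin (suc b)) n → ℕ → ℕ
  read {n} x v with v <? n
  ... | yes p = toℕ (Vec.lookup x (fromℕ< p))
  ... | no _  = 0

  read-toℕ : ∀ {n} (x : Vec (Fin (suc b)) n) i → read x (toℕ i) ≡ toℕ (Vec.lookup x i)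
  read-toℕ {n} x i with toℕ i <? n
  ... | yes p = cong (toℕ ∘ Vec.lookup x) (fromℕ<-toℕ i p)
  ... | no f  = ⊥-elim (f (toℕ<n i))

  read< : ∀ {n} (x : Vec (Fin (suc b)) n) v → read x v < suc b
  read< {n} x v with v <? n
  ... | yes p = toℕ<n (Vec.lookup x (fromℕ< p))
  ... | no _  = z<s

  write : ∀ n → (ℕ → ℕ) → Vec (Fin (suc b)) n
  write n f = Vec.tabulate λ i → fromℕ< (m%n<n (f (toℕ i)) (suc b))

  lookup-write : ∀ n f i → f (toℕ i) < suc b → toℕ (Vec.lookup (write n f) i) ≡ f (toℕ i)
  lookup-write n f i p = trans (cong toℕ (lookup∘tabulate _ i)) (trans (toℕ-fromℕ< _) (m<n⇒m%n≡m p))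

  read-write : ∀ n f → (∀ v → f v < suc b) → ∀ v → v < n → read (write n f) v ≡ f v
  read-write n f h v p = trans (cong (read (write n f)) (sym (toℕ-fromℕ< p)))
    (trans (read-toℕ (write n f) (fromℕ< p)) (trans (lookup-write n f (fromℕ< p) (h _)) (cong f (toℕ-fromℕ< p))))

  read-ext : ∀ {n} {x y : Vec (Fin (suc b)) n} → (∀ v → v < n → read x v ≡ read y v) → x ≡ y
  read-ext {n} {x} {y} h = trans (sym (tabulate∘lookup x)) (trans (tabulate-cong λ i → toℕ-injective
    (trans (sym (read-toℕ x i)) (trans (h (toℕ i) (toℕ<n i)) (read-toℕ y i)))) (tabulate∘lookup y))

  toCode : ∀ {n} → Vec (Fin (suc b)) n → ℕ
  toCode {n} x = encode b n (read x)

  fromCode : ∀ n → ℕ → Vec (Fin (suc b)) n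
  fromCode n z = write n (λ v → digit b v z)

  toCode< : ∀ {n} (x : Vec (Fin (suc b)) n) → toCode x < suc b ^ n
  toCode< {n} x = full-code< b n (read< x)

  digit-toCode : ∀ {n} (x : Vec (Fin (suc b)) n) v → v < n → digit b v (toCode x) ≡ read x v
  digit-toCode {n} x = digit-encode b n (read x) (λ i _ → read< x i)

  read-fromCode : ∀ n z v → v < n → read (fromCode n z) v ≡ digit b v z
  read-fromCode n z = read-write n _ (λ v → digit<base b v z)

  fromCode-toCode : ∀ {n} (x : Vec (Fin (suc b)) n) → fromCode n (toCode x) ≡ x
  fromCode-toCode {n} x = read-ext λ v p → trans (read-fromCode n (toCode x) v p) (digit-toCode x v p)

  toCode-injective : ∀ {n} {x y : Vec (Fin (suc b)) n} → toCode x ≡ toCode y → x ≡ y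
  toCode-injective {n} {x} {y} e = trans (sym (fromCode-toCode x)) (trans (cong (fromCode n) e) (fromCode-toCode y))

  fromCode-injective : ∀ n {y z} → y < suc b ^ n → z < suc b ^ n → fromCode n y ≡ fromCode n z → y ≡ z
  fromCode-injective n {y} {z} p q e = digit-ext b n p q λ v v< →
    trans (sym (read-fromCode n y v v<)) (trans (cong (λ x → read x v) e) (read-fromCode n z v v<))

module CodeLinks (b : ℕ) {n : ℕ} (G : Graph n) where
  open Colourings b n (edge G)
  open Reading b
  open GraphFacts G

  V : ℕ → Bool
  V _ = true

  clash-vec : ∀ {x y : Vec (Fin (suc b)) n} i → x ↾ N G i ≡ y ↾ N G i → Vec.lookup x i ≢ Vec.lookup y i → Clash V (read x) (read y)
  clash-vec {x} {y} i e d = clashes (toℕ<n i) refl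
    (λ r → d (toℕ-injective (trans (sym (read-toℕ x i)) (trans r (read-toℕ y i)))))
    λ u u<n _ a → trans (cong (read x) (sym (toℕ-fromℕ< u<n))) (trans (read-toℕ x _)
      (trans (cong toℕ (restrict-agree⁻ {x = x} {y} i e (fromℕ< u<n) (trans (sym (edge-adj i _)) (trans (cong (edge G (toℕ i)) (toℕ-fromℕ< u<n)) a))))
        (trans (sym (read-toℕ y _)) (cong (read y) (toℕ-fromℕ< u<n)))))

  vec-clash : ∀ {x y : Vec (Fin (suc b)) n} → Clash V (read x) (read y) →
    ∃[ i ] x ↾ N G i ≡ y ↾ N G i × Vec.lookup x i ≢ Vec.lookup y i
  vec-clash {x} {y} (clashes {v} v<n _ d f) = fromℕ< v<n ,
    restrict-agree {x = x} {y} (fromℕ< v<n) (λ j a → toℕ-injective (trans (sym (read-toℕ x j))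
      (trans (f (toℕ j) (toℕ<n j) refl (trans (cong (λ z → edge G z (toℕ j)) (sym (toℕ-fromℕ< v<n))) (trans (edge-adj _ j) a))) (read-toℕ y j)))) ,
    λ e → d (trans (cong (read x) (sym (toℕ-fromℕ< v<n))) (trans (read-toℕ x _) (trans (cong toℕ e)
      (trans (sym (read-toℕ y _)) (cong (read y) (toℕ-fromℕ< v<n))))))

  unique-lookup : ∀ {A : Set} {C : List A} → Unique C → ∀ i j → List.lookup C i ≡ List.lookup C j → i ≡ j
  unique-lookup (p ∷ u) Fin.zero    Fin.zero    e = refl
  unique-lookup {C = x ∷ C} (p ∷ u) Fin.zero    (Fin.suc j) e = ⊥-elim (All.lookup p (∈-lookup j) e)
  unique-lookup {C = x ∷ C} (p ∷ u) (Fin.suc i) Fin.zero    e = ⊥-elim (All.lookup p (∈-lookup i) (sym e))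
  unique-lookup (p ∷ u) (Fin.suc i) (Fin.suc j) e = cong Fin.suc (unique-lookup u i j e)

  module _ {C : List (Vec (Fin (suc b)) n)} (unique : Unique C) (safe : IsStorageCode (suc b) G C) where

    nth : ℕ → Vec (Fin (suc b)) n
    nth i with i <? List.length C
    ... | yes p = List.lookup C (fromℕ< p)
    ... | no _  = write n λ _ → 0

    nth-lookup : ∀ {i} (p : i < List.length C) → nth i ≡ List.lookup C (fromℕ< p)
    nth-lookup {i} p with i <? List.length C
    ... | yes _ = refl
    ... | no f  = ⊥-elim (f p)

    list-storage : Storage V (List.length C)
    list-storage = storage (read ∘ nth) (λ i → read< (nth i))
      (λ i j p q i≢j → differ (λ e → i≢j (trans (sym (toℕ-fromℕ< p)) (trans (cong toℕ
        (unique-lookup unique _ _ (trans (sym (nth-lookup p)) (trans e (nth-lookup q))))) (toℕ-fromℕ< q)))))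
      (λ i j p q _ cl → let v , e , d = vec-clash {nth i} {nth j} cl in
        d (safe (nth i) (nth j) (member p) (member q) v e))
      where
        member : ∀ {i} → i < List.length C → nth i ∈ C
        member p = subst (_∈ C) (sym (nth-lookup p)) (∈-lookup (fromℕ< p))
        differ : ∀ {x y} → x ≢ y → Differ V (read x) (read y)
        differ {x} {y} d with search n (λ v → not (read x v ≡ᵇ read y v))
        ... | inj₁ (v , v<n , p) = v , v<n , refl , ≡ᵇ-false (read x v) (read y v) (not-elim p)
        ... | inj₂ none = ⊥-elim (d (read-ext λ v v<n → ≡ᵇ-sound (not-false (none v v<n))))

  storage-list : ∀ {m} → Storage V m → HasStorageCode (suc b) G m
  storage-list {m} (storage c dig dist safe) = List.tabulate f , Unique.tabulate⁺ inj , code-safe , List.length-tabulate f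
    where
      f : Fin m → Vec (Fin (suc b)) n
      f i = write n (c (toℕ i))
      back : ∀ i v → v < n → read (f i) v ≡ c (toℕ i) v
      back i = read-write n (c (toℕ i)) (dig (toℕ i))
      inj : ∀ {i j} → f i ≡ f j → i ≡ j
      inj {i} {j} e with toℕ i ≟ toℕ j
      ... | yes p = toℕ-injective p
      ... | no i≢j = let v , v<n , _ , d = dist (toℕ i) (toℕ j) (toℕ<n i) (toℕ<n j) i≢j in
        ⊥-elim (d (trans (sym (back i v v<n)) (trans (cong (λ x → read x v) e) (back j v v<n))))
      code-safe : IsStorageCode (suc b) G (List.tabulate f)
      code-safe x y x∈ y∈ v e with ∈-tabulate⁻ x∈ | ∈-tabulate⁻ y∈ | Vec.lookup x v Fin.≟ Vec.lookup y v
      ... | _ | _ | yes p = p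
      ... | i , refl | j , refl | no d with toℕ i ≟ toℕ j
      ...   | yes p = cong (λ i → Vec.lookup (f i) v) (toℕ-injective p)
      ...   | no i≢j = ⊥-elim (safe (toℕ i) (toℕ j) (toℕ<n i) (toℕ<n j) i≢j
              (Clash-cong (λ u u<n _ → back i u u<n) (λ u u<n _ → back j u u<n) (clash-vec v e d)))

  storage-has : ∀ {m} → HasStorageCode (suc b) G m → Storage V m
  storage-has (C , unique , safe , refl) = list-storage unique safe

  open Table V

  -- The brute-force test on the whole vertex set, here only a decision procedure whose cost is
  -- irrelevant, yields the maximum size of a code; that size is at most the number of words.
  capacity-sound : ∀ {k} → Storage V (suc b ^ k) → StorageCapacity (suc b) n G k
  capacity-sound {k} S =
    let m , p , max = greatest stores universe {suc b ^ k} bounded (stores-complete S)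
    in m , (storage-list (stores-sound {m} p) , λ m′ H → max m′ (stores-complete (storage-has H))) ,
       max (suc b ^ k) (stores-complete S)
    where
      bounded : ∀ i → stores i ≡ true → i ≤ universe
      bounded i p = let X , _ , q = any-elim (2 ^ universe) p in
        ≤-trans (≤ᵇ-sound {i} (∧-right {independent X} q)) (count≤n universe _)

  capacity-complete : ∀ {k} → StorageCapacity (suc b) n G k → Storage V (suc b ^ k)
  capacity-complete (m , (H , _) , le) = storage-restrict le (storage-has H)

  -- The colour of a word is its encoding. Clashing words with equal encodings would give some
  -- vertex the same message for two different letters.
  index-colouring : ∀ {ℓ} → IndexCode (suc b) G ℓ → Colouring V (suc b ^ ℓ)
  index-colouring {ℓ} I = colouring (toCode ∘ E ∘ fromCode n) (λ x _ → toCode< (E (fromCode n x))) proper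
    where
      open IndexCode I
      proper : ∀ x y → x < suc b ^ n → y < suc b ^ n → Clash V (λ v → digit b v x) (λ v → digit b v y) →
        toCode (E (fromCode n x)) ≢ toCode (E (fromCode n y))
      proper x y _ _ cl e =
        let i , r , d = vec-clash {fromCode n x} {fromCode n y}
              (Clash-cong (λ v v<n _ → sym (read-fromCode n x v v<n)) (λ v v<n _ → sym (read-fromCode n y v v<n)) cl)
        in d (trans (sym (decodes i (fromCode n x)))
             (trans (cong (g i) (cong₂ Vec._++_ (toCode-injective e) r)) (decodes i (fromCode n y))))

  -- The decoder searches for any word that produces the message it received and answers with its
  -- letter. A wrong letter would make that word clash with the true one at equal colours. The
  -- default `Fin.zero` is never reached on a message of an actual word.
  colouring-index : ∀ {ℓ} → Colouring V (suc b ^ ℓ) → IndexCode (suc b) G ℓ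
  colouring-index {ℓ} (colouring col bd pr) = record { E = E′ ; g = g′ ; decodes = decodes′ }
    where
      E′ : Vec (Fin (suc b)) n → Vec (Fin (suc b)) ℓ
      E′ x = fromCode ℓ (col (toCode x))

      message : ∀ i → Vec (Fin (suc b)) n → Vec (Fin (suc b)) (ℓ + List.length (N G i))
      message i x = E′ x Vec.++ (x ↾ N G i)

      g′ : ∀ i → Vec (Fin (suc b)) (ℓ + List.length (N G i)) → Fin (suc b)
      g′ i v with search (suc b ^ n) (λ y → does (Vec.≡-dec Fin._≟_ (message i (fromCode n y)) v))
      ... | inj₁ (y , _) = Vec.lookup (fromCode n y) i
      ... | inj₂ _       = Fin.zero

      decodes′ : ∀ i x → g′ i (message i x) ≡ Vec.lookup x i
      decodes′ i x with search (suc b ^ n) (λ y → does (Vec.≡-dec Fin._≟_ (message i (fromCode n y)) (message i x)))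
      ... | inj₂ none with Vec.≡-dec Fin._≟_ (message i (fromCode n (toCode x))) (message i x) | none (toCode x) (toCode< x)
      ...   | no f  | _ = ⊥-elim (f (cong (message i) (fromCode-toCode x)))
      decodes′ i x | inj₁ (y , y< , p) with Vec.≡-dec Fin._≟_ (message i (fromCode n y)) (message i x)
      ...   | yes e with Vec.lookup (fromCode n y) i Fin.≟ Vec.lookup x i
      ...     | yes r = r
      ...     | no d  = ⊥-elim (pr _ _ (toCode< (fromCode n y)) (toCode< x)
                (Clash-cong (λ v v<n _ → sym (digit-toCode (fromCode n y) v v<n)) (λ v v<n _ → sym (digit-toCode x v v<n))
                  (clash-vec i (++-injectiveʳ _ _ e) d))
                (fromCode-injective ℓ (bd _ (toCode< (fromCode n y))) (bd _ (toCode< x)) (++-injectiveˡ _ _ e)))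

  index-sound : ∀ {k} → Indexable V k → DualIndexCoding (suc b) n G k
  index-sound {k} (ℓ , le , C) =
    let l , l≤ , p , min = least (λ i → paintable (suc b ^ i)) ℓ (paintable-complete C)
    in l , (colouring-index (paintable-sound p) , λ i I → min i (paintable-complete (index-colouring I))) ,
       ≤-trans (+-monoˡ-≤ k l≤) (≤-trans le (count≤n n V))

  index-complete : ∀ {k} → DualIndexCoding (suc b) n G k → Indexable V k
  index-complete (ℓ , (I , _) , le) = ℓ , ≤-trans le (≤-reflexive (sym (count-true n))) , index-colouring I

module RankLinks {c ℓ} (F : FiniteField c ℓ) {n : ℕ} (G : Graph n) where
  open GraphFacts G
  open LinearSums F

  V : ℕ → Bool
  V _ = true

  open Representations F n (edge G)
    using (Mat; term; combination; Free; Represented; LowRank; term-in; term-out)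
  open CodedRank F (coding F) n (edge G) V

  open Algebra.Properties.CommutativeMonoid.Sum FF.+-commutativeMonoid using () renaming (sum to ∑)

  ∑-Σ : ∀ r (t : Fin r → Carrier) h → (∀ j → t j ≈ h (toℕ j)) → ∑ t ≈ Σᶠ r h
  ∑-Σ zero    t h e = FF.refl
  ∑-Σ (suc r) t h e = FF.+-cong (e Fin.zero) (∑-Σ r (t ∘ Fin.suc) (h ∘ suc) (e ∘ Fin.suc)) ⟶ FF.sym (Σ-head r h)

  Σ-select : ∀ n X g → Σᶠ n (λ x → if X x then g x else 0#) ≈ Σᶠ (count n X) (g ∘ select n X)
  Σ-select zero    X g = FF.refl
  Σ-select (suc n) X g with X n in e
  ... | false = FF.+-identityʳ _ ⟶ Σ-select n X g ⟶ ≡⇒≈ (cong (λ m → Σᶠ m (g ∘ select n X)) (sym (+-identityʳ (count n X))))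
  ... | true  = FF.+-cong (Σ-select n X g ⟶ Σ-cong (count n X) λ i p → ≡⇒≈ (cong g (sym (below i p)))) (≡⇒≈ (cong g (sym here-n)))
      ⟶ ≡⇒≈ (cong (λ m → Σᶠ m (λ i → g (if (count n X ≡ᵇ i) then n else select n X i))) (+-comm 1 (count n X)))
    where
      below : ∀ i → i < count n X → (if (count n X ≡ᵇ i) then n else select n X i) ≡ select n X i
      below i p rewrite ≢⇒≡ᵇ (count n X) i (λ e → <-irrefl (sym e) p) = refl
      here-n : (if (count n X ≡ᵇ count n X) then n else select n X (count n X)) ≡ n
      here-n rewrite ≡ᵇ-refl (count n X) = refl

  image : ℕ → (ℕ → ℕ) → ℕ → Bool
  image m φ x = any m λ j → φ j ≡ᵇ x

  -- Reindexing along an injection translates between sets of columns and families of columns, the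
  -- form used in the definition of rank; `Σ-select` does so through ranks.
  Σ-image : ∀ m φ g → (∀ j → j < m → φ j < n) → (∀ i j → i < m → j < m → φ i ≡ φ j → i ≡ j) →
    Σᶠ m (g ∘ φ) ≈ Σᶠ n (λ x → if image m φ x then g x else 0#)
  Σ-image zero    φ g h inj = FF.sym (Σ-zero n λ _ _ → FF.refl)
  Σ-image (suc m) φ g h inj =
    FF.+-cong (Σ-image m φ g (λ j p → h j (m<n⇒m<1+n p)) (λ i j p q → inj i j (m<n⇒m<1+n p) (m<n⇒m<1+n q))) (FF.sym last)
    ⟶ FF.sym (Σ-+ n _ _) ⟶ Σ-cong n combine′
    where
      point : ℕ → Carrier
      point x = if φ m ≡ᵇ x then g x else 0#
      last : Σᶠ n point ≈ g (φ m)
      last = Σ-single n (h m ≤-refl) (λ j _ p → ≡⇒≈ (cong (λ b → if b then g j else 0#) (≢⇒≡ᵇ (φ m) j (p ∘ sym))))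
        ⟶ ≡⇒≈ (cong (λ b → if b then g (φ m) else 0#) (≡ᵇ-refl (φ m)))
      combine′ : ∀ x → x < n → (if image m φ x then g x else 0#) +ᶠ point x ≈ (if image (suc m) φ x then g x else 0#)
      combine′ x _ with b-dec (φ m ≡ᵇ x)
      ... | inj₂ e rewrite e with image m φ x
      ...   | true  = FF.+-identityʳ (g x)
      ...   | false = FF.+-identityʳ 0#
      combine′ x _ | inj₁ e with image m φ x in f
      ...   | true = let j , j<m , r = any-elim m f in
              ⊥-elim (<-irrefl (inj j m (m<n⇒m<1+n j<m) ≤-refl (trans (≡ᵇ-sound {φ j} {x} r) (sym (≡ᵇ-sound {φ m} {x} e)))) j<m)
      ...   | false rewrite e = FF.+-identityˡ (g x)

  asMat : Matrix F n → Mat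
  asMat A i j with i <? n | j <? n
  ... | yes p | yes q = A (fromℕ< p) (fromℕ< q)
  ... | _     | _     = 0#

  asMat-toℕ : ∀ A i j → asMat A (toℕ i) (toℕ j) ≡ A i j
  asMat-toℕ A i j with toℕ i <? n | toℕ j <? n
  ... | yes p | yes q = cong₂ A (fromℕ<-toℕ i p) (fromℕ<-toℕ j q)
  ... | no f  | _     = ⊥-elim (f (toℕ<n i))
  ... | yes _ | no f  = ⊥-elim (f (toℕ<n j))

  asMat-fin : ∀ A {i j} (p : i < n) (q : j < n) → asMat A i j ≡ A (fromℕ< p) (fromℕ< q)
  asMat-fin A p q = trans (cong₂ (asMat A) (sym (toℕ-fromℕ< p)) (sym (toℕ-fromℕ< q))) (asMat-toℕ A (fromℕ< p) (fromℕ< q))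

  represented : ∀ {A} → Represents F A G → Represented (asMat A) V
  represented {A} (diag , off) =
    (λ i p _ e → diag (fromℕ< p) (subst (_≈ 0#) (asMat-fin A p p) e)) ,
    λ i j p q _ _ i≢j e → ≡⇒≈ (asMat-fin A p q) ⟶ off (fromℕ< p) (fromℕ< q)
      (λ r → i≢j (trans (sym (toℕ-fromℕ< p)) (trans (cong toℕ r) (toℕ-fromℕ< q)))) (trans (sym (edge-fin p q)) e)

  finite-mat : Mat → Matrix F n
  finite-mat M i j = M (toℕ i) (toℕ j)

  as-finite : ∀ M i j → i < n → j < n → asMat (finite-mat M) i j ≡ M i j
  as-finite M i j p q = trans (asMat-fin (finite-mat M) p q) (cong₂ M (toℕ-fromℕ< p) (toℕ-fromℕ< q))

  represents-finite : ∀ {M} → Represented M V → Represents F (finite-mat M) G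
  represents-finite (diag , off) = (λ i → diag (toℕ i) (toℕ<n i) refl) ,
    λ i j i≢j e → off (toℕ i) (toℕ j) (toℕ<n i) (toℕ<n j) refl refl (i≢j ∘ toℕ-injective) (trans (edge-adj i j) e)

  -- The columns of X are listed in increasing order. Coefficients of the family are spread over X
  -- by rank.
  free-columns : ∀ {A X} → Free (asMat A) V X → ∃[ f ] IndependentColumns F {n} {count n X} A f
  free-columns {A} {X} free = f , independent
    where
      spec : ∀ j → Selected n X (toℕ j) (select n X (toℕ j))
      spec j = select-spec n X (toℕ<n j)
      f : Fin (count n X) → Fin n
      f j = fromℕ< (Selected.bound (spec j))
      toℕ-f : ∀ j → toℕ (f j) ≡ select n X (toℕ j)
      toℕ-f j = toℕ-fromℕ< (Selected.bound (spec j))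
      independent : IndependentColumns F A f
      independent u eqs j = ≡⇒≈ (sym (z-select j)) ⟶
          free z rows (select n X (toℕ j)) (Selected.bound (spec j)) (Selected.member (spec j))
        where
          extend-u : ℕ → Carrier
          extend-u i with i <? count n X
          ... | yes p = u (fromℕ< p)
          ... | no _  = 0#
          extend-toℕ : ∀ j → extend-u (toℕ j) ≡ u j
          extend-toℕ j with toℕ j <? count n X
          ... | yes p = cong u (fromℕ<-toℕ j p)
          ... | no h  = ⊥-elim (h (toℕ<n j))
          z : ℕ → Carrier
          z x = extend-u (count x X)
          z-select : ∀ j → z (select n X (toℕ j)) ≡ u j
          z-select j = trans (cong extend-u (Selected.ranked (spec j))) (extend-toℕ j)
          rows : ∀ i → i < n → V i ≡ true → combination X z (asMat A) i ≈ 0#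
          rows i i<n _ = Σ-select n X (λ x → z x *ᶠ asMat A i x)
            ⟶ FF.sym (∑-Σ (count n X) _ _ λ j → ≡⇒≈ (sym (cong₂ _*ᶠ_ (z-select j) (trans (cong (asMat A i) (sym (toℕ-f j)))
                (trans (cong (λ x → asMat A x (toℕ (f j))) (sym (toℕ-fromℕ< i<n))) (asMat-toℕ A (fromℕ< i<n) (f j)))))))
            ⟶ eqs (fromℕ< i<n)

  -- An independent family is injective, as two equal columns i and j satisfy the relation
  -- `opposite i j`, so its image has at least m elements.
  columns-free : ∀ {A m} (f : Fin m → Fin n) → IndependentColumns F A f → ∃[ X ] Free (asMat A) V X × m ≤ count n X
  columns-free {A} {m} f independent = image m φ , image-free , injection-count m n φ
      (λ j p → φ< j p , any-intro m p (≡ᵇ-refl (φ j))) φ-injective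
    where
      φ : ℕ → ℕ
      φ j with j <? m
      ... | yes p = toℕ (f (fromℕ< p))
      ... | no _  = 0
      φ-toℕ : ∀ j → φ (toℕ j) ≡ toℕ (f j)
      φ-toℕ j with toℕ j <? m
      ... | yes p = cong (toℕ ∘ f) (fromℕ<-toℕ j p)
      ... | no h  = ⊥-elim (h (toℕ<n j))
      φ-fin : ∀ {j} (p : j < m) → φ j ≡ toℕ (f (fromℕ< p))
      φ-fin p = trans (cong φ (sym (toℕ-fromℕ< p))) (φ-toℕ (fromℕ< p))
      φ< : ∀ j → j < m → φ j < n
      φ< j p = subst (_< n) (sym (φ-fin p)) (toℕ<n _)
      column : ∀ i j → asMat A (toℕ i) (φ (toℕ j)) ≡ A i (f j)
      column i j = trans (cong (asMat A (toℕ i)) (φ-toℕ j)) (asMat-toℕ A i (f j))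
      φ-injective : ∀ i j → i < m → j < m → φ i ≡ φ j → i ≡ j
      φ-injective i j p q e with i ≟ j
      ... | yes r = r
      ... | no i≢j = ⊥-elim (FF.0≉1 (FF.sym (subst (_≈ 0#)
              (trans (cong (opposite i j) (toℕ-fromℕ< p)) (opposite-first i j)) (independent (opposite i j ∘ toℕ) eqs (fromℕ< p)))))
        where
          eqs : ∀ r → ∑ (λ l → opposite i j (toℕ l) *ᶠ A r (f l)) ≈ 0#
          eqs r = ∑-Σ m _ (λ l → opposite i j l *ᶠ asMat A (toℕ r) (φ l)) (λ l → ≡⇒≈ (cong (opposite i j (toℕ l) *ᶠ_) (sym (column r l))))
            ⟶ Σ-pair m p q i≢j (λ l _ a b → FF.*-congʳ (≡⇒≈ (opposite-other a b)) ⟶ FF.zeroˡ _)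
            ⟶ opposite-cancel i≢j (≡⇒≈ (cong (asMat A (toℕ r)) e))
      image-free : Free (asMat A) V (image m φ)
      image-free z eqs x x<n x∈ = let j , j<m , r = any-elim m x∈ in
          ≡⇒≈ (cong z (trans (sym (≡ᵇ-sound {φ j} {x} r)) (φ-fin j<m))) ⟶ independent (z ∘ toℕ ∘ f) sums (fromℕ< j<m)
        where
          sums : ∀ i → ∑ (λ l → z (toℕ (f l)) *ᶠ A i (f l)) ≈ 0#
          sums i = ∑-Σ m _ (λ l → z (φ l) *ᶠ asMat A (toℕ i) (φ l)) (λ l → ≡⇒≈ (cong₂ _*ᶠ_ (cong z (sym (φ-toℕ l))) (sym (column i l))))
            ⟶ Σ-image m φ (λ x → z x *ᶠ asMat A (toℕ i) x) φ< φ-injective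
            ⟶ eqs (toℕ i) (toℕ<n i) refl

  lowRank-bound : ∀ {k} → LowRank V k → k ≤ n
  lowRank-bound {k} (A , _ , low) = ≤-trans (≤-trans (m≤n+m k (count n none)) (low none (λ _ _ ()) λ _ _ _ _ ()))
      (count≤n n V)
    where none : ℕ → Bool
          none _ = false

  private
    w≡n : w ≡ n
    w≡n = count-true n

  rank-complete : ∀ {k} → DualMinrank F n G k → LowRank V k
  rank-complete {k} (r , ((A , rep , _ , max) , _) , le) = asMat A , represented rep , λ X _ free →
    ≤-trans (+-monoˡ-≤ k (max (count n X) (free-columns free))) (≤-trans le (≤-reflexive (sym w≡n)))

  -- Let K be the greatest gap for which the test succeeds and M its matrix. As K + 1 fails for M
  -- too, some free set of columns X has at least n - K elements, so M has rank exactly n - K.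
  rank-sound : ∀ {k} → LowRank V k → DualMinrank F n G k
  rank-sound {k} L with greatest ranked n {k} (λ i p → lowRank-bound (ranked-sound {i} p)) (ranked-complete L)
  ... | K , p , max with any-elim (q ^ (w * w)) p
  ...   | M , M< , r with search (2 ^ w) (λ X → not (not (free M X) ∨ (count n (chosen X) + suc K ≤ᵇ w)))
  ...     | inj₂ none = ⊥-elim (<-irrefl refl (max (suc K) (any-intro (q ^ (w * w)) M< (∧-intro (∧-left r)
              (all-intro (2 ^ w) λ X X< → not-false (none X X<))))))
  ...     | inj₁ (X , X< , t) = rank , ((finite-mat A , represents-finite rep , free-columns {finite-mat A} {chosen X} free′ , largest) , smallest) ,
              ≤-trans (+-monoʳ-≤ rank (max k (ranked-complete L))) (≤-reflexive rank+K)
    where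
      A = decoded M
      rep = represents-sound {M} (∧-left r)

      split : free M X ≡ true × (count n (chosen X) + suc K ≤ᵇ w) ≡ false
      split with free M X | count n (chosen X) + suc K ≤ᵇ w
      split | true | false = refl , refl

      rank : ℕ
      rank = count n (chosen X)

      low : ∀ Y → Free A V Y → count n Y + K ≤ n
      low Y f = ≤-trans (ranked-low {M} {K} (∧-right {represents M} r) Y (λ _ _ _ → refl) f) (≤-reflexive w≡n)

      rank+K : rank + K ≡ n
      rank+K = ≤-antisym (low (chosen X) (free-sound {M} {X} (proj₁ split)))
        (≤-pred (≤-trans (s≤s (≤-reflexive (sym w≡n)))
          (≤-trans (≤ᵇ-false {rank + suc K} {w} (proj₂ split)) (≤-reflexive (+-suc rank K)))))

      free′ : Free (asMat (finite-mat A)) V (chosen X)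
      free′ = Free-cong {A} {asMat (finite-mat A)} {chosen X} {chosen X} (λ i j p q _ _ → ≡⇒≈ (sym (as-finite A i j p q))) (λ _ _ → refl) (free-sound {M} {X} (proj₁ split))

      largest : ∀ m → ∃[ f ] IndependentColumns F {n} {m} (finite-mat A) f → m ≤ rank
      largest m (f , ind) = let Y , fr , le = columns-free {finite-mat A} f ind in
        ≤-trans le (+-cancelʳ-≤ K _ _ (≤-trans (low Y (Free-cong {asMat (finite-mat A)} {A} {Y} {Y}
          (λ i j p q _ _ → ≡⇒≈ (as-finite A i j p q)) (λ _ _ → refl) fr)) (≤-reflexive (sym rank+K))))

      -- A matrix of rank `r′` passes the test for the gap `n ∸ r′`, so this gap is at most K.
      smallest : ∀ r′ → ∃[ A′ ] Represents F A′ G × IsRank F A′ r′ → rank ≤ r′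
      smallest r′ (A′ , rep′ , (f , ind) , max′) = +-cancelʳ-≤ (n ∸ r′) _ _
          (≤-trans (+-monoʳ-≤ rank (max (n ∸ r′) (ranked-complete (asMat A′ , represented rep′ , bound))))
            (≤-reflexive (trans rank+K (sym (m+[n∸m]≡n r′≤n)))))
        where
          r′≤n : r′ ≤ n
          r′≤n = let Y , _ , le = columns-free {A′} f ind in ≤-trans le (count≤n n Y)
          bound : ∀ Y → Sub n Y V → Free (asMat A′) V Y → count n Y + (n ∸ r′) ≤ w
          bound Y _ fr = ≤-trans (+-monoˡ-≤ (n ∸ r′) (max′ (count n Y) (free-columns {A′} {Y} fr)))
            (≤-reflexive (trans (m+[n∸m]≡n r′≤n) (sym w≡n)))

-- Running times

module Finish (n k : ℕ) (G : Graph n) (R X L : ℕ) (64≤R : 64 ≤ R) (1≤X : 1 ≤ X) (1≤L : 1 ≤ L) where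
  open Machine n k G R X L 64≤R 1≤X 1≤L

  finish : ∀ {e v δ ε} → J (0 , λ _ → 0) e v δ ε →
    ∃[ s ] ∃[ t ] ⟨ e 0 ⨾ 0 [ lit 0 ]≔ cell 0 , input G k ⟩⇓⟨ s , t ⟩ × t ≤ 64 * Budget δ ε × output s ≡ v
  finish {e} {v} {δ} {ε} j = slower time (begins ⟫ λ s a → store s 0 0 (eval s (cell 0)) , _ , assign ,
      +-mono-≤ (+-monoˡ-≤ 1 (s≤s (cost-cell s 0 (subst (_< 2 ^ L) (sym (After.val a)) (small j)))))
        (bits≤ 1≤L (subst (_< 2 ^ L) (sym (After.val a)) (small j))) , After.val a)
    where
      begins : Runs (e 0) 0 (input G k) v (Budget δ ε)
      begins = run j 0 (λ _ → 0) (≤-refl , λ _ ()) (input G k) (intact refl refl λ _ → refl) (λ _ ())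

      time : Budget δ ε + (1 + 3 * L + 1 + L) ≤ 64 * Budget δ ε
      time = ≤-trans (+-monoʳ-≤ (Budget δ ε) (≤-trans (≤-reflexive (lemma₁ L))
          (≤-trans (+-monoʳ-≤ (4 * L) (+-mono-≤ 1≤L 1≤L)) (≤-trans (≤-reflexive (lemma₂ L)) (*-monoʳ-≤ 6 (L≤Budget δ ε))))))
        (*-monoˡ-≤ (Budget δ ε) {7} {64} (≤ᵇ⇒≤ 7 64 _))
        where
          lemma₁ : ∀ l → 1 + 3 * l + 1 + l ≡ 4 * l + 2
          lemma₁ = solve-∀
          lemma₂ : ∀ l → 4 * l + (l + l) ≡ 6 * l
          lemma₂ = solve-∀

decide : ∀ {a} {Π : Set a} {b o} → o ≡ 𝟙 b → (b ≡ true → Π) → (Π → b ≡ true) → (o ≡ 1 × Π) ⊎ (o ≡ 0 × ¬ Π)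
decide {b = true}  refl f g = inj₁ (refl , f refl)
decide {b = false} refl f g = inj₂ (refl , λ p → absurd (g p) refl)

*-^ : ∀ a b d → (a * b) ^ d ≡ a ^ d * b ^ d
*-^ a b zero    = refl
*-^ a b (suc d) = trans (cong (a * b *_) (*-^ a b d)) (shuffle a b (a ^ d) (b ^ d))
  where shuffle : ∀ a b x y → a * b * (x * y) ≡ a * x * (b * y)
        shuffle = solve-∀

-- For d > 0, N is at most (N / d + 1) d, hence at most 2 ^ (N / d) d; the d-th power gives the
-- bound.
power≤exponential : ∀ N d → N ^ d ≤ d ^ d * 2 ^ N
power≤exponential N zero    = ≤-trans (m^n>0 2 N) (≤-reflexive (sym (+-identityʳ (2 ^ N))))
power≤exponential N (suc d) = begin
  N ^ suc d                              ≤⟨ ^-monoˡ-≤ (suc d) N≤ ⟩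
  (2 ^ (N / suc d) * suc d) ^ suc d      ≡⟨ *-^ (2 ^ (N / suc d)) (suc d) (suc d) ⟩
  (2 ^ (N / suc d)) ^ suc d * suc d ^ suc d ≡⟨ cong (_* suc d ^ suc d) (^-*-assoc 2 (N / suc d) (suc d)) ⟩
  2 ^ (N / suc d * suc d) * suc d ^ suc d ≤⟨ *-monoˡ-≤ (suc d ^ suc d) (^-monoʳ-≤ 2 (m/n*n≤m N (suc d))) ⟩
  2 ^ N * suc d ^ suc d                  ≡⟨ *-comm (2 ^ N) (suc d ^ suc d) ⟩
  suc d ^ suc d * 2 ^ N                  ∎
  where
    open ≤-Reasoning
    N≤ : N ≤ 2 ^ (N / suc d) * suc d
    N≤ = ≤-trans (≤-trans (≤-reflexive (m≡m%n+[m/n]*n N (suc d))) (+-monoˡ-≤ (N / suc d * suc d) (<⇒≤ (m%n<n N (suc d)))))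
      (*-monoˡ-≤ (suc d) (n<2^n (N / suc d)))

^≤2^* : ∀ q x → q ^ x ≤ 2 ^ (q * x)
^≤2^* q x = ≤-trans (^-monoˡ-≤ x (<⇒≤ (n<2^n q))) (≤-reflexive (^-*-assoc 2 q x))

-- The number of words in the brute-force search on a core.
words : ℕ → ℕ → ℕ
words q k = q ^ (3 * (k ∸ 1))

-- The three vertices saved by the kernel are worth a factor q ^ 3 ≥ 8 in the number of words; this
-- factor pays for every exponential loop of the code searches.
8words≤ : ∀ {q} k → 2 ≤ q → 1 ≤ k → 8 * words q k ≤ q ^ (3 * k)
8words≤ {q} (suc m) 2≤q _ = ≤-trans (*-monoˡ-≤ (words q (suc m)) (^-monoˡ-≤ 3 2≤q))
  (≤-reflexive (trans (sym (^-distribˡ-+-* q 3 (3 * m))) (cong (q ^_) (sym (*-suc 3 m)))))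

-- Opaque, as are the overheads below: comparing powers with large literal exponents
-- would otherwise unfold them.
opaque
  rough : ℕ → ℕ → ℕ → ℕ → ℕ
  rough q d ε k = words q k ^ d * 2 ^ (ε * words q k)

  rough-def : ∀ q d ε k → rough q d ε k ≡ words q k ^ d * 2 ^ (ε * words q k)
  rough-def q d ε k = refl

  overhead : ℕ → ℕ → ℕ → ℕ → ℕ
  overhead a c d n = a * (c * (1 + n) ^ 2) ^ d

  overhead-def : ∀ a c d n → overhead a c d n ≡ a * (c * (1 + n) ^ 2) ^ d
  overhead-def a c d n = refl

overhead-polynomial : ∀ a c d → Polynomial (overhead a c d)
overhead-polynomial a c d = a * c ^ d , 2 * d , λ n → ≤-reflexive (trans (overhead-def a c d n) (trans
  (cong (a *_) (trans (*-^ c ((1 + n) ^ 2) d) (cong (c ^ d *_) (^-*-assoc (1 + n) 2 d)))) (sym (*-assoc a (c ^ d) _))))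

module Growth (q : ℕ) (2≤q : 2 ≤ q) where

  -- At k = 0 there is a single word.
  rough-Õ : ∀ d ε (g : ℕ → ℕ) → (∀ k → 1 ≤ g k) →
    (∀ k → 8 * words q k ≤ q ^ (3 * k) → 2 ^ (suc ε * words q k) ≤ g k) → rough q d ε ∈Õ g
  rough-Õ d ε g g≥1 fast = d ^ d * 2 ^ suc ε , 0 , bound
    where
      open ≤-Reasoning
      split : ∀ k → rough q d ε k ≤ d ^ d * 2 ^ (suc ε * words q k)
      split k = begin
        rough q d ε k                                 ≡⟨ rough-def q d ε k ⟩
        words q k ^ d * 2 ^ (ε * words q k)           ≤⟨ *-monoˡ-≤ (2 ^ (ε * words q k)) (power≤exponential (words q k) d) ⟩
        d ^ d * 2 ^ words q k * 2 ^ (ε * words q k)   ≡⟨ *-assoc (d ^ d) _ _ ⟩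
        d ^ d * (2 ^ words q k * 2 ^ (ε * words q k)) ≡⟨ cong (d ^ d *_) (^-distribˡ-+-* 2 (words q k) (ε * words q k)) ⟨
        d ^ d * 2 ^ (suc ε * words q k)               ∎

      bound : ∀ k → rough q d ε k ≤ d ^ d * 2 ^ suc ε * g k * 1
      bound zero = begin
        rough q d ε 0                   ≤⟨ split 0 ⟩
        d ^ d * 2 ^ (suc ε * 1)       ≡⟨ cong (λ z → d ^ d * 2 ^ z) (*-identityʳ (suc ε)) ⟩
        d ^ d * 2 ^ suc ε             ≡⟨ *-identityʳ _ ⟨
        d ^ d * 2 ^ suc ε * 1         ≤⟨ *-monoʳ-≤ (d ^ d * 2 ^ suc ε) (g≥1 0) ⟩
        d ^ d * 2 ^ suc ε * g 0       ≡⟨ *-identityʳ _ ⟨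
        d ^ d * 2 ^ suc ε * g 0 * 1   ∎
      bound (suc k) = begin
        rough q d ε (suc k)                         ≤⟨ split (suc k) ⟩
        d ^ d * 2 ^ (suc ε * words q (suc k))     ≤⟨ *-mono-≤ (≤-trans (≤-reflexive (sym (*-identityʳ (d ^ d)))) (*-monoʳ-≤ (d ^ d) (m^n>0 2 (suc ε))))
                                                      (fast (suc k) (8words≤ (suc k) 2≤q z<s)) ⟩
        d ^ d * 2 ^ suc ε * g (suc k)             ≡⟨ *-identityʳ _ ⟨
        d ^ d * 2 ^ suc ε * g (suc k) * 1         ∎

≤÷ : ∀ x u v .{{_ : NonZero v}} → x * v ≤ u → x ≤ ⌈ u ÷ v ⌉
≤÷ x u v p = ≤-trans (≤-reflexive (sym (m*n/n≡m x v))) (/-monoˡ-≤ v (≤-trans p (m≤m+n u (v ∸ 1))))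

-- 1.1996 ^ 4 ≥ 2.
2^≤1·1996^ : ∀ j M → 4 * j ≤ M → 2 ^ j ≤ ⌈1·1996^ M ⌉
2^≤1·1996^ j M p = ≤÷ (2 ^ j) (11996 ^ M) (10000 ^ M) {{m^n≢0 10000 M}} (subst (λ M → 2 ^ j * 10000 ^ M ≤ 11996 ^ M) (m+[n∸m]≡n p) (begin
  2 ^ j * 10000 ^ (4 * j + (M ∸ 4 * j))        ≡⟨ cong (2 ^ j *_) (^-distribˡ-+-* 10000 (4 * j) (M ∸ 4 * j)) ⟩
  2 ^ j * (10000 ^ (4 * j) * 10000 ^ (M ∸ 4 * j)) ≡⟨ *-assoc (2 ^ j) _ _ ⟨
  2 ^ j * 10000 ^ (4 * j) * 10000 ^ (M ∸ 4 * j) ≤⟨ *-mono-≤ main (^-monoˡ-≤ (M ∸ 4 * j) (≤ᵇ⇒≤ 10000 11996 _)) ⟩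
  11996 ^ (4 * j) * 11996 ^ (M ∸ 4 * j)        ≡⟨ ^-distribˡ-+-* 11996 (4 * j) (M ∸ 4 * j) ⟨
  11996 ^ (4 * j + (M ∸ 4 * j))                ∎))
  where
    open ≤-Reasoning
    main : 2 ^ j * 10000 ^ (4 * j) ≤ 11996 ^ (4 * j)
    main = begin
      2 ^ j * 10000 ^ (4 * j)   ≡⟨ cong (2 ^ j *_) (^-*-assoc 10000 4 j) ⟨
      2 ^ j * (10000 ^ 4) ^ j   ≡⟨ *-^ 2 (10000 ^ 4) j ⟨
      (2 * 10000 ^ 4) ^ j       ≤⟨ ^-monoˡ-≤ j (≤ᵇ⇒≤ (2 * 10000 ^ 4) (11996 ^ 4) _) ⟩
      (11996 ^ 4) ^ j           ≡⟨ ^-*-assoc 11996 4 j ⟩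
      11996 ^ (4 * j)           ∎

conclude : ∀ {a} {Π : Set a} {P s₀ T b} →
  ∃[ s ] ∃[ t ] ⟨ P , s₀ ⟩⇓⟨ s , t ⟩ × t ≤ T × output s ≡ 𝟙 b → (b ≡ true → Π) → (Π → b ≡ true) →
  ∃[ s ] ∃[ t ] ⟨ P , s₀ ⟩⇓⟨ s , t ⟩ × t ≤ T × ((output s ≡ 1 × Π) ⊎ (output s ≡ 0 × ¬ Π))
conclude (s , t , r , le , e) f g = s , t , r , le , decide e f g

faster : ∀ {P s₀ T T′ v} → T ≤ T′ → ∃[ s ] ∃[ t ] ⟨ P , s₀ ⟩⇓⟨ s , t ⟩ × t ≤ T × output s ≡ v →
  ∃[ s ] ∃[ t ] ⟨ P , s₀ ⟩⇓⟨ s , t ⟩ × t ≤ T′ × output s ≡ v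
faster p (s , t , r , le , e) = s , t , r , ≤-trans le p , e

decider : (Term → Term → Term) → Program
decider bruteT = acceptsT bruteT 0 ⨾ 0 [ lit 0 ]≔ cell 0

module CodeSetup (b : ℕ) (1≤b : 1 ≤ b) (κ : ℕ) (n : ℕ) (G : Graph n) (k : ℕ) where
  open GraphFacts G public

  -- `N*` counts as polynomial here, because powers of it are absorbed by 2 ^ `N*` in the end. κ is
  -- 0 when all numbers have at most polynomially many bits in this sense, as for masks of sets of
  -- words, and 1 when whole tables of 2 ^ `N*` bits are stored.
  q N* R X L : ℕ
  q  = suc b
  N* = words q k
  R  = 64 + q + (n * n + n + N*)
  X  = 2 ^ N*
  L  = q * R * X ^ κ

  1≤N* : 1 ≤ N*
  1≤N* = m^n>0 q (3 * (k ∸ 1))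

  1≤X : 1 ≤ X
  1≤X = m^n>0 2 N*

  64≤R : 64 ≤ R
  64≤R = ≤-trans (m≤m+n 64 q) (m≤m+n (64 + q) _)

  q≤R : q ≤ R
  q≤R = ≤-trans (m≤n+m q 64) (m≤m+n (64 + q) _)

  n²≤R : n * n ≤ R
  n²≤R = ≤-trans (m≤m+n (n * n) n) (≤-trans (m≤m+n (n * n + n) N*) (m≤n+m _ (64 + q)))

  N*≤R : N* ≤ R
  N*≤R = ≤-trans (m≤n+m N* (n * n + n)) (m≤n+m _ (64 + q))

  N*<R : N* < R
  N*<R = ≤-trans (s≤s (m≤n+m N* (n * n + n))) (+-monoˡ-≤ (n * n + n + N*) (≤-trans (≤ᵇ⇒≤ 1 64 _) (m≤m+n 64 q)))

  n<R : n < R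
  n<R = ≤-trans (s≤s (≤-trans (m≤n+m n (n * n)) (m≤m+n (n * n + n) N*))) (+-monoˡ-≤ (n * n + n + N*) (≤-trans (≤ᵇ⇒≤ 1 64 _) (m≤m+n 64 q)))

  k≤1+N* : k ≤ suc N*
  k≤1+N* = ≤-trans (m≤n+m∸n k 1) (s≤s (≤-trans (<⇒≤ (n<2^n (k ∸ 1))) (≤-trans (^-monoˡ-≤ (k ∸ 1) (s≤s 1≤b)) (^-monoʳ-≤ q (m≤n*m (k ∸ 1) 3)))))

  k≤R : k ≤ R
  k≤R = ≤-trans k≤1+N* N*<R

  qR≤L : q * R ≤ L
  qR≤L = ≤-trans (≤-reflexive (sym (*-identityʳ (q * R)))) (*-monoʳ-≤ (q * R) (m^n>0 X {{>-nonZero 1≤X}} κ))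

  R≤L : R ≤ L
  R≤L = ≤-trans (m≤n*m R q) qR≤L

  1≤L : 1 ≤ L
  1≤L = ≤-trans (≤-trans (≤ᵇ⇒≤ 1 64 _) 64≤R) R≤L

  <2^L : ∀ {x} → x ≤ L → x < 2 ^ L
  <2^L p = ≤-trans (s≤s p) (n<2^n L)

  2k<2^L : k + k < 2 ^ L
  2k<2^L = <2^L (≤-trans (+-mono-≤ k≤R k≤R) (≤-trans (≤-trans (≤-reflexive (cong (R +_) (sym (+-identityʳ R)))) (*-monoˡ-≤ R (s≤s 1≤b))) qR≤L))

  -- The code size asked for is compared as a number. It may exceed `N*`, but by a factor of at most
  -- q, which is why `L` contains q.
  q^k<2^L : ∀ {m} → m ≤ k → q ^ m < 2 ^ L
  q^k<2^L {m} p = <2^L (≤-trans (^-monoʳ-≤ q (≤-trans p (m≤n+m∸n k 1)))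
    (≤-trans (*-monoʳ-≤ q (≤-trans (^-monoʳ-≤ q (m≤n*m (k ∸ 1) 3)) N*≤R)) qR≤L))

  open WordProgram n k G R X L 64≤R 1≤X 1≤L n²≤R (<2^L R≤L) (≤-trans n<R R≤L) 2k<2^L b q≤R public
  open Finish n k G R X L 64≤R 1≤X 1≤L public

  module _ {U : ℕ → Bool} (c≤ : count n U ≤ 3 * (k ∸ 1)) where

    universe≤N* : q ^ count n U ≤ N*
    universe≤N* = ^-monoʳ-≤ q c≤

    universe≤R : q ^ count n U ≤ R
    universe≤R = ≤-trans universe≤N* N*≤R

    universe<L : q ^ count n U < L
    universe<L = ≤-trans (s≤s universe≤N*) (≤-trans N*<R R≤L)

    subsets≤X : 2 ^ (q ^ count n U) ≤ X
    subsets≤X = ^-monoʳ-≤ 2 universe≤N*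

    subsets≤RX : 2 ^ (q ^ count n U) ≤ R * X ^ 1
    subsets≤RX = ≤-trans subsets≤X (≤-trans (≤-reflexive (sym (*-identityʳ X))) (m≤n*m (X ^ 1) R {{>-nonZero (≤-trans (≤ᵇ⇒≤ 1 64 _) 64≤R)}}))

  -- 2 ^ (2(k - 1)) is at most q ^ (3(k - 1)) = `N*`, so the search for A costs no factor `X`.
  subsets≤R : count n cover ≤ 2 * (k ∸ 1) → subsets ≤ R * X ^ 0
  subsets≤R c≤ = ≤R (≤-trans (^-monoʳ-≤ 2 (≤-trans c≤ (*-monoˡ-≤ (k ∸ 1) (≤ᵇ⇒≤ 2 3 _))))
    (≤-trans (^-monoˡ-≤ (3 * (k ∸ 1)) (s≤s 1≤b)) N*≤R))

  R≤ : R ≤ (66 + q) * (1 + n) ^ 2 * N*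
  R≤ = begin
    64 + q + (n * n + n + N*) ≤⟨ +-mono-≤ (≤-trans (≤-reflexive (sym (*-identityʳ (64 + q)))) (*-monoʳ-≤ (64 + q) 1≤z)) (+-mono-≤ n²+n≤z N*≤z) ⟩
    (64 + q) * z + (z + z)    ≡⟨ shuffle q z ⟩
    (66 + q) * z              ≡⟨ *-assoc (66 + q) ((1 + n) ^ 2) N* ⟨
    (66 + q) * (1 + n) ^ 2 * N* ∎
    where
      open ≤-Reasoning
      z = (1 + n) ^ 2 * N*
      1≤z : 1 ≤ z
      1≤z = *-mono-≤ {1} {_} {1} (m^n>0 (1 + n) 2) 1≤N*
      N*≤z : N* ≤ z
      N*≤z = ≤-trans (≤-reflexive (sym (*-identityˡ N*))) (*-monoˡ-≤ N* (m^n>0 (1 + n) 2))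
      n²+n≤z : n * n + n ≤ z
      n²+n≤z = ≤-trans (≤-trans (m≤m+n (n * n + n) (n + 1)) (≤-reflexive (square n)))
        (≤-trans (≤-reflexive (sym (*-identityʳ ((1 + n) ^ 2)))) (*-monoʳ-≤ ((1 + n) ^ 2) 1≤N*))
        where square : ∀ n → n * n + n + (n + 1) ≡ (1 + n) * ((1 + n) * 1)
              square = solve-∀
      shuffle : ∀ q z → (64 + q) * z + (z + z) ≡ (66 + q) * z
      shuffle = solve-∀

  time≤ : ∀ δ ε → 64 * Budget δ ε ≤ overhead (64 * q) (66 + q) (suc δ) n * rough q (suc δ) (ε + κ) k
  time≤ δ ε = begin
    64 * (R ^ δ * X ^ ε * (q * R * X ^ κ))          ≡⟨ shuffle (R ^ δ) (X ^ ε) q R (X ^ κ) ⟩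
    64 * q * (R * R ^ δ * (X ^ ε * X ^ κ))          ≡⟨ cong (λ z → 64 * q * (R ^ suc δ * z)) (^-distribˡ-+-* X ε κ) ⟨
    64 * q * (R ^ suc δ * X ^ (ε + κ))              ≡⟨ cong (λ z → 64 * q * (R ^ suc δ * z)) (trans (^-*-assoc 2 N* (ε + κ)) (cong (2 ^_) (*-comm N* (ε + κ)))) ⟩
    64 * q * (R ^ suc δ * E)                        ≤⟨ *-monoʳ-≤ (64 * q) (*-monoˡ-≤ E (^-monoˡ-≤ (suc δ) R≤)) ⟩
    64 * q * (((66 + q) * (1 + n) ^ 2 * N*) ^ suc δ * E) ≡⟨ cong (λ z → 64 * q * (z * E)) (*-^ ((66 + q) * (1 + n) ^ 2) N* (suc δ)) ⟩
    64 * q * (((66 + q) * (1 + n) ^ 2) ^ suc δ * N* ^ suc δ * E) ≡⟨ regroup (64 * q) (((66 + q) * (1 + n) ^ 2) ^ suc δ) (N* ^ suc δ) E ⟩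
    64 * q * ((66 + q) * (1 + n) ^ 2) ^ suc δ * (N* ^ suc δ * E)
      ≡⟨ cong₂ _*_ (overhead-def (64 * q) (66 + q) (suc δ) n) (rough-def q (suc δ) (ε + κ) k) ⟨
    overhead (64 * q) (66 + q) (suc δ) n * rough q (suc δ) (ε + κ) k ∎
    where
      open ≤-Reasoning
      E = 2 ^ ((ε + κ) * N*)
      shuffle : ∀ a x q r y → 64 * (a * x * (q * r * y)) ≡ 64 * q * (r * a * (x * y))
      shuffle = solve-∀
      regroup : ∀ s a b e → s * (a * b * e) ≡ s * a * (b * e)
      regroup = solve-∀

  within : ∀ {e v δ ε} → J (0 , λ _ → 0) e v δ ε →
    ∃[ s ] ∃[ t ] ⟨ e 0 ⨾ 0 [ lit 0 ]≔ cell 0 , input G k ⟩⇓⟨ s , t ⟩ × t ≤ overhead (64 * q) (66 + q) (suc δ) n * rough q (suc δ) (ε + κ) k × output s ≡ v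
  within {δ = δ} {ε} j = faster (time≤ δ ε) (finish j)

module CodeAlgorithms (b : ℕ) (1≤b : 1 ≤ b) where
  q : ℕ
  q = suc b

  open Growth q (s≤s 1≤b)

  module StorageRun (n : ℕ) (G : Graph n) (k : ℕ) where
    open CodeSetup b 1≤b 0 n G k hiding (q)
    open Colourings b n (edge G)
    open CodeLinks b G using (V; capacity-sound; capacity-complete)
    module K = KernelCorrect G k edge-sym edge-irr (storage-saving edge-sym)

    brute : (ℕ → Bool) → ℕ → Bool
    brute U m = Brute.stores U (q ^ m)

    search-J : J (0 , λ _ → 0) (acceptsT (storesT b)) (𝟙 (accepts brute)) 140 1
    search-J = Search.accepts-J K.cover≤ 0 (subsets≤R K.cover≤) brute (storesT b) 1
      λ {w} {W} {k′} {U} {m} c≤ m≤k jW jk → weakenᵇ (stores-J U (universe≤R c≤) (universe<L c≤) (subsets≤RX c≤) jW jk (≤-trans m≤k k≤R) (q^k<2^L m≤k))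

    accepted : accepts brute ≡ true → StorageCapacity q n G k
    accepted p = capacity-sound {k} (K.accepts-sound brute (λ U m _ → Brute.stores-sound U) (λ U m _ → Brute.stores-complete U) p)

    accepting : StorageCapacity q n G k → accepts brute ≡ true
    accepting p = K.accepts-complete brute (λ U m _ → Brute.stores-sound U) (λ U m _ → Brute.stores-complete U) (capacity-complete {k} p)

    outcome : ∃[ s ] ∃[ t ] ⟨ decider (storesT b) , input G k ⟩⇓⟨ s , t ⟩ × t ≤ overhead (64 * q) (66 + q) 141 n * rough q 141 (1 + 0) k ×
      ((output s ≡ 1 × StorageCapacity q n G k) ⊎ (output s ≡ 0 × ¬ StorageCapacity q n G k))
    outcome = conclude (within search-J) accepted accepting


  module IndexRun (n : ℕ) (G : Graph n) (k : ℕ) where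
    open CodeSetup b 1≤b 1 n G k hiding (q)
    open Colourings b n (edge G)
    open CodeLinks b G using (V; index-sound; index-complete)
    module K = KernelCorrect G k edge-sym edge-irr (indexable-saving 1≤b edge-sym)

    brute : (ℕ → Bool) → ℕ → Bool
    brute U = Table.indexes U

    search-J : J (0 , λ _ → 0) (acceptsT (indexesT b)) (𝟙 (accepts brute)) 140 3
    search-J = Search.accepts-J K.cover≤ 0 (subsets≤R K.cover≤) brute (indexesT b) 3
      λ {w} {W} {k′} {U} {m} c≤ _ jW jk → indexes-J U (universe≤R c≤) (universe<L c≤) (subsets≤RX c≤)
        -- This is where κ = 1 enters: a table has one bit for every set of words.
        (≤-trans (subsets≤X c≤) (≤-trans (≤-reflexive (sym (*-identityʳ X))) (m≤n*m (X ^ 1) (q * R)))) jW jk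

    accepted : accepts brute ≡ true → DualIndexCoding q n G k
    accepted p = index-sound {k} (K.accepts-sound brute (λ U m _ → Table.indexes-sound U) (λ U m _ → Table.indexes-complete U) p)

    accepting : DualIndexCoding q n G k → accepts brute ≡ true
    accepting p = K.accepts-complete brute (λ U m _ → Table.indexes-sound U) (λ U m _ → Table.indexes-complete U) (index-complete {k} p)

    outcome : ∃[ s ] ∃[ t ] ⟨ decider (indexesT b) , input G k ⟩⇓⟨ s , t ⟩ × t ≤ overhead (64 * q) (66 + q) 141 n * rough q 141 (3 + 1) k ×
      ((output s ≡ 1 × DualIndexCoding q n G k) ⊎ (output s ≡ 0 × ¬ DualIndexCoding q n G k))
    outcome = conclude (within search-J) accepted accepting


  storage-solvable : ∃[ p ] ∃[ f ] Polynomial p × (f ∈Õ λ k → ⌈1·1996^ q ^ (3 * k) ⌉) ×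
    Solvable StorageCapacity q InTime (λ n k → p n * f k)
  storage-solvable = overhead (64 * q) (66 + q) 141 , rough q 141 (1 + 0) , overhead-polynomial (64 * q) (66 + q) 141 ,
    rough-Õ 141 (1 + 0) _ (λ k → 2^≤1·1996^ 0 (q ^ (3 * k)) z≤n)
      -- One factor 2 ^ N for the search and one for the powers of N; times 4, from 1.1996 ^ 4 ≥ 2,
      -- this uses up the factor 8 exactly.
      (λ k p → 2^≤1·1996^ (2 * words q k) (q ^ (3 * k)) (≤-trans (≤-reflexive (sym (*-assoc 4 2 (words q k)))) p)) ,
    decider (storesT b) , StorageRun.outcome

  index-solvable : ∃[ p ] ∃[ f ] Polynomial p × (f ∈Õ λ k → 2 ^ (q ^ (3 * k))) ×
    Solvable DualIndexCoding q InTime (λ n k → p n * f k)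
  index-solvable = overhead (64 * q) (66 + q) 141 , rough q 141 (3 + 1) , overhead-polynomial (64 * q) (66 + q) 141 ,
    rough-Õ 141 (3 + 1) _ (λ k → m^n>0 2 (q ^ (3 * k)))
      -- Five factors 2 ^ N: three from a round of the table, one from the length of its numbers,
      -- one for the powers of N.
      (λ k p → ^-monoʳ-≤ 2 (≤-trans (*-monoˡ-≤ (words q k) (≤ᵇ⇒≤ 5 8 _)) p)) ,
    decider (indexesT b) , IndexRun.outcome

module RankAlgorithm {c ℓ} (F : FiniteField c ℓ) where
  open Coding (coding F) using (b; order≡; enc; enc<; dec; dec-enc)
  open FieldTables F (coding F)

  -- In a field with a single code, 0 and 1 would coincide.
  1≤b : 1 ≤ b
  1≤b with b in e
  ... | suc _ = z<s
  ... | zero  = ⊥-elim (0≉1 (FiniteField.trans F (FiniteField.sym F (dec-enc 0#))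
      (FiniteField.trans F (FiniteField.reflexive F (cong dec (trans (enc≡0 0#) (sym (enc≡0 1#))))) (dec-enc 1#))))
    where
      open FiniteField F using (0#; 1#; 0≉1)
      enc≡0 : ∀ x → enc x ≡ 0
      enc≡0 x = n<1⇒n≡0 (subst (λ b → enc x < suc b) e (enc< x))

  constant : ℕ
  constant = 64 + (q * q + (tadd + tmul))

  module Run (n : ℕ) (G : Graph n) (k : ℕ) where
    open GraphFacts G

    -- `X` is q ^ (k - 1), so that powers of q with exponent e (k - 1) are powers of `X`. The factor
    -- `X` in `L` makes room for k, which no function of n bounds; the summand `q * (n * n)` of `R`
    -- makes room for the codes of matrices.
    m R X L : ℕ
    m = k ∸ 1
    R = constant + (n * n + n) + q * (n * n)
    X = q ^ m
    L = R * X

    1≤X : 1 ≤ X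
    1≤X = m^n>0 q m

    constant≤R : constant ≤ R
    constant≤R = ≤-trans (m≤m+n constant _) (m≤m+n _ (q * (n * n)))

    64≤R : 64 ≤ R
    64≤R = ≤-trans (m≤m+n 64 _) constant≤R

    instance
      R-nonZero : NonZero R
      R-nonZero = >-nonZero (≤-trans (≤ᵇ⇒≤ 1 64 _) 64≤R)
      X-nonZero : NonZero X
      X-nonZero = >-nonZero 1≤X

    n²+n≤R : n * n + n ≤ R
    n²+n≤R = ≤-trans (m≤n+m _ constant) (m≤m+n _ (q * (n * n)))

    n<R : n < R
    n<R = ≤-trans (+-mono-≤ {1} {constant} (≤-trans (≤ᵇ⇒≤ 1 64 _) (m≤m+n 64 _)) (m≤n+m n (n * n))) (m≤m+n _ (q * (n * n)))

    q²≤R : q * q ≤ R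
    q²≤R = ≤-trans (≤-trans (m≤m+n (q * q) _) (m≤n+m _ 64)) constant≤R

    tables≤R : tadd + tmul ≤ R
    tables≤R = ≤-trans (≤-trans (m≤n+m _ (q * q)) (m≤n+m _ 64)) constant≤R

    qn²<R : q * (n * n) < R
    qn²<R = +-monoˡ-≤ (q * (n * n)) (≤-trans (≤-trans (≤ᵇ⇒≤ 1 64 _) (m≤m+n 64 _)) (m≤m+n constant (n * n + n)))

    R≤L : R ≤ L
    R≤L = m≤m*n R X

    1≤L : 1 ≤ L
    1≤L = ≤-trans (≤-trans (≤ᵇ⇒≤ 1 64 _) 64≤R) R≤L

    <2^L : ∀ {x} → x ≤ L → x < 2 ^ L
    <2^L p = ≤-trans (s≤s p) (n<2^n L)

    k≤X : k ≤ X
    k≤X = ≤-trans (m≤n+m∸n k 1) (≤-trans (n<2^n m) (^-monoˡ-≤ m (s≤s 1≤b)))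

    2k<2^L : k + k < 2 ^ L
    2k<2^L = <2^L (≤-trans (+-mono-≤ k≤X k≤X) (≤-trans (≤-reflexive (cong (X +_) (sym (+-identityʳ X))))
      (*-monoˡ-≤ X (≤-trans (≤ᵇ⇒≤ 2 64 _) 64≤R))))

    n+k<2^L : ∀ {i} → i ≤ k → n + i < 2 ^ L
    n+k<2^L {i} p = <2^L (≤-trans (+-mono-≤ (m≤m*n n X) (≤-trans p k≤X))
      (≤-trans (≤-reflexive (+-comm (n * X) X)) (*-monoˡ-≤ X n<R)))

    ≤RX : ∀ e {x} → x ≤ X ^ e → x ≤ R * X ^ e
    ≤RX e p = ≤-trans p (m≤n*m (X ^ e) R)

    power : ∀ e {x} → x ≤ m * e → q ^ x ≤ X ^ e
    power e p = ≤-trans (^-monoʳ-≤ q p) (≤-reflexive (sym (^-*-assoc q m e)))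

    open RankProgram F (coding F) n k G R X L 64≤R 1≤X 1≤L n²+n≤R (<2^L R≤L) (≤-trans n<R R≤L) 2k<2^L q²≤R
      hiding (q; tadd; tmul; rankedT)
    open Finish n k G R X L 64≤R 1≤X 1≤L
    open RankLinks F G using (V; rank-sound; rank-complete)
    open Representations F n (edge G) using (lowRank-saving)
    module K = KernelCorrect G k edge-sym edge-irr (lowRank-saving edge-sym)

    brute : (ℕ → Bool) → ℕ → Bool
    brute U = CodedRank.ranked F (coding F) n (edge G) U

    subsets≤ : subsets ≤ R * X ^ 2
    subsets≤ = ≤RX 2 (≤-trans (^-monoʳ-≤ 2 K.cover≤) (≤-trans (^-monoˡ-≤ (2 * m) (s≤s 1≤b)) (power 2 (≤-reflexive (*-comm 2 m)))))

    brute-J : ∀ {w W k′ U i} → count n U ≤ 3 * m → i ≤ k → Bits w W U → J w k′ i 1 0 →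
      J w (rankedT W k′) (𝟙 (brute U i)) 110 (9 * m + 6)
    brute-J {U = U} c≤ i≤k jW jk = weakenᵇ (ranked-J U
        (<2^L (≤-trans (≤-trans (m≤m+n tadd tmul) tables≤R) R≤L)) (<2^L (≤-trans (≤-trans (m≤n+m tmul tadd) tables≤R) R≤L))
        (9 * m) 3 3
        (≤RX (9 * m) (power (9 * m) (≤-trans (*-mono-≤ c≤ c≤) (≤-reflexive (square m)))))
        (≤RX 3 q^w≤) (≤RX 3 (≤-trans (^-monoˡ-≤ (count n U) (s≤s 1≤b)) q^w≤))
        (small-power (*-mono-≤ w≤n w≤n)) (small-power (≤-trans w≤n (n≤n² n)))
        (^-monoʳ-< 2 ≤-refl (≤-trans (s≤s w≤n) (≤-trans n<R R≤L)))
        jW jk (n+k<2^L i≤k))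
      where
        w≤n = count≤n n U
        q^w≤ : q ^ count n U ≤ X ^ 3
        q^w≤ = power 3 (≤-trans c≤ (≤-reflexive (*-comm 3 m)))
        square : ∀ m → 3 * m * (3 * m) ≡ m * (9 * m)
        square = solve-∀
        -- Codes of matrices on at most n vertices stay below q ^ (n²), hence have at most q n²
        -- bits, which is less than `R`.
        small-power : ∀ {x} → x ≤ n * n → q ^ x < 2 ^ L
        small-power {x} p = ≤-trans (s≤s (^≤2^* q x)) (^-monoʳ-< 2 ≤-refl (≤-trans (s≤s (*-monoʳ-≤ q p)) (≤-trans qn²<R R≤L)))

    search-J : J (0 , λ _ → 0) (acceptsT rankedT) (𝟙 (accepts brute)) 140 (2 + (2 + (9 * m + 6)))
    search-J = Search.accepts-J K.cover≤ 2 subsets≤ brute rankedT (9 * m + 6) brute-J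

    accepted : accepts brute ≡ true → DualMinrank F n G k
    accepted p = rank-sound {k} (K.accepts-sound brute (λ U i _ → CodedRank.ranked-sound F (coding F) n (edge G) U)
      (λ U i _ → CodedRank.ranked-complete F (coding F) n (edge G) U) p)

    accepting : DualMinrank F n G k → accepts brute ≡ true
    accepting p = K.accepts-complete brute (λ U i _ → CodedRank.ranked-sound F (coding F) n (edge G) U)
      (λ U i _ → CodedRank.ranked-complete F (coding F) n (edge G) U) (rank-complete {k} p)

    R≤ : R ≤ (suc constant + q) * (1 + n) ^ 2
    R≤ = begin
      constant + (n * n + n) + q * (n * n) ≤⟨ +-mono-≤ (+-mono-≤ (≤-trans (≤-reflexive (sym (*-identityʳ constant))) (*-monoʳ-≤ constant (m^n>0 (1 + n) 2))) n²+n≤) (*-monoʳ-≤ q n²≤) ⟩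
      constant * z + z + q * z             ≡⟨ shuffle constant q z ⟩
      (suc constant + q) * z               ∎
      where
        open ≤-Reasoning
        z = (1 + n) ^ 2
        n²+n≤ : n * n + n ≤ z
        n²+n≤ = ≤-trans (m≤m+n (n * n + n) (n + 1)) (≤-reflexive (square n))
          where square : ∀ n → n * n + n + (n + 1) ≡ (1 + n) * ((1 + n) * 1)
                square = solve-∀
        n²≤ : n * n ≤ z
        n²≤ = ≤-trans (m≤m+n (n * n) n) n²+n≤
        shuffle : ∀ c q z → c * z + z + q * z ≡ (suc c + q) * z
        shuffle = solve-∀

    -- The factors `X` are: 2 and 2 for the subsets of the cover, 9(k - 1) for the matrices, 3 and 3
    -- for sets of columns and coefficient vectors, 1 for the length of numbers. With m = k - 1 this
    -- makes 9m² + 11m, which falls short of 9(m + 1)² by 7m + 9.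
    exponent : ∀ k → (k ∸ 1) * (suc (2 + (2 + (9 * (k ∸ 1) + 6)))) ≤ 9 * k ^ 2
    exponent zero    = z≤n
    exponent (suc m) = ≤-trans (m≤m+n _ (7 * m + 9)) (≤-reflexive (expand m))
      where expand : ∀ m → m * (suc (2 + (2 + (9 * m + 6)))) + (7 * m + 9) ≡ 9 * ((1 + m) * ((1 + m) * 1))
            expand = solve-∀

    time≤ : ∀ δ ε → m * suc ε ≤ 9 * k ^ 2 → 64 * Budget δ ε ≤ overhead 64 (suc constant + q) (suc δ) n * FiniteField.order F ^ (9 * k ^ 2)
    time≤ δ ε e≤ = begin
      64 * (R ^ δ * X ^ ε * (R * X)) ≡⟨ shuffle (R ^ δ) (X ^ ε) R X ⟩
      64 * R ^ suc δ * X ^ suc ε     ≤⟨ *-monoˡ-≤ (X ^ suc ε) (*-monoʳ-≤ 64 (^-monoˡ-≤ (suc δ) R≤)) ⟩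
      64 * ((suc constant + q) * (1 + n) ^ 2) ^ suc δ * X ^ suc ε ≡⟨ cong (_* X ^ suc ε) (overhead-def 64 (suc constant + q) (suc δ) n) ⟨
      overhead 64 (suc constant + q) (suc δ) n * X ^ suc ε
        ≤⟨ *-monoʳ-≤ (overhead 64 (suc constant + q) (suc δ) n) (≤-trans (≤-reflexive (^-*-assoc q m (suc ε)))
             (≤-trans (^-monoʳ-≤ q e≤) (≤-reflexive (cong (_^ (9 * k ^ 2)) (sym order≡))))) ⟩
      overhead 64 (suc constant + q) (suc δ) n * FiniteField.order F ^ (9 * k ^ 2) ∎
      where
        open ≤-Reasoning
        shuffle : ∀ a x r y → 64 * (a * x * (r * y)) ≡ 64 * (r * a) * (y * x)
        shuffle = solve-∀

    within : ∀ {e v δ ε} → m * suc ε ≤ 9 * k ^ 2 → J (0 , λ _ → 0) e v δ ε →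
      ∃[ s ] ∃[ t ] ⟨ e 0 ⨾ 0 [ lit 0 ]≔ cell 0 , input G k ⟩⇓⟨ s , t ⟩ ×
        t ≤ overhead 64 (suc constant + q) (suc δ) n * FiniteField.order F ^ (9 * k ^ 2) × output s ≡ v
    within {δ = δ} {ε} e≤ j = faster (time≤ δ ε e≤) (finish j)

    outcome : ∃[ s ] ∃[ t ] ⟨ decider rankedT , input G k ⟩⇓⟨ s , t ⟩ ×
      t ≤ overhead 64 (suc constant + q) 141 n * FiniteField.order F ^ (9 * k ^ 2) ×
      ((output s ≡ 1 × DualMinrank F n G k) ⊎ (output s ≡ 0 × ¬ DualMinrank F n G k))
    outcome = conclude (within (exponent k) search-J) accepted accepting

  rank-solvable : ∃[ p ] Polynomial p ×
    Solvable DualMinrank F InTime (λ n k → p n * FiniteField.order F ^ (9 * k ^ 2))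
  rank-solvable = overhead 64 (suc constant + q) 141 , overhead-polynomial 64 (suc constant + q) 141 , decider rankedT , Run.outcome

theorem1p4 : ∀ {c ℓ} (q : ℕ) → 2 ≤ q → (F : FiniteField c ℓ) →
    (∃[ p ] ∃[ f ] Polynomial p × (f ∈Õ λ k → ⌈1·1996^ q ^ (3 * k) ⌉) ×
    Solvable StorageCapacity q InTime (λ n k → p n * f k)) ×
    (∃[ p ] ∃[ f ] Polynomial p × (f ∈Õ λ k → 2 ^ (q ^ (3 * k))) ×
    Solvable DualIndexCoding q InTime (λ n k → p n * f k)) ×
    (∃[ p ] Polynomial p ×
    Solvable DualMinrank F InTime (λ n k → p n * FiniteField.order F ^ (9 * k ^ 2)))
theorem1p4 (suc b) (s≤s 1≤b) F =
  CodeAlgorithms.storage-solvable b 1≤b , CodeAlgorithms.index-solvable b 1≤b , RankAlgorithm.rank-solvable F
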